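{- Let $h(N)$ be the maximal size of a subset of $[N]$ consisting of squarefree integers and having distinct subset products. Then $$h(N)\ge \pi(N)+\tfrac12\pi(N^{1/2})+o(\pi(N^{1/2})),$$ i.e. there is a function $E(N)$ with $E(N)/\pi(N^{1/2})\to0$ as $N\to\infty$ such that $h(N)\ge \pi(N)+\tfrac12\pi(N^{1/2})+E(N)$ for all $N$.
   Context: A finite set $A\subset\mathbb{N}$ has distinct subset products if for any two distinct subsets $B,C\subseteq A$ we have $\prod_{b\in B}b\neq\prod_{c\in C}c$. $\pi(x)$ denotes the number of primes $\le x$, and $[N]=\{1,\dots,N\}$. -}

module Defs where

open import Data.Nat using (ℕ; zero; suc; _*_; _≤_; _≤?_)
open import Data.Nat.Divisibility using (_∣_)
open import Data.Nat.Primality using (Prime; prime?)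
open import Data.Bool using (true; false; if_then_else_)
open import Data.List using (List; length; filter; upTo)
open import Data.Vec using (Vec; []; _∷_)
open import Data.Fin.Subset using (Subset)
open import Relation.Binary.PropositionalEquality using (_≡_; _≢_)
open import Data.Product using (_×_)
open import Relation.Nullary.Decidable using (_×-dec_)

primeCount : ℕ → ℕ
primeCount x = length (filter prime? (upTo (suc x)))

primeCountSqrt : ℕ → ℕ
primeCountSqrt N = length (filter (λ p → prime? p ×-dec (p * p ≤? N)) (upTo (suc N)))

SquareFree : ℕ → Set
SquareFree a = ∀ d → d * d ∣ a → d ≡ 1

prodSub : ∀ {n} → Vec ℕ n → Subset n → ℕ
prodSub [] [] = 1
prodSub (a ∷ as) (b ∷ bs) = (if b then a else 1) * prodSub as bs

-- A = (a_1,…,a_n) has distinct subset products: distinct index-subsets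
-- give distinct products (this forces the a_i to be pairwise distinct)
DistinctSubsetProducts : ∀ {n} → Vec ℕ n → Set
DistinctSubsetProducts {n} A = (B C : Subset n) → B ≢ C → prodSub A B ≢ prodSub A C

Admissible : ℕ → ℕ → Set
Admissible N a = (1 ≤ a × a ≤ N) × SquareFree a

{-# OPTIONS --safe #-}
-- Let p, q ≤ √N and r be primes with p q, p r, q r ≤ N. Replacing p, q, r by the four numbers p, p q, p r, q r keeps
-- subset products distinct and gains one element per two primes p, q ≤ √N. With z ≈ √N / Q we take p, q from the
-- window (j z, (j + 1) z] and r from (i z, (i + 1) z], i + j + 2 = 2 Q. So it suffices that all these windows contain
-- asymptotically equally many primes, that is ψ (a z) = a ψ (z) + o(z) for every integer a.
--
-- This form of the prime number theorem is proved along the lines of Richter's elementary proof. For the summatory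
-- function M of μ, the Turán–Kubilius inequality shows that M (x) / x is close to minus the average of
-- M (x / p) / (x / p) over any rich family of primes p. Comparing two families whose members differ by factors
-- slightly above 1 (they exist by Chebyshev's bounds) shows that M (x) / x varies slowly, so M (x) / x is close to
-- minus itself and M (x) = o(x). Finally ψ (a z) - a ψ (z) = ∑ μ (d) (T (a z / d) - a T (z / d)) with T (n) = log n!
-- is o(z) by the hyperbola method. Reals are avoided by working with integer multiples of rounded logarithms.
module Submission where

open import Defs
open import Data.Nat
open import Data.Nat.Properties
open import Data.Nat.Divisibility
open import Data.Nat.DivMod using (m/n*n≤m; m%n<n; m≡m%n+[m/n]*n; _/_)
open import Data.Nat.Primality
open import Data.Nat.Primality.Factorisation using (PrimeFactorisation; factorise; factorisationUnique; factors)
open import Data.Nat.ListAction using (sum; product)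
open import Data.Nat.ListAction.Properties using (sum-++; product-++; sum-↭)
open import Data.Nat.Tactic.RingSolver using (solve-∀)
import Data.Integer as ℤ
open ℤ using (ℤ; ∣_∣) renaming (+_ to pos)
import Data.Integer.Properties as ℤP
import Data.Integer.Tactic.RingSolver as ℤR
open import Data.Bool using (Bool; true; false; if_then_else_)
open import Data.List using (List; []; _∷_; _++_; length; filter; upTo; applyUpTo; map; zip)
open import Data.List.Properties using (map-++; map-∘; map-cong; length-++; length-map)
open import Data.List.Membership.Propositional using (_∈_; _∉_; find; lose)
open import Data.List.Membership.Propositional.Properties using (∈-map⁺; ∈-map⁻; ∈-++⁻; ∈-filter⁻; ∈-upTo⁻)
open import Data.List.Membership.DecPropositional _≟_ using (_∈?_)
open import Data.List.Relation.Unary.Any using (Any; here; there)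
open import Data.List.Relation.Unary.All as LAll using ([]; _∷_)
import Data.List.Relation.Unary.All.Properties as LAllP
import Data.List.Relation.Unary.Any as LAny
import Data.List.Relation.Binary.Permutation.Propositional.Properties as Perm
open import Data.List.Relation.Unary.Unique.Propositional using (Unique)
import Data.List.Relation.Unary.Unique.Propositional.Properties as Uniq
open import Data.List.Relation.Unary.AllPairs using ([]; _∷_)
open import Data.Product using (Σ; ∃; _×_; _,_; proj₁; proj₂)
open import Data.Sum using (_⊎_; inj₁; inj₂)
open import Data.Empty using (⊥; ⊥-elim)
open import Data.Vec using (Vec; []; _∷_; fromList)
open import Data.Vec.Relation.Unary.All using (All; []; _∷_)
open import Data.Fin.Subset using (Subset)
open import Function using (_∘_; id; case_of_)
open import Relation.Nullary using (¬_; Dec; yes; no; contradiction)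
open import Relation.Nullary.Decidable using (_×-dec_; ¬?)
open import Relation.Binary.PropositionalEquality

-- Finite sums, division and integer logarithms

-- The exponent vectors of p, p q, p r, q r lie in dimension three, so they are dependent: p² · q r
-- = p q · p r. Up to powers this is the only relation, and comparing two subset products allows
-- only the coefficients -1, 0, 1, which excludes the 2. If the pairwise products of three primes
-- are at most N, at most one of them exceeds √N; an extra element therefore costs two primes up to
-- √N, hence the factor 1/2. The obstacle is the supply of third primes: for p and q near t they
-- must come from a narrow window near N / t. Chebyshev's bounds do not even show that (i z, (i + 1)
-- z] contains a prime when i is large, so the strength of the prime number theorem comes in, but
-- only for ratios: ψ (z) is itself the unit of measurement, and its asymptotics are never
-- determined. The other delicate point is the order of choices behind M (x) = o(x). Each comparison
-- of two families costs an averaging error, and the number of comparisons depends on the gap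
-- between the ratios and 1; so this gap has to be fixed before the quality of the averaging.

∑ : {A : Set} → List A → (A → ℕ) → ℕ
∑ [] f = 0
∑ (x ∷ xs) f = f x + ∑ xs f

∑ℤ : {A : Set} → List A → (A → ℤ) → ℤ
∑ℤ [] f = pos 0
∑ℤ (x ∷ xs) f = f x ℤ.+ ∑ℤ xs f

rng : ℕ → List ℕ
rng zero = []
rng (suc n) = suc n ∷ rng n

∈-rng⁻ : ∀ {x} n → x ∈ rng n → 1 ≤ x × x ≤ n
∈-rng⁻ (suc n) (here refl) = s≤s z≤n , ≤-refl
∈-rng⁻ (suc n) (there i) = let a , b = ∈-rng⁻ n i in a , m≤n⇒m≤1+n b

length-rng : ∀ n → length (rng n) ≡ n
length-rng zero = refl
length-rng (suc n) = cong suc (length-rng n)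

module _ {A : Set} where

  ∑-cong∈ : ∀ (xs : List A) {f g : A → ℕ} → (∀ x → x ∈ xs → f x ≡ g x) → ∑ xs f ≡ ∑ xs g
  ∑-cong∈ [] h = refl
  ∑-cong∈ (x ∷ xs) h = cong₂ _+_ (h x (here refl)) (∑-cong∈ xs (λ y i → h y (there i)))

  ∑-cong : ∀ (xs : List A) {f g : A → ℕ} → (∀ x → f x ≡ g x) → ∑ xs f ≡ ∑ xs g
  ∑-cong xs h = ∑-cong∈ xs (λ x _ → h x)

  ∑-mono∈ : ∀ (xs : List A) {f g : A → ℕ} → (∀ x → x ∈ xs → f x ≤ g x) → ∑ xs f ≤ ∑ xs g
  ∑-mono∈ [] h = z≤n
  ∑-mono∈ (x ∷ xs) h = +-mono-≤ (h x (here refl)) (∑-mono∈ xs (λ y i → h y (there i)))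

  ∑-mono : ∀ (xs : List A) {f g : A → ℕ} → (∀ x → f x ≤ g x) → ∑ xs f ≤ ∑ xs g
  ∑-mono xs h = ∑-mono∈ xs (λ x _ → h x)

  ∑-+ : ∀ (xs : List A) (f g : A → ℕ) → ∑ xs (λ x → f x + g x) ≡ ∑ xs f + ∑ xs g
  ∑-+ [] f g = refl
  ∑-+ (x ∷ xs) f g rewrite ∑-+ xs f g = swap (f x) (g x) (∑ xs f) (∑ xs g)
    where
    swap : ∀ a b c d → a + b + (c + d) ≡ a + c + (b + d)
    swap = solve-∀

  ∑-*ˡ : ∀ (xs : List A) c (f : A → ℕ) → ∑ xs (λ x → c * f x) ≡ c * ∑ xs f
  ∑-*ˡ [] c f = sym (*-zeroʳ c)
  ∑-*ˡ (x ∷ xs) c f rewrite ∑-*ˡ xs c f = sym (*-distribˡ-+ c (f x) (∑ xs f))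

  ∑-*ʳ : ∀ (xs : List A) c (f : A → ℕ) → ∑ xs (λ x → f x * c) ≡ ∑ xs f * c
  ∑-*ʳ [] c f = refl
  ∑-*ʳ (x ∷ xs) c f rewrite ∑-*ʳ xs c f = sym (*-distribʳ-+ c (f x) (∑ xs f))

  ∑-const : ∀ (xs : List A) c → ∑ xs (λ _ → c) ≡ length xs * c
  ∑-const [] c = refl
  ∑-const (x ∷ xs) c = cong (c +_) (∑-const xs c)

  ∑-zero : ∀ (xs : List A) {f : A → ℕ} → (∀ x → x ∈ xs → f x ≡ 0) → ∑ xs f ≡ 0
  ∑-zero [] h = refl
  ∑-zero (x ∷ xs) h rewrite h x (here refl) = ∑-zero xs (λ y i → h y (there i))

  ∑-++ : ∀ (xs ys : List A) (f : A → ℕ) → ∑ (xs ++ ys) f ≡ ∑ xs f + ∑ ys f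
  ∑-++ [] ys f = refl
  ∑-++ (x ∷ xs) ys f rewrite ∑-++ xs ys f = sym (+-assoc (f x) (∑ xs f) (∑ ys f))

  ∑ℤ-cong∈ : ∀ (xs : List A) {f g : A → ℤ} → (∀ x → x ∈ xs → f x ≡ g x) → ∑ℤ xs f ≡ ∑ℤ xs g
  ∑ℤ-cong∈ [] h = refl
  ∑ℤ-cong∈ (x ∷ xs) h = cong₂ ℤ._+_ (h x (here refl)) (∑ℤ-cong∈ xs (λ y i → h y (there i)))

  ∑ℤ-cong : ∀ (xs : List A) {f g : A → ℤ} → (∀ x → f x ≡ g x) → ∑ℤ xs f ≡ ∑ℤ xs g
  ∑ℤ-cong xs h = ∑ℤ-cong∈ xs (λ x _ → h x)

  ∑ℤ-+ : ∀ (xs : List A) (f g : A → ℤ) → ∑ℤ xs (λ x → f x ℤ.+ g x) ≡ ∑ℤ xs f ℤ.+ ∑ℤ xs g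
  ∑ℤ-+ [] f g = refl
  ∑ℤ-+ (x ∷ xs) f g rewrite ∑ℤ-+ xs f g = swap (f x) (g x) (∑ℤ xs f) (∑ℤ xs g)
    where
    swap : ∀ a b c d → a ℤ.+ b ℤ.+ (c ℤ.+ d) ≡ a ℤ.+ c ℤ.+ (b ℤ.+ d)
    swap = ℤR.solve-∀

  ∑ℤ-*ˡ : ∀ (xs : List A) c (f : A → ℤ) → ∑ℤ xs (λ x → c ℤ.* f x) ≡ c ℤ.* ∑ℤ xs f
  ∑ℤ-*ˡ [] c f = sym (ℤP.*-zeroʳ c)
  ∑ℤ-*ˡ (x ∷ xs) c f rewrite ∑ℤ-*ˡ xs c f = sym (ℤP.*-distribˡ-+ c (f x) (∑ℤ xs f))

  ∑ℤ-- : ∀ (xs : List A) (f g : A → ℤ) → ∑ℤ xs (λ x → f x ℤ.- g x) ≡ ∑ℤ xs f ℤ.- ∑ℤ xs g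
  ∑ℤ-- [] f g = refl
  ∑ℤ-- (x ∷ xs) f g rewrite ∑ℤ-- xs f g = swap (f x) (g x) (∑ℤ xs f) (∑ℤ xs g)
    where
    swap : ∀ a b c d → a ℤ.- b ℤ.+ (c ℤ.- d) ≡ a ℤ.+ c ℤ.- (b ℤ.+ d)
    swap = ℤR.solve-∀

  ∑ℤ-zero : ∀ (xs : List A) {f : A → ℤ} → (∀ x → x ∈ xs → f x ≡ pos 0) → ∑ℤ xs f ≡ pos 0
  ∑ℤ-zero [] h = refl
  ∑ℤ-zero (x ∷ xs) h rewrite h x (here refl) | ∑ℤ-zero xs (λ y i → h y (there i)) = refl

  ∑ℤ-pos : ∀ (xs : List A) (f : A → ℕ) → ∑ℤ xs (λ x → pos (f x)) ≡ pos (∑ xs f)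
  ∑ℤ-pos [] f = refl
  ∑ℤ-pos (x ∷ xs) f rewrite ∑ℤ-pos xs f = refl

  ∑ℤ-abs : ∀ (xs : List A) (f : A → ℤ) → ∣ ∑ℤ xs f ∣ ≤ ∑ xs (λ x → ∣ f x ∣)
  ∑ℤ-abs [] f = z≤n
  ∑ℤ-abs (x ∷ xs) f = ≤-trans (ℤP.∣i+j∣≤∣i∣+∣j∣ (f x) (∑ℤ xs f)) (+-monoʳ-≤ ∣ f x ∣ (∑ℤ-abs xs f))

module _ {A B : Set} where

  ∑-swap : ∀ (xs : List A) (ys : List B) (f : A → B → ℕ) →
    ∑ xs (λ x → ∑ ys (f x)) ≡ ∑ ys (λ y → ∑ xs (λ x → f x y))
  ∑-swap [] ys f = sym (∑-zero ys (λ _ _ → refl))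
  ∑-swap (x ∷ xs) ys f = trans (cong (∑ ys (f x) +_) (∑-swap xs ys f))
    (sym (∑-+ ys (f x) (λ y → ∑ xs (λ z → f z y))))

  ∑ℤ-swap : ∀ (xs : List A) (ys : List B) (f : A → B → ℤ) →
    ∑ℤ xs (λ x → ∑ℤ ys (f x)) ≡ ∑ℤ ys (λ y → ∑ℤ xs (λ x → f x y))
  ∑ℤ-swap [] ys f = sym (∑ℤ-zero ys (λ _ _ → refl))
  ∑ℤ-swap (x ∷ xs) ys f = trans (cong (ℤ._+_ (∑ℤ ys (f x))) (∑ℤ-swap xs ys f))
    (sym (∑ℤ-+ ys (f x) (λ y → ∑ℤ xs (λ z → f z y))))

∑-rng-+ : ∀ m n (f : ℕ → ℕ) → ∑ (rng (m + n)) f ≡ ∑ (rng m) f + ∑ (rng n) (λ i → f (m + i))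
∑-rng-+ m zero f rewrite +-identityʳ m = sym (+-identityʳ _)
∑-rng-+ m (suc n) f rewrite +-suc m n | ∑-rng-+ m n f = swap (f (suc (m + n))) (∑ (rng m) f) (∑ (rng n) (λ i → f (m + i)))
  where
  swap : ∀ a b c → a + (b + c) ≡ b + (a + c)
  swap = solve-∀

∑ℤ-rng-+ : ∀ m n (f : ℕ → ℤ) → ∑ℤ (rng (m + n)) f ≡ ∑ℤ (rng m) f ℤ.+ ∑ℤ (rng n) (λ i → f (m + i))
∑ℤ-rng-+ m zero f rewrite +-identityʳ m = sym (ℤP.+-identityʳ _)
∑ℤ-rng-+ m (suc n) f rewrite +-suc m n | ∑ℤ-rng-+ m n f = swap (f (suc (m + n))) (∑ℤ (rng m) f) (∑ℤ (rng n) (λ i → f (m + i)))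
  where
  swap : ∀ a b c → a ℤ.+ (b ℤ.+ c) ≡ b ℤ.+ (a ℤ.+ c)
  swap = ℤR.solve-∀

∑-rng-suc : ∀ n (f : ℕ → ℕ) → ∑ (rng (suc n)) f ≡ f 1 + ∑ (rng n) (λ i → f (suc i))
∑-rng-suc n f = trans (∑-rng-+ 1 n f) (cong (_+ ∑ (rng n) (λ i → f (suc i))) (+-identityʳ (f 1)))

∑-rng-mono : ∀ {m n} (f : ℕ → ℕ) → m ≤ n → ∑ (rng m) f ≤ ∑ (rng n) f
∑-rng-mono {m} {n} f m≤n = subst (λ k → ∑ (rng m) f ≤ ∑ (rng k) f) (m+[n∸m]≡n m≤n)
  (≤-trans (m≤m+n _ _) (≤-reflexive (sym (∑-rng-+ m (n ∸ m) f))))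

∑-rng-const : ∀ n c → ∑ (rng n) (λ _ → c) ≡ n * c
∑-rng-const n c = trans (∑-const (rng n) c) (cong (_* c) (length-rng n))

⟦_⟧ : ∀ {P : Set} → Dec P → ℕ
⟦ yes _ ⟧ = 1
⟦ no _ ⟧ = 0

⟦⟧≤1 : ∀ {P : Set} (d : Dec P) → ⟦ d ⟧ ≤ 1
⟦⟧≤1 (yes _) = ≤-refl
⟦⟧≤1 (no _) = z≤n

⟦⟧-true : ∀ {P : Set} (d : Dec P) → P → ⟦ d ⟧ ≡ 1
⟦⟧-true (yes _) p = refl
⟦⟧-true (no ¬p) p = contradiction p ¬p

⟦⟧-false : ∀ {P : Set} (d : Dec P) → ¬ P → ⟦ d ⟧ ≡ 0
⟦⟧-false (yes p) ¬p = contradiction p ¬p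
⟦⟧-false (no _) ¬p = refl

⟦⟧-mono : ∀ {P Q : Set} (d : Dec P) (e : Dec Q) → (P → Q) → ⟦ d ⟧ ≤ ⟦ e ⟧
⟦⟧-mono (yes p) e f rewrite ⟦⟧-true e (f p) = ≤-refl
⟦⟧-mono (no _) e f = z≤n

⟦⟧-iff : ∀ {P Q : Set} (d : Dec P) (e : Dec Q) → (P → Q) → (Q → P) → ⟦ d ⟧ ≡ ⟦ e ⟧
⟦⟧-iff d e f g = ≤-antisym (⟦⟧-mono d e f) (⟦⟧-mono e d g)

⟦⟧-× : ∀ {P Q R : Set} (d : Dec P) (e : Dec Q) (r : Dec R) → (P → Q → R) → (R → P × Q) →
  ⟦ d ⟧ * ⟦ e ⟧ ≡ ⟦ r ⟧
⟦⟧-× (yes p) e r f g = trans (+-identityʳ _) (⟦⟧-iff e r (f p) (proj₂ ∘ g))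
⟦⟧-× (no ¬p) e r f g = sym (⟦⟧-false r (¬p ∘ proj₁ ∘ g))

∑⟦⟧≤ : ∀ n {P : ℕ → Set} (P? : ∀ i → Dec (P i)) → ∑ (rng n) (λ i → ⟦ P? i ⟧) ≤ n
∑⟦⟧≤ n P? = ≤-trans (∑-mono (rng n) (λ i → ⟦⟧≤1 (P? i))) (≤-reflexive (trans (∑-rng-const n 1) (*-identityʳ n)))

∑-delta : ∀ n f (g : ℕ → ℕ) → 1 ≤ f → f ≤ n → ∑ (rng n) (λ p → ⟦ f ≟ p ⟧ * g p) ≡ g f
∑-delta zero f g 1≤f f≤0 = contradiction (≤-trans 1≤f f≤0) λ ()
∑-delta (suc n) f g 1≤f f≤n with f ≟ suc n
... | yes refl = trans (cong (g f + 0 +_) (∑-zero (rng n) λ p i →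
        cong (_* g p) (⟦⟧-false (suc n ≟ p) λ { refl → 1+n≰n (proj₂ (∈-rng⁻ n i)) })))
        (trans (+-identityʳ _) (+-identityʳ _))
... | no f≢ = ∑-delta n f g 1≤f (≤-pred (≤∧≢⇒< f≤n f≢))

-- Division with the junk value n ÷ 0 = 0, to avoid instance arguments under sums.
infixl 7 _÷_
_÷_ : ℕ → ℕ → ℕ
n ÷ zero = 0
n ÷ suc d = n / suc d

÷-lower : ∀ n d → (n ÷ d) * d ≤ n
÷-lower n zero = z≤n
÷-lower n (suc d) = m/n*n≤m n (suc d)

÷-upper : ∀ n {d} → 1 ≤ d → n < suc (n ÷ d) * d
÷-upper n {suc d} _ = subst (_< suc d + (n / suc d) * suc d) (sym (m≡m%n+[m/n]*n n (suc d)))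
  (+-monoˡ-< ((n / suc d) * suc d) (m%n<n n (suc d)))

÷-greatest : ∀ {q n d} → 1 ≤ d → q * d ≤ n → q ≤ n ÷ d
÷-greatest {q} {n} {d} 1≤d h = ≤-pred (*-cancelʳ-< d q (suc (n ÷ d)) (≤-<-trans h (÷-upper n 1≤d)))

÷-least : ∀ {q n d} → n < suc q * d → n ÷ d ≤ q
÷-least {q} {n} {d} h = ≤-pred (*-cancelʳ-< d (n ÷ d) (suc q) (≤-<-trans (÷-lower n d) h))

÷-unique : ∀ {q n d} → q * d ≤ n → n < suc q * d → n ÷ d ≡ q
÷-unique {q} {n} {zero} l u = contradiction (subst (n <_) (*-zeroʳ q) u) λ ()
÷-unique {q} {n} {suc d} l u = ≤-antisym (÷-least u) (÷-greatest (s≤s z≤n) l)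

÷-monoˡ : ∀ {m n} d → m ≤ n → m ÷ d ≤ n ÷ d
÷-monoˡ zero h = z≤n
÷-monoˡ {m} (suc d) h = ÷-greatest (s≤s z≤n) (≤-trans (÷-lower m (suc d)) h)

÷-≤ : ∀ n d → n ÷ d ≤ n
÷-≤ n zero = z≤n
÷-≤ n (suc d) = ≤-trans (m≤m*n (n ÷ suc d) (suc d)) (÷-lower n (suc d))

÷-antiʳ : ∀ n {d e} → 1 ≤ d → d ≤ e → n ÷ e ≤ n ÷ d
÷-antiʳ n {d} {e} 1≤d d≤e = ÷-greatest 1≤d (≤-trans (*-monoʳ-≤ (n ÷ e) d≤e) (÷-lower n e))

1≤* : ∀ {a b} → 1 ≤ a → 1 ≤ b → 1 ≤ a * b
1≤* = *-mono-≤

÷-÷ : ∀ n {a b} → 1 ≤ a → 1 ≤ b → n ÷ a ÷ b ≡ n ÷ (a * b)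
÷-÷ n {a} {b} 1≤a 1≤b = sym (÷-unique l u)
  where
  q = n ÷ a ÷ b
  l : q * (a * b) ≤ n
  l = ≤-trans (≤-reflexive (assoc q a b)) (≤-trans (*-monoˡ-≤ a (÷-lower (n ÷ a) b)) (÷-lower n a))
    where
    assoc : ∀ q a b → q * (a * b) ≡ q * b * a
    assoc = solve-∀
  u : n < suc q * (a * b)
  u = <-≤-trans (÷-upper n 1≤a) (≤-trans (*-monoˡ-≤ a (÷-upper (n ÷ a) 1≤b)) (≤-reflexive (assoc q a b)))
    where
    assoc : ∀ q a b → suc q * b * a ≡ suc q * (a * b)
    assoc = solve-∀

÷-zero : ∀ {n d} → n < d → n ÷ d ≡ 0
÷-zero {n} {d} h = ÷-unique {0} z≤n (subst (n <_) (sym (*-identityˡ d)) h)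

multiples : ∀ x {p} → 1 ≤ p → (F : ℕ → ℤ) →
  ∑ℤ (rng x) (λ m → pos ⟦ p ∣? m ⟧ ℤ.* F m) ≡ ∑ℤ (rng (x ÷ p)) (λ j → F (p * j))
multiples zero {p} 1≤p F = cong (λ q → ∑ℤ (rng q) (λ j → F (p * j))) (sym (÷-zero 1≤p))
multiples (suc x) {p} 1≤p F with p ∣? suc x
... | yes (divides zero ())
... | yes (divides (suc q) eq) =
  trans (cong₂ ℤ._+_ (trans (ℤP.*-identityˡ _) (cong F (trans eq (*-comm (suc q) p))))
          (trans (multiples x 1≤p F) (cong (λ r → ∑ℤ (rng r) (λ j → F (p * j))) x÷p)))
        (cong (λ r → ∑ℤ (rng r) (λ j → F (p * j))) (sym sx÷p))
  where
  sx÷p : suc x ÷ p ≡ suc q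
  sx÷p = ÷-unique (≤-reflexive (sym eq)) (subst (_< suc (suc q) * p) (sym eq) (+-monoˡ-≤ (suc q * p) 1≤p))
  x÷p : x ÷ p ≡ q
  x÷p = ÷-unique (≤-pred (subst (q * p <_) (sym eq) (+-monoˡ-≤ (q * p) 1≤p))) (≤-reflexive eq)
... | no p∤ = trans (ℤP.+-identityˡ _) (trans (multiples x 1≤p F)
    (cong (λ r → ∑ℤ (rng r) (λ j → F (p * j))) (sym sx÷p)))
  where
  sx÷p : suc x ÷ p ≡ x ÷ p
  sx÷p = ÷-unique (≤-trans (÷-lower x p) (n≤1+n x)) (≤∧≢⇒< (÷-upper x 1≤p) (λ e → p∤ (divides (suc (x ÷ p)) e)))

count-multiples : ∀ x {p} → 1 ≤ p → ∑ (rng x) (λ m → ⟦ p ∣? m ⟧) ≡ x ÷ p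
count-multiples x {p} 1≤p = ℤP.+-injective (trans (sym (∑ℤ-pos (rng x) _))
  (trans (∑ℤ-cong (rng x) λ m → sym (ℤP.*-identityʳ _)) (trans (multiples x 1≤p (λ _ → pos 1))
  (trans (∑ℤ-pos (rng (x ÷ p)) (λ _ → 1)) (cong pos (trans (∑-rng-const (x ÷ p) 1) (*-identityʳ _)))))))

lg-step : ∀ k n → Dec (2 ^ suc k ≤ n) → ℕ
lg-step k n (yes _) = suc k
lg-step k n (no _) = k

lg : ℕ → ℕ
lg zero = 0
lg (suc zero) = 0
lg (suc (suc n)) = lg-step (lg (suc n)) (suc (suc n)) (2 ^ suc (lg (suc n)) ≤? suc (suc n))

lg-spec : ∀ {n} → 1 ≤ n → 2 ^ lg n ≤ n × n < 2 ^ suc (lg n)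
lg-spec {suc zero} _ = s≤s z≤n , s≤s (s≤s z≤n)
lg-spec {suc (suc n)} _ with 2 ^ suc (lg (suc n)) ≤? suc (suc n) | lg-spec {suc n} (s≤s z≤n)
... | yes h | (a , b) = h , ≤-<-trans b (subst (2 ^ suc (lg (suc n)) <_) (cong (2 ^ suc (lg (suc n)) +_) (sym (+-identityʳ _)))
        (m<m+n (2 ^ suc (lg (suc n))) (m^n>0 2 (suc (lg (suc n))))))
... | no h | (a , b) = ≤-trans a (n≤1+n _) , ≰⇒> h

2^-cancel-≤ : ∀ {a b} → 2 ^ a ≤ 2 ^ b → a ≤ b
2^-cancel-≤ {a} {b} h with a ≤? b
... | yes p = p
... | no p = contradiction h (<⇒≱ (^-monoʳ-< 2 (s≤s (s≤s z≤n)) (≰⇒> p)))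

2^-cancel-< : ∀ {a b} → 2 ^ a < 2 ^ b → a < b
2^-cancel-< {a} {b} h with b ≤? a
... | yes p = contradiction h (≤⇒≯ (^-monoʳ-≤ 2 p))
... | no p = ≰⇒> p

n<2^n : ∀ n → n < 2 ^ n
n<2^n zero = s≤s z≤n
n<2^n (suc n) = ≤-trans (+-mono-≤ (m^n>0 2 n) (n<2^n n)) (≤-reflexive (cong (2 ^ n +_) (sym (+-identityʳ _))))

isqrt-step : ∀ k n → Dec (suc k * suc k ≤ n) → ℕ
isqrt-step k n (yes _) = suc k
isqrt-step k n (no _) = k

isqrt : ℕ → ℕ
isqrt zero = 0
isqrt (suc n) = isqrt-step (isqrt n) (suc n) (suc (isqrt n) * suc (isqrt n) ≤? suc n)

isqrt-spec : ∀ n → isqrt n * isqrt n ≤ n × n < suc (isqrt n) * suc (isqrt n)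
isqrt-spec zero = z≤n , s≤s z≤n
isqrt-spec (suc n) with suc (isqrt n) * suc (isqrt n) ≤? suc n | isqrt-spec n
... | yes h | (a , b) = h , <-≤-trans (s≤s b) (sq (isqrt n))
  where
  sq : ∀ s → suc (suc s * suc s) ≤ suc (suc s) * suc (suc s)
  sq s = ≤-trans (m≤m+n _ (s + s + 2)) (≤-reflexive (id' s))
    where
    id' : ∀ s → suc (suc s * suc s) + (s + s + 2) ≡ suc (suc s) * suc (suc s)
    id' = solve-∀
... | no h | (a , b) = ≤-trans a (n≤1+n _) , ≰⇒> h

-- Linear arithmetic by certificate: A ≤ B is a combination of the hypotheses, the second argument usually a ring identity.
by-lin : ∀ {A B a b} → A ≤ B → B + a ≤ A + b → a ≤ b
by-lin {A} {B} {a} {b} h k = +-cancelˡ-≤ A a b (≤-trans (+-monoˡ-≤ a h) k)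

-- Additive functions and the Möbius function

∈-rng⁺ : ∀ {x} n → 1 ≤ x → x ≤ n → x ∈ rng n
∈-rng⁺ {x} zero 1≤x x≤0 = contradiction (≤-trans 1≤x x≤0) λ ()
∈-rng⁺ {x} (suc n) 1≤x x≤n with x ≟ suc n
... | yes refl = here refl
... | no x≢ = there (∈-rng⁺ n 1≤x (≤-pred (≤∧≢⇒< x≤n x≢)))

prime≥2 : ∀ {p} → Prime p → 2 ≤ p
prime≥2 {p} pp = nonTrivial⇒n>1 p {{prime⇒nonTrivial pp}}

prime≥1 : ∀ {p} → Prime p → 1 ≤ p
prime≥1 pp = ≤-trans (s≤s z≤n) (prime≥2 pp)

prime∤1 : ∀ {p} → Prime p → ¬ p ∣ 1
prime∤1 pp d = contradiction (∣⇒≤ d) (<⇒≱ (prime≥2 pp))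

prime∣prime : ∀ {p q} → Prime p → Prime q → p ∣ q → p ≡ q
prime∣prime pp pq d with prime⇒irreducible pq d
... | inj₁ refl = contradiction (prime≥2 pp) λ { (s≤s ()) }
... | inj₂ e = e

product≥1 : ∀ {ps} → LAll.All Prime ps → 1 ≤ product ps
product≥1 [] = ≤-refl
product≥1 (p ∷ ps) = 1≤* (prime≥1 p) (product≥1 ps)

factor-ind : (P : ℕ → Set) → P 1 → (∀ p m → Prime p → 1 ≤ m → P m → P (p * m)) → ∀ n → 1 ≤ n → P n
factor-ind P P1 Pstep n@(suc _) _ = subst P (sym (PrimeFactorisation.isFactorisation f)) (go (PrimeFactorisation.factorsPrime f))
  where
  f = factorise n
  go : ∀ {ps} → LAll.All Prime ps → P (product ps)
  go [] = P1
  go (p ∷ ps) = Pstep _ _ p (product≥1 ps) (go ps)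

prime-divisor : ∀ n → 2 ≤ n → ∃ λ p → Prime p × p ∣ n
prime-divisor n 2≤n = factor-ind (λ n → 2 ≤ n → ∃ λ p → Prime p × p ∣ n)
  (λ { (s≤s ()) }) (λ p m pp _ _ _ → p , pp , m∣m*n m) n (≤-trans (s≤s z≤n) 2≤n) 2≤n

additive : (ℕ → ℕ) → ℕ → ℕ
additive h zero = 0
additive h n@(suc _) = sum (map h (factors (factorise n)))

additive-product : ∀ h {ps} → LAll.All Prime ps → additive h (product ps) ≡ sum (map h ps)
additive-product h {ps} pps = go (product ps) refl (product≥1 pps)
  where
  go : ∀ n → n ≡ product ps → 1 ≤ n → additive h n ≡ sum (map h ps)
  go n@(suc _) e _ = sum-↭ (Perm.map⁺ h (factorisationUnique (factorise n)
    (record { factors = ps ; isFactorisation = e ; factorsPrime = pps })))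

additive-* : ∀ h {m n} → 1 ≤ m → 1 ≤ n → additive h (m * n) ≡ additive h m + additive h n
additive-* h {m@(suc _)} {n@(suc _)} _ _ = begin
  additive h (m * n) ≡⟨ cong (additive h) (trans (cong₂ _*_ (isF f) (isF g)) (sym (product-++ (factors f) (factors g)))) ⟩
  additive h (product (factors f ++ factors g)) ≡⟨ additive-product h (LAllP.++⁺ (fP f) (fP g)) ⟩
  sum (map h (factors f ++ factors g)) ≡⟨ cong sum (map-++ h (factors f) (factors g)) ⟩
  sum (map h (factors f) ++ map h (factors g)) ≡⟨ sum-++ (map h (factors f)) _ ⟩
  additive h m + additive h n ∎
  where
  open ≡-Reasoning
  open PrimeFactorisation using () renaming (isFactorisation to isF; factorsPrime to fP)
  f = factorise m
  g = factorise n

additive-1 : ∀ h → additive h 1 ≡ 0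
additive-1 h = additive-product h []

additive-prime : ∀ h {p} → Prime p → additive h p ≡ h p
additive-prime h {p} pp = trans (cong (additive h) (sym (*-identityʳ p)))
  (trans (additive-product h (pp ∷ [])) (+-identityʳ (h p)))

1≤^ : ∀ {a} k → 1 ≤ a → 1 ≤ a ^ k
1≤^ {suc a} k _ = m^n>0 (suc a) k

additive-^ : ∀ h {a} k → 1 ≤ a → additive h (a ^ k) ≡ k * additive h a
additive-^ h zero 1≤a = additive-1 h
additive-^ h {a} (suc k) 1≤a = trans (additive-* h 1≤a (1≤^ k 1≤a)) (cong (additive h a +_) (additive-^ h k 1≤a))

valuation : ℕ → ℕ → ℕ
valuation p = additive (λ q → ⟦ p ≟ q ⟧)

valuation-∤ : ∀ {p} → Prime p → ∀ n → 1 ≤ n → ¬ p ∣ n → valuation p n ≡ 0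
valuation-∤ {p} pp = factor-ind (λ n → ¬ p ∣ n → valuation p n ≡ 0) (λ _ → additive-1 (λ q → ⟦ p ≟ q ⟧))
  λ q m pq 1≤m ih p∤ → trans (additive-* _ (prime≥1 pq) 1≤m)
    (cong₂ _+_ (trans (additive-prime _ pq) (⟦⟧-false (p ≟ q) λ { refl → p∤ (m∣m*n m) }))
      (ih (λ d → p∤ (∣n⇒∣m*n q d))))

valuation-self : ∀ {p} → Prime p → valuation p p ≡ 1
valuation-self {p} pp = trans (additive-prime _ pp) (⟦⟧-true (p ≟ p) refl)

hasSquare? : ∀ n → Dec (Any (λ q → Prime q × q * q ∣ n) (rng n))
hasSquare? n = LAny.any? (λ q → prime? q ×-dec (q * q ∣? n)) (rng n)

sgn : ℕ → ℤ
sgn zero = pos 1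
sgn (suc k) = ℤ.- sgn k

μ-dec : ∀ n → Dec (Any (λ q → Prime q × q * q ∣ n) (rng n)) → ℤ
μ-dec n (yes _) = pos 0
μ-dec n (no _) = sgn (additive (λ _ → 1) n)

-- Only squares of primes are tested, which is enough for squarefreeness and makes multiplication by
-- a prime easy to follow. The value at 0 is 1 by default; all sums start at 1.
μ : ℕ → ℤ
μ n = μ-dec n (hasSquare? n)

∣sgn∣ : ∀ k → ∣ sgn k ∣ ≡ 1
∣sgn∣ zero = refl
∣sgn∣ (suc k) = trans (ℤP.∣-i∣≡∣i∣ (sgn k)) (∣sgn∣ k)

∣μ∣≤1 : ∀ n → ∣ μ n ∣ ≤ 1
∣μ∣≤1 n with hasSquare? n
... | yes _ = z≤n
... | no _ = ≤-reflexive (∣sgn∣ (additive (λ _ → 1) n))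

μ-1 : μ 1 ≡ pos 1
μ-1 with hasSquare? 1
... | yes a = let q , _ , pq , d = find a in contradiction (∣-trans (m∣m*n q) d) (prime∤1 pq)
... | no _ = cong sgn (additive-1 (λ _ → 1))

μ-square : ∀ {q n} → 1 ≤ n → Prime q → q * q ∣ n → μ n ≡ pos 0
μ-square {q} {n} 1≤n pq d with hasSquare? n
... | yes _ = refl
... | no ¬s = contradiction (lose (∈-rng⁺ n (prime≥1 pq) (∣⇒≤ {{>-nonZero 1≤n}} (∣-trans (m∣m*n q) d))) (pq , d)) ¬s

-- If q = p, cancelling p would give p ∣ m; if q ≠ p, Euclid's lemma moves both factors q past p.
square∣prime* : ∀ {p q m} → Prime p → Prime q → ¬ p ∣ m → q * q ∣ p * m → q * q ∣ m
square∣prime* {p} {q} {m} pp pq p∤m d with p ≟ q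
... | yes refl = contradiction (*-cancelˡ-∣ p {{prime⇒nonZero pp}} d) p∤m
... | no p≢q with euclidsLemma p m pq (∣-trans (m∣m*n q) d)
... | inj₁ q∣p = contradiction (sym (prime∣prime pq pp q∣p)) p≢q
... | inj₂ (divides m' refl) with euclidsLemma p m' pq (*-cancelʳ-∣ q {{prime⇒nonZero pq}} (subst (q * q ∣_) (sym (*-assoc p m' q)) d))
... | inj₁ q∣p = contradiction (sym (prime∣prime pq pp q∣p)) p≢q
... | inj₂ q∣m' = *-monoˡ-∣ q q∣m'

μ-prime* : ∀ {p m} → Prime p → 1 ≤ m → ¬ p ∣ m → μ (p * m) ≡ ℤ.- μ m
μ-prime* {p} {m} pp 1≤m p∤m with hasSquare? (p * m) | hasSquare? m
... | yes _ | yes _ = refl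
... | no _ | no _ = cong sgn (trans (additive-* _ (prime≥1 pp) 1≤m) (cong (_+ additive (λ _ → 1) m) (additive-prime _ pp)))
... | yes a | no ¬b = let q , _ , pq , d = find a ; d' = square∣prime* pp pq p∤m d in
  contradiction (lose (∈-rng⁺ m (prime≥1 pq) (∣⇒≤ {{>-nonZero 1≤m}} (∣-trans (m∣m*n q) d'))) (pq , d')) ¬b
... | no ¬a | yes b = let q , _ , pq , d = find b ; d' = ∣n⇒∣m*n p d in
  contradiction (lose (∈-rng⁺ (p * m) (prime≥1 pq) (∣⇒≤ {{>-nonZero (1≤* (prime≥1 pp) 1≤m)}} (∣-trans (m∣m*n q) d'))) (pq , d')) ¬a

∑ℤ-rng-extend : ∀ {k D} (f : ℕ → ℤ) → k ≤ D → (∀ d → k < d → f d ≡ pos 0) → ∑ℤ (rng D) f ≡ ∑ℤ (rng k) f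
∑ℤ-rng-extend {k} {D} f k≤D h = trans (cong (λ n → ∑ℤ (rng n) f) (sym (m+[n∸m]≡n k≤D)))
  (trans (∑ℤ-rng-+ k (D ∸ k) f) (trans (cong (ℤ._+_ (∑ℤ (rng k) f))
    (∑ℤ-zero (rng (D ∸ k)) λ i i∈ → h (k + i) (m<m+n k (proj₁ (∈-rng⁻ (D ∸ k) i∈))))) (ℤP.+-identityʳ _)))

-- For n > 1 fix a prime p ∣ n. A divisor e with p ∤ e is paired with p e, where μ changes sign; the
-- divisors p e with p ∣ e contribute 0.
μ-divisor-sum : ∀ {n D} → 1 ≤ n → n ≤ D → ∑ℤ (rng D) (λ d → pos ⟦ d ∣? n ⟧ ℤ.* μ d) ≡ pos ⟦ n ≟ 1 ⟧
μ-divisor-sum {n} {D} 1≤n n≤D with n ≟ 1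
... | yes refl = trans (∑ℤ-rng-extend (λ d → pos ⟦ d ∣? 1 ⟧ ℤ.* μ d) n≤D
        (λ d 1<d → cong (λ t → pos t ℤ.* μ d) (⟦⟧-false (d ∣? 1) λ d∣1 → <⇒≱ 1<d (∣⇒≤ d∣1))))
      (trans (ℤP.+-identityʳ _) (trans (ℤP.*-identityˡ _) μ-1))
... | no n≢1 = begin
  ∑ℤ (rng D) F ≡⟨ ∑ℤ-cong (rng D) split ⟩
  ∑ℤ (rng D) (λ d → pos ⟦ p ∣? d ⟧ ℤ.* F d ℤ.+ G d) ≡⟨ ∑ℤ-+ (rng D) _ _ ⟩
  ∑ℤ (rng D) (λ d → pos ⟦ p ∣? d ⟧ ℤ.* F d) ℤ.+ ∑ℤ (rng D) G ≡⟨ cong₂ ℤ._+_ (trans (multiples D 1≤p F) (trans (∑ℤ-cong∈ (rng (D ÷ p)) reflect) (∑ℤ-*ˡ (rng (D ÷ p)) (ℤ.- pos 1) G)))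
                                                                                (∑ℤ-rng-extend G (÷-≤ D p) vanish) ⟩
  (ℤ.- pos 1) ℤ.* ∑ℤ (rng (D ÷ p)) G ℤ.+ ∑ℤ (rng (D ÷ p)) G ≡⟨ cancel (∑ℤ (rng (D ÷ p)) G) ⟩
  pos 0 ∎
  where
  open ≡-Reasoning
  cancel : ∀ x → (ℤ.- pos 1) ℤ.* x ℤ.+ x ≡ pos 0
  cancel = ℤR.solve-∀
  pd = prime-divisor n (≤∧≢⇒< 1≤n (n≢1 ∘ sym))
  p = proj₁ pd
  pp = proj₁ (proj₂ pd)
  p∣n = proj₂ (proj₂ pd)
  1≤p = prime≥1 pp
  F G : ℕ → ℤ
  F d = pos ⟦ d ∣? n ⟧ ℤ.* μ d
  G d = pos ⟦ ¬? (p ∣? d) ⟧ ℤ.* F d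
  split : ∀ d → F d ≡ pos ⟦ p ∣? d ⟧ ℤ.* F d ℤ.+ G d
  split d with p ∣? d
  ... | yes _ = sym (trans (ℤP.+-identityʳ _) (ℤP.*-identityˡ _))
  ... | no _ = sym (trans (ℤP.+-identityˡ _) (ℤP.*-identityˡ _))
  n' = _∣_.quotient p∣n
  coprime-part : ∀ {e} → ¬ p ∣ e → e ∣ n → p * e ∣ n
  coprime-part {e} p∤e (divides c eq) with euclidsLemma c e pp (subst (p ∣_) eq p∣n)
  ... | inj₁ (divides c' refl) = divides c' (trans eq (*-assoc c' p e))
  ... | inj₂ p∣e = contradiction p∣e p∤e
  reflect : ∀ e → e ∈ rng (D ÷ p) → F (p * e) ≡ (ℤ.- pos 1) ℤ.* G e
  reflect e e∈ with p ∣? e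
  ... | yes p∣e = trans (cong (ℤ._*_ (pos ⟦ p * e ∣? n ⟧)) (μ-square (1≤* 1≤p 1≤e) pp (*-monoʳ-∣ p p∣e))) (ℤP.*-zeroʳ (pos ⟦ p * e ∣? n ⟧))
    where 1≤e = proj₁ (∈-rng⁻ (D ÷ p) e∈)
  ... | no p∤e = trans (cong₂ (λ a b → pos a ℤ.* b) (⟦⟧-iff (p * e ∣? n) (e ∣? n) (∣-trans (n∣m*n p)) (coprime-part p∤e))
                   (μ-prime* pp 1≤e p∤e)) (neg (pos ⟦ e ∣? n ⟧) (μ e))
    where
    1≤e = proj₁ (∈-rng⁻ (D ÷ p) e∈)
    neg : ∀ a b → a ℤ.* (ℤ.- b) ≡ (ℤ.- pos 1) ℤ.* (pos 1 ℤ.* (a ℤ.* b))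
    neg = ℤR.solve-∀
  -- A divisor d prime to p has p d ∣ n ≤ D, so the unpaired sum stops at D ÷ p, exactly the range
  -- of the partners.
  vanish : ∀ d → D ÷ p < d → G d ≡ pos 0
  vanish d h with p ∣? d
  ... | yes _ = refl
  ... | no p∤d = trans (ℤP.*-identityˡ _) (cong (λ t → pos t ℤ.* μ d) (⟦⟧-false (d ∣? n) λ d∣n →
    <⇒≱ h (÷-greatest 1≤p (≤-trans (≤-reflexive (*-comm d p)) (≤-trans (∣⇒≤ {{>-nonZero 1≤n}} (coprime-part p∤d d∣n)) n≤D)))))

-- Inversion of the floor function, the only arithmetic input on μ besides μ (p m) = - μ m.
μ-floor-sum : ∀ {y D m} → 1 ≤ m → y ≤ D → ∑ℤ (rng D) (λ d → μ d ℤ.* pos (y ÷ d ÷ m)) ≡ pos ⟦ m ≤? y ⟧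
μ-floor-sum {y} {D} {m} 1≤m y≤D = begin
  ∑ℤ (rng D) (λ d → μ d ℤ.* pos (y ÷ d ÷ m)) ≡⟨ ∑ℤ-cong∈ (rng D) expand ⟩
  ∑ℤ (rng D) (λ d → ∑ℤ (rng t) (λ j → pos ⟦ d ∣? j ⟧ ℤ.* μ d)) ≡⟨ ∑ℤ-swap (rng D) (rng t) _ ⟩
  ∑ℤ (rng t) (λ j → ∑ℤ (rng D) (λ d → pos ⟦ d ∣? j ⟧ ℤ.* μ d)) ≡⟨ ∑ℤ-cong∈ (rng t) (λ j j∈ → let a , b = ∈-rng⁻ t j∈ in μ-divisor-sum a (≤-trans b (≤-trans (÷-≤ y m) y≤D))) ⟩
  ∑ℤ (rng t) (λ j → pos ⟦ j ≟ 1 ⟧) ≡⟨ ones t ⟩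
  pos ⟦ 1 ≤? t ⟧ ≡⟨ cong pos (⟦⟧-iff (1 ≤? t) (m ≤? y) (λ 1≤t → ≤-trans (≤-trans (≤-reflexive (sym (*-identityˡ m))) (*-monoˡ-≤ m 1≤t)) (÷-lower y m))
        (λ m≤y → ÷-greatest 1≤m (≤-trans (≤-reflexive (*-identityˡ m)) m≤y))) ⟩
  pos ⟦ m ≤? y ⟧ ∎
  where
  open ≡-Reasoning
  t = y ÷ m
  expand : ∀ d → d ∈ rng D → μ d ℤ.* pos (y ÷ d ÷ m) ≡ ∑ℤ (rng t) (λ j → pos ⟦ d ∣? j ⟧ ℤ.* μ d)
  expand d d∈ = begin
    μ d ℤ.* pos (y ÷ d ÷ m) ≡⟨ cong (λ q → μ d ℤ.* pos q) (trans (÷-÷ y 1≤d 1≤m) (trans (cong (y ÷_) (*-comm d m)) (sym (÷-÷ y 1≤m 1≤d)))) ⟩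
    μ d ℤ.* pos (t ÷ d) ≡⟨ cong (λ q → μ d ℤ.* pos q) (sym (count-multiples t 1≤d)) ⟩
    μ d ℤ.* pos (∑ (rng t) (λ j → ⟦ d ∣? j ⟧)) ≡⟨ cong (ℤ._*_ (μ d)) (sym (∑ℤ-pos (rng t) _)) ⟩
    μ d ℤ.* ∑ℤ (rng t) (λ j → pos ⟦ d ∣? j ⟧) ≡⟨ sym (∑ℤ-*ˡ (rng t) (μ d) _) ⟩
    ∑ℤ (rng t) (λ j → μ d ℤ.* pos ⟦ d ∣? j ⟧) ≡⟨ ∑ℤ-cong (rng t) (λ j → ℤP.*-comm (μ d) _) ⟩
    ∑ℤ (rng t) (λ j → pos ⟦ d ∣? j ⟧ ℤ.* μ d) ∎
    where 1≤d = proj₁ (∈-rng⁻ D d∈)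
  ones : ∀ t → ∑ℤ (rng t) (λ j → pos ⟦ j ≟ 1 ⟧) ≡ pos ⟦ 1 ≤? t ⟧
  ones zero = refl
  ones (suc t) = trans (∑ℤ-rng-+ 1 t (λ j → pos ⟦ j ≟ 1 ⟧)) (trans (cong (ℤ._+_ (pos 1)) (∑ℤ-zero (rng t) λ i i∈ →
    cong pos (⟦⟧-false (suc i ≟ 1) λ e → <⇒≢ (proj₁ (∈-rng⁻ t i∈)) (sym (suc-injective e))))) refl)

mertens : ℕ → ℤ
mertens x = ∑ℤ (rng x) μ

∣mertens-diff∣ : ∀ m n → ∣ mertens (m + n) ℤ.- mertens m ∣ ≤ n
∣mertens-diff∣ m n = ≤-trans (≤-reflexive (cong ∣_∣ (trans (cong (ℤ._- mertens m) (∑ℤ-rng-+ m n μ)) (cancel (mertens m) _))))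
  (≤-trans (∑ℤ-abs (rng n) (λ i → μ (m + i))) (≤-trans (∑-mono (rng n) (λ i → ∣μ∣≤1 (m + i)))
    (≤-reflexive (trans (∑-rng-const n 1) (*-identityʳ n)))))
  where
  cancel : ∀ a b → a ℤ.+ b ℤ.- a ≡ b
  cancel = ℤR.solve-∀

∣mertens∣ : ∀ n → ∣ mertens n ∣ ≤ n
∣mertens∣ n = subst (λ t → ∣ t ∣ ≤ n) (ℤP.+-identityʳ (mertens n)) (∣mertens-diff∣ 0 n)

-- μ (p j) = - μ (j) unless p ∣ j, when μ (p j) = 0; only the X ÷ p multiples of p are left over,
-- each with a term of size at most 1.
mertens-prime-shift : ∀ {p} X → Prime p → ∣ ∑ℤ (rng X) (λ j → μ (p * j)) ℤ.+ mertens X ∣ ≤ X ÷ p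
mertens-prime-shift {p} X pp = ≤-trans (≤-reflexive (cong ∣_∣ (sym (∑ℤ-+ (rng X) _ _))))
  (≤-trans (∑ℤ-abs (rng X) _) (≤-trans (∑-mono∈ (rng X) bound) (≤-reflexive (count-multiples X (prime≥1 pp)))))
  where
  bound : ∀ j → j ∈ rng X → ∣ μ (p * j) ℤ.+ μ j ∣ ≤ ⟦ p ∣? j ⟧
  bound j j∈ with p ∣? j
  ... | yes p∣j = subst (λ t → ∣ t ℤ.+ μ j ∣ ≤ 1) (sym (μ-square (1≤* (prime≥1 pp) 1≤j) pp (*-monoʳ-∣ p p∣j)))
          (subst (λ t → ∣ t ∣ ≤ 1) (sym (ℤP.+-identityˡ (μ j))) (∣μ∣≤1 j))
    where 1≤j = proj₁ (∈-rng⁻ X j∈)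
  ... | no p∤j = ≤-reflexive (cong ∣_∣ (trans (cong (ℤ._+ μ j) (μ-prime* pp (proj₁ (∈-rng⁻ X j∈)) p∤j)) (ℤP.+-inverseˡ (μ j))))

-- Averaging over primes

2ab≤a²+b² : ∀ a b → 2 * (a * b) ≤ a * a + b * b
2ab≤a²+b² a b with ≤-total a b
... | inj₁ a≤b = subst (λ b → 2 * (a * b) ≤ a * a + b * b) (m+[n∸m]≡n a≤b)
    (≤-trans (m≤m+n _ ((b ∸ a) * (b ∸ a))) (≤-reflexive (id' a (b ∸ a))))
  where
  id' : ∀ a k → 2 * (a * (a + k)) + k * k ≡ a * a + (a + k) * (a + k)
  id' = solve-∀
... | inj₂ b≤a = subst (λ a → 2 * (a * b) ≤ a * a + b * b) (m+[n∸m]≡n b≤a)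
    (≤-trans (m≤m+n _ ((a ∸ b) * (a ∸ b))) (≤-reflexive (id' b (a ∸ b))))
  where
  id' : ∀ b k → 2 * ((b + k) * b) + k * k ≡ (b + k) * (b + k) + b * b
  id' = solve-∀

∣pos-pos∣ : ∀ u w → ∣ pos u ℤ.- pos w ∣ ≡ ∣ u - w ∣
∣pos-pos∣ u w with ≤-total w u
... | inj₁ w≤u = trans (cong ∣_∣ (trans (ℤP.m-n≡m⊖n u w) (ℤP.⊖-≥ w≤u))) (sym (m≤n⇒∣n-m∣≡n∸m w≤u))
... | inj₂ u≤w = trans (cong ∣_∣ (trans (ℤP.m-n≡m⊖n u w) (ℤP.⊖-≤ u≤w)))
    (trans (ℤP.∣-i∣≡∣i∣ (pos (w ∸ u))) (sym (m≤n⇒∣m-n∣≡n∸m u≤w)))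

-- Expand (l - ∣u - w∣)² ≥ 0. With a fixed l this replaces the Cauchy-Schwarz inequality, so no
-- square root is taken.
deviation-bound : ∀ l u w → 2 * (l * ∣ u - w ∣) + 2 * (w * u) ≤ l * l + (u * u + w * w)
deviation-bound l u w with ≤-total w u
... | inj₁ w≤u rewrite m≤n⇒∣n-m∣≡n∸m w≤u = subst (λ v → 2 * (l * (u ∸ w)) + 2 * (w * v) ≤ l * l + (v * v + w * w)) (m+[n∸m]≡n w≤u)
    (by-lin (2ab≤a²+b² l (u ∸ w)) (≤-reflexive (id' l w (u ∸ w))))
  where
  id' : ∀ l w k → l * l + k * k + (2 * (l * k) + 2 * (w * (w + k))) ≡ 2 * (l * k) + (l * l + ((w + k) * (w + k) + w * w))
  id' = solve-∀
... | inj₂ u≤w rewrite m≤n⇒∣m-n∣≡n∸m u≤w = subst (λ v → 2 * (l * (w ∸ u)) + 2 * (v * u) ≤ l * l + (u * u + v * v)) (m+[n∸m]≡n u≤w)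
    (by-lin (2ab≤a²+b² l (w ∸ u)) (≤-reflexive (id' l u (w ∸ u))))
  where
  id' : ∀ l u k → l * l + k * k + (2 * (l * k) + 2 * ((u + k) * u)) ≡ 2 * (l * k) + (l * l + (u * u + (u + k) * (u + k)))
  id' = solve-∀

∑-map : ∀ {A B : Set} (h : A → B) (xs : List A) (f : B → ℕ) → ∑ (map h xs) f ≡ ∑ xs (f ∘ h)
∑-map h [] f = refl
∑-map h (x ∷ xs) f = cong (f (h x) +_) (∑-map h xs f)

∑ℤ-map : ∀ {A B : Set} (h : A → B) (xs : List A) (f : B → ℤ) → ∑ℤ (map h xs) f ≡ ∑ℤ xs (f ∘ h)
∑ℤ-map h [] f = refl
∑ℤ-map h (x ∷ xs) f = cong (ℤ._+_ (f (h x))) (∑ℤ-map h xs f)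

weight : List (ℕ × ℕ) → ℕ
weight P = ∑ P proj₁

-- A family of primes p with weights α, to be averaged over with weight α p on the multiples of p.
record Averaging (E : ℕ) (P : List (ℕ × ℕ)) : Set where
  field
    V : ℕ
    1≤V : 1 ≤ V
    large : E * E * V ≤ weight P
    primes : ∀ a → a ∈ P → Prime (proj₂ a)
    big : ∀ a → a ∈ P → E ≤ proj₂ a
    bounded : ∀ a → a ∈ P → proj₁ a * proj₂ a ≤ V
    unique : Unique (map proj₂ P)

module Concentration (x V : ℕ) where

  term : ℕ → ℕ × ℕ → ℕ
  term m (α , p) = α * p * ⟦ p ∣? m ⟧

  -- A weighted count of the members of the family that divide m. Its mean over m is about
  -- `weight P`, since p divides one m in p.
  u : List (ℕ × ℕ) → ℕ → ℕ
  u P m = ∑ P (term m)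

  term-sum : ∀ α {p} → 1 ≤ p → ∑ (rng x) (λ m → term m (α , p)) ≡ α * p * (x ÷ p)
  term-sum α {p} 1≤p = trans (∑-*ˡ (rng x) (α * p) _) (cong (α * p *_) (count-multiples x 1≤p))

  ⟦⟧-idem : ∀ {P : Set} (d : Dec P) → ⟦ d ⟧ * ⟦ d ⟧ ≡ ⟦ d ⟧
  ⟦⟧-idem (yes _) = refl
  ⟦⟧-idem (no _) = refl

  distinct-divide : ∀ {p q} → Prime p → Prime q → p ≢ q → ∀ m → p ∣ m → q ∣ m → p * q ∣ m
  distinct-divide {p} {q} pp pq p≢q m (divides c eq) q∣m with euclidsLemma c p pq (subst (q ∣_) eq q∣m)
  ... | inj₁ (divides c' refl) = divides c' (trans eq (reassoc c' q p))
    where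
    reassoc : ∀ c q p → c * q * p ≡ c * (p * q)
    reassoc = solve-∀
  ... | inj₂ q∣p = contradiction (sym (prime∣prime pq pp q∣p)) p≢q

  -- Divisibility by distinct primes is independent: p and q both divide m exactly when p q does,
  -- which happens at most x / (p q) times and so cancels the factors p and q of the weights.
  cross : ∀ α {p} (P : List (ℕ × ℕ)) → Prime p → (∀ a → a ∈ P → Prime (proj₂ a)) → LAll.All (p ≢_) (map proj₂ P) →
    ∑ (rng x) (λ m → term m (α , p) * u P m) ≤ α * weight P * x
  cross α {p} P pp pP p≢ = begin
    ∑ (rng x) (λ m → term m (α , p) * u P m) ≡⟨ ∑-cong (rng x) (λ m → sym (∑-*ˡ P (term m (α , p)) (term m))) ⟩
    ∑ (rng x) (λ m → ∑ P (λ a → term m (α , p) * term m a)) ≡⟨ ∑-swap (rng x) P _ ⟩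
    ∑ P (λ a → ∑ (rng x) (λ m → term m (α , p) * term m a)) ≤⟨ ∑-mono∈ P each ⟩
    ∑ P (λ a → α * x * proj₁ a) ≡⟨ ∑-*ˡ P (α * x) proj₁ ⟩
    α * x * weight P ≡⟨ comm α x (weight P) ⟩
    α * weight P * x ∎
    where
    open ≤-Reasoning
    comm : ∀ a x w → a * x * w ≡ a * w * x
    comm = solve-∀
    each : ∀ a → a ∈ P → ∑ (rng x) (λ m → term m (α , p) * term m a) ≤ α * x * proj₁ a
    each (β , q) a∈ = begin
      ∑ (rng x) (λ m → α * p * ⟦ p ∣? m ⟧ * (β * q * ⟦ q ∣? m ⟧)) ≡⟨ ∑-cong (rng x) (λ m → trans (regroup α p β q ⟦ p ∣? m ⟧ ⟦ q ∣? m ⟧)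
              (cong (α * β * (p * q) *_) (⟦⟧-× (p ∣? m) (q ∣? m) (p * q ∣? m) (distinct-divide pp pq p≢q m) (λ d → ∣-trans (m∣m*n q) d , ∣-trans (n∣m*n p) d)))) ⟩
      ∑ (rng x) (λ m → α * β * (p * q) * ⟦ p * q ∣? m ⟧) ≡⟨ ∑-*ˡ (rng x) (α * β * (p * q)) _ ⟩
      α * β * (p * q) * ∑ (rng x) (λ m → ⟦ p * q ∣? m ⟧) ≡⟨ cong (α * β * (p * q) *_) (count-multiples x (1≤* (prime≥1 pp) (prime≥1 pq))) ⟩
      α * β * (p * q) * (x ÷ (p * q)) ≡⟨ regroup′ α β (p * q) (x ÷ (p * q)) ⟩
      α * β * ((x ÷ (p * q)) * (p * q)) ≤⟨ *-monoʳ-≤ (α * β) (÷-lower x (p * q)) ⟩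
      α * β * x ≡⟨ comm α β x ⟩
      α * x * β ∎
      where
      pq = pP (β , q) a∈
      p≢q : p ≢ q
      p≢q = LAll.lookup p≢ (∈-map⁺ proj₂ a∈)
      regroup : ∀ α p β q a b → α * p * a * (β * q * b) ≡ α * β * (p * q) * (a * b)
      regroup = solve-∀
      regroup′ : ∀ α β p a → α * β * p * a ≡ α * β * (a * p)
      regroup′ = solve-∀

  second-moment : ∀ P → (∀ a → a ∈ P → Prime (proj₂ a)) → (∀ a → a ∈ P → proj₁ a * proj₂ a ≤ V) → Unique (map proj₂ P) →
    ∑ (rng x) (λ m → u P m * u P m) ≤ weight P * weight P * x + V * weight P * x
  second-moment [] _ _ _ = ≤-trans (≤-reflexive (∑-zero (rng x) λ _ _ → refl)) z≤n
  second-moment ((α , p) ∷ P) pP bP (p≢ ∷ uniq) = begin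
    ∑ (rng x) (λ m → (t m + u P m) * (t m + u P m)) ≡⟨ ∑-cong (rng x) (λ m → square (t m) (u P m)) ⟩
    ∑ (rng x) (λ m → t m * t m + (2 * (t m * u P m) + u P m * u P m)) ≡⟨ trans (∑-+ (rng x) (λ m → t m * t m) _) (cong (∑ (rng x) (λ m → t m * t m) +_)
              (trans (∑-+ (rng x) (λ m → 2 * (t m * u P m)) _) (cong (_+ ∑ (rng x) (λ m → u P m * u P m)) (∑-*ˡ (rng x) 2 _)))) ⟩
    ∑ (rng x) (λ m → t m * t m) + (2 * ∑ (rng x) (λ m → t m * u P m) + ∑ (rng x) (λ m → u P m * u P m))
        ≤⟨ +-mono-≤ diagonal (+-mono-≤ (*-monoʳ-≤ 2 (cross α P pp (λ a i → pP a (there i)) p≢)) (second-moment P (λ a i → pP a (there i)) (λ a i → bP a (there i)) uniq)) ⟩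
    -- The slack α² x completes the square (α + w)².
    V * α * x + (2 * (α * w * x) + (w * w * x + V * w * x)) ≤⟨ m≤m+n _ (α * α * x) ⟩
    V * α * x + (2 * (α * w * x) + (w * w * x + V * w * x)) + α * α * x ≡⟨ collect α w V x ⟩
    (α + w) * (α + w) * x + V * (α + w) * x ∎
    where
    open ≤-Reasoning
    w = weight P
    pp = pP (α , p) (here refl)
    t : ℕ → ℕ
    t m = term m (α , p)
    square : ∀ a b → (a + b) * (a + b) ≡ a * a + (2 * (a * b) + b * b)
    square = solve-∀
    collect : ∀ α w V x → V * α * x + (2 * (α * w * x) + (w * w * x + V * w * x)) + α * α * x ≡ (α + w) * (α + w) * x + V * (α + w) * x
    collect = solve-∀
    diagonal : ∑ (rng x) (λ m → t m * t m) ≤ V * α * x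
    diagonal = begin
      ∑ (rng x) (λ m → t m * t m) ≡⟨ ∑-cong (rng x) (λ m → trans (regroup (α * p) ⟦ p ∣? m ⟧) (cong (α * p * (α * p) *_) (⟦⟧-idem (p ∣? m)))) ⟩
      ∑ (rng x) (λ m → α * p * (α * p) * ⟦ p ∣? m ⟧) ≡⟨ ∑-*ˡ (rng x) (α * p * (α * p)) _ ⟩
      α * p * (α * p) * ∑ (rng x) (λ m → ⟦ p ∣? m ⟧) ≡⟨ cong (α * p * (α * p) *_) (count-multiples x (prime≥1 pp)) ⟩
      α * p * (α * p) * (x ÷ p) ≡⟨ regroup′ α p (x ÷ p) ⟩
      α * p * (α * ((x ÷ p) * p)) ≤⟨ *-mono-≤ (bP (α , p) (here refl)) (*-monoʳ-≤ α (÷-lower x p)) ⟩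
      V * (α * x) ≡⟨ sym (*-assoc V α x) ⟩
      V * α * x ∎
      where
      regroup : ∀ a b → a * b * (a * b) ≡ a * a * (b * b)
      regroup = solve-∀
      regroup′ : ∀ α p y → α * p * (α * p) * y ≡ α * p * (α * (y * p))
      regroup′ = solve-∀

  -- Each floor x ÷ p loses less than 1, which costs at most α p ≤ V after weighting.
  first-moment : ∀ P → (∀ a → a ∈ P → Prime (proj₂ a)) → (∀ a → a ∈ P → proj₁ a * proj₂ a ≤ V) →
    weight P * x ≤ ∑ (rng x) (u P) + length P * V
  first-moment P pP bP = begin
    weight P * x ≡⟨ sym (∑-*ʳ P x proj₁) ⟩
    ∑ P (λ a → proj₁ a * x) ≤⟨ ∑-mono∈ P each ⟩
    ∑ P (λ a → ∑ (rng x) (λ m → term m a) + V) ≡⟨ trans (∑-+ P _ _) (cong₂ _+_ (∑-swap P (rng x) (λ a m → term m a)) (∑-const P V)) ⟩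
    ∑ (rng x) (u P) + length P * V ∎
    where
    open ≤-Reasoning
    each : ∀ a → a ∈ P → proj₁ a * x ≤ ∑ (rng x) (λ m → term m a) + V
    each (α , p) a∈ = begin
      α * x ≤⟨ *-monoʳ-≤ α (<⇒≤ (÷-upper x 1≤p)) ⟩
      α * (suc (x ÷ p) * p) ≡⟨ regroup α p (x ÷ p) ⟩
      α * p * (x ÷ p) + α * p ≤⟨ +-mono-≤ (≤-reflexive (sym (term-sum α 1≤p))) (bP (α , p) a∈) ⟩
      ∑ (rng x) (λ m → term m (α , p)) + V ∎
      where
      1≤p = prime≥1 (pP (α , p) a∈)
      regroup : ∀ α p q → α * (suc q * p) ≡ α * p * q + α * p
      regroup = solve-∀

  -- The variance sum is of order V W x, so the mean deviation is of order √(V W), and W ≥ E² V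
  -- turns this into W / E.
  deviation : ∀ E P → 1 ≤ V → E * E * V ≤ weight P → (∀ a → a ∈ P → Prime (proj₂ a)) → (∀ a → a ∈ P → proj₁ a * proj₂ a ≤ V) →
    Unique (map proj₂ P) → length P ≤ x → E * ∑ (rng x) (λ m → ∣ u P m - weight P ∣) ≤ 2 * (weight P * x)
  deviation E P 1≤V EEV≤W pP bP uniq len = *-cancelˡ-≤ (2 * V) {{>-nonZero (*-mono-≤ {1} {2} (s≤s z≤n) 1≤V)}} final
    where
    open ≤-Reasoning
    W = weight P
    D = ∑ (rng x) (λ m → ∣ u P m - W ∣)
    U = ∑ (rng x) (u P)
    Q = ∑ (rng x) (λ m → u P m * u P m)
    -- With this l the term x l² is at most V W x, no more than the bound for the variance.
    l = E * V
    summed : 2 * (l * D) + 2 * (W * U) ≤ x * (l * l) + (Q + x * (W * W))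
    summed = begin
      2 * (l * D) + 2 * (W * U) ≡⟨ sym (cong₂ _+_ (trans (∑-*ˡ (rng x) 2 _) (cong (2 *_) (∑-*ˡ (rng x) l _))) (trans (∑-*ˡ (rng x) 2 _) (cong (2 *_) (∑-*ˡ (rng x) W (u P))))) ⟩
      ∑ (rng x) (λ m → 2 * (l * ∣ u P m - W ∣)) + ∑ (rng x) (λ m → 2 * (W * u P m)) ≡⟨ sym (∑-+ (rng x) _ _) ⟩
      ∑ (rng x) (λ m → 2 * (l * ∣ u P m - W ∣) + 2 * (W * u P m)) ≤⟨ ∑-mono (rng x) (λ m → deviation-bound l (u P m) W) ⟩
      ∑ (rng x) (λ m → l * l + (u P m * u P m + W * W)) ≡⟨ trans (∑-+ (rng x) (λ _ → l * l) _) (cong₂ _+_ (const (l * l)) (trans (∑-+ (rng x) _ (λ _ → W * W)) (cong (Q +_) (const (W * W))))) ⟩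
      x * (l * l) + (Q + x * (W * W)) ∎
      where
      const : ∀ c → ∑ (rng x) (λ _ → c) ≡ x * c
      const c = ∑-rng-const x c
    final : 2 * V * (E * D) ≤ 2 * V * (2 * (W * x))
    final = by-lin (+-mono-≤ summed (+-mono-≤ (second-moment P pP bP uniq)
        (+-mono-≤ (*-monoʳ-≤ (2 * W) (first-moment P pP bP)) (+-mono-≤ (*-monoʳ-≤ (V * x) EEV≤W) (*-monoʳ-≤ (2 * W * V) len)))))
        (≤-reflexive (identity E V D W U Q x (length P)))
      where
      identity : ∀ E V D W U Q x L →
        x * (E * V * (E * V)) + (Q + x * (W * W)) + (W * W * x + V * W * x + (2 * W * (U + L * V) + (V * x * W + 2 * W * V * x))) + 2 * V * (E * D)
        ≡ 2 * (E * V * D) + 2 * (W * U) + (Q + (2 * W * (W * x) + (V * x * (E * E * V) + 2 * W * V * L))) + 2 * V * (2 * (W * x))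
      identity = solve-∀

∣∣-+≤ : ∀ a b {m n} → ∣ a ∣ ≤ m → ∣ b ∣ ≤ n → ∣ a ℤ.+ b ∣ ≤ m + n
∣∣-+≤ a b h k = ≤-trans (ℤP.∣i+j∣≤∣i∣+∣j∣ a b) (+-mono-≤ h k)

-- B = ∑ μ (m) u (m) is evaluated twice. As u is close to its mean W, it is close to W M (x); summed
-- over the multiples of each p, it is close to - ∑ α p M (x / p), where the multiples of p² cost α
-- p · x / p² ≤ α x / E.
turán-kubilius : ∀ {E P} → Averaging E P → ∀ x → length P ≤ x →
  E * ∣ pos (weight P) ℤ.* mertens x ℤ.+ ∑ℤ P (λ a → pos (proj₁ a * proj₂ a) ℤ.* mertens (x ÷ proj₂ a)) ∣ ≤ 3 * (weight P * x)
turán-kubilius {E} {P} av x len = begin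
  E * ∣ pos W ℤ.* mertens x ℤ.+ S₁ ∣ ≡⟨ cong (λ t → E * ∣ t ∣) (rearrange (pos W ℤ.* mertens x) S₁ B) ⟩
  E * ∣ ℤ.- (B ℤ.- pos W ℤ.* mertens x) ℤ.+ (B ℤ.+ S₁) ∣ ≤⟨ *-monoʳ-≤ E (∣∣-+≤ (ℤ.- (B ℤ.- pos W ℤ.* mertens x)) (B ℤ.+ S₁)
      (≤-trans (≤-reflexive (ℤP.∣-i∣≡∣i∣ (B ℤ.- pos W ℤ.* mertens x))) main) shift-error) ⟩
  E * (D + ∑ P (λ a → proj₁ a * proj₂ a * (x ÷ proj₂ a ÷ proj₂ a))) ≡⟨ trans (*-distribˡ-+ E D _) (cong (E * D +_) (sym (∑-*ˡ P E _))) ⟩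
  E * D + ∑ P (λ a → E * (proj₁ a * proj₂ a * (x ÷ proj₂ a ÷ proj₂ a))) ≤⟨ +-mono-≤ (deviation E P 1≤V large primes bounded unique len) (∑-mono∈ P small) ⟩
  2 * (W * x) + ∑ P (λ a → proj₁ a * x) ≡⟨ cong (2 * (W * x) +_) (∑-*ʳ P x proj₁) ⟩
  2 * (W * x) + W * x ≡⟨ three (W * x) ⟩
  3 * (W * x) ∎
  where
  open ≤-Reasoning
  open Averaging av
  open Concentration x V
  W = weight P
  D = ∑ (rng x) (λ m → ∣ u P m - W ∣)
  S₁ = ∑ℤ P (λ a → pos (proj₁ a * proj₂ a) ℤ.* mertens (x ÷ proj₂ a))
  b : ℕ × ℕ → ℤ
  b (α , p) = ∑ℤ (rng (x ÷ p)) (λ j → μ (p * j))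
  B = ∑ℤ P (λ a → pos (proj₁ a * proj₂ a) ℤ.* b a)
  three : ∀ t → 2 * t + t ≡ 3 * t
  three = solve-∀
  rearrange : ∀ w s b → w ℤ.+ s ≡ ℤ.- (b ℤ.- w) ℤ.+ (b ℤ.+ s)
  rearrange = ℤR.solve-∀
  twisted : ∑ℤ (rng x) (λ m → μ m ℤ.* (pos (u P m) ℤ.- pos W)) ≡ B ℤ.- pos W ℤ.* mertens x
  twisted = trans (∑ℤ-cong (rng x) (λ m → distr (μ m) (pos (u P m)) (pos W))) (trans (∑ℤ-- (rng x) _ _) (cong₂ ℤ._-_ expand (∑ℤ-*ˡ (rng x) (pos W) μ)))
    where
    distr : ∀ a b c → a ℤ.* (b ℤ.- c) ≡ a ℤ.* b ℤ.- c ℤ.* a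
    distr = ℤR.solve-∀
    expand : ∑ℤ (rng x) (λ m → μ m ℤ.* pos (u P m)) ≡ B
    expand = trans (∑ℤ-cong (rng x) (λ m → trans (cong (ℤ._*_ (μ m)) (sym (∑ℤ-pos P (term m)))) (sym (∑ℤ-*ˡ P (μ m) _))))
      (trans (∑ℤ-swap (rng x) P _) (∑ℤ-cong∈ P λ { (α , p) a∈ → trans (∑ℤ-cong (rng x) (λ m →
          trans (cong (ℤ._*_ (μ m)) (ℤP.pos-* (α * p) ⟦ p ∣? m ⟧)) (shuffle (μ m) (pos (α * p)) (pos ⟦ p ∣? m ⟧))))
        (trans (∑ℤ-*ˡ (rng x) (pos (α * p)) _) (cong (ℤ._*_ (pos (α * p))) (multiples x (prime≥1 (primes (α , p) a∈)) μ))) }))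
      where
      shuffle : ∀ a b c → a ℤ.* (b ℤ.* c) ≡ b ℤ.* (c ℤ.* a)
      shuffle = ℤR.solve-∀
  main : ∣ B ℤ.- pos W ℤ.* mertens x ∣ ≤ D
  main = ≤-trans (≤-reflexive (cong ∣_∣ (sym twisted))) (≤-trans (∑ℤ-abs (rng x) _) (∑-mono (rng x) λ m →
    ≤-trans (≤-reflexive (trans (ℤP.abs-* (μ m) _) (cong (∣ μ m ∣ *_) (∣pos-pos∣ (u P m) W))))
      (≤-trans (*-monoˡ-≤ ∣ u P m - W ∣ (∣μ∣≤1 m)) (≤-reflexive (*-identityˡ _)))))
  shift-error : ∣ B ℤ.+ S₁ ∣ ≤ ∑ P (λ a → proj₁ a * proj₂ a * (x ÷ proj₂ a ÷ proj₂ a))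
  shift-error = ≤-trans (≤-reflexive (cong ∣_∣ (sym (∑ℤ-+ P _ _)))) (≤-trans (∑ℤ-abs P _) (∑-mono∈ P λ { (α , p) a∈ →
    ≤-trans (≤-reflexive (trans (cong ∣_∣ (sym (ℤP.*-distribˡ-+ (pos (α * p)) (b (α , p)) (mertens (x ÷ p))))) (ℤP.abs-* (pos (α * p)) _)))
      (*-monoʳ-≤ (α * p) (mertens-prime-shift (x ÷ p) (primes (α , p) a∈))) }))
  small : ∀ a → a ∈ P → E * (proj₁ a * proj₂ a * (x ÷ proj₂ a ÷ proj₂ a)) ≤ proj₁ a * x
  small (α , p) a∈ = begin
    E * (α * p * (x ÷ p ÷ p)) ≤⟨ *-monoˡ-≤ (α * p * (x ÷ p ÷ p)) (big (α , p) a∈) ⟩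
    p * (α * p * (x ÷ p ÷ p)) ≡⟨ regroup p α (x ÷ p ÷ p) ⟩
    α * ((x ÷ p ÷ p) * p * p) ≤⟨ *-monoʳ-≤ α (≤-trans (*-monoˡ-≤ p (÷-lower (x ÷ p) p)) (÷-lower x p)) ⟩
    α * x ∎
    where
    regroup : ∀ p α q → p * (α * p * q) ≡ α * (q * p * p)
    regroup = solve-∀

-- Slow variation of the normalised Mertens function

scaled : ℕ → ℕ → ℤ
scaled N y = pos y ℤ.* mertens (N ÷ y)

-- For G (y) = y M (N / y) the factor p of the weights is absorbed into y p, so averaging reads W G
-- (y) ≈ - ∑ α G (y p), with the same error 3 W N / E for all y.
scaled-average : ∀ {E P} → Averaging E P → ∀ N {y} → 1 ≤ y → length P ≤ N ÷ y →
  E * ∣ pos (weight P) ℤ.* scaled N y ℤ.+ ∑ℤ P (λ a → pos (proj₁ a) ℤ.* scaled N (y * proj₂ a)) ∣ ≤ 3 * (weight P * N)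
scaled-average {E} {P} av N {y} 1≤y len = begin
  E * ∣ pos W ℤ.* scaled N y ℤ.+ ∑ℤ P (λ a → pos (proj₁ a) ℤ.* scaled N (y * proj₂ a)) ∣ ≡⟨ cong (λ t → E * ∣ t ∣) factor ⟩
  E * ∣ pos y ℤ.* (pos W ℤ.* mertens x ℤ.+ S₁) ∣ ≡⟨ cong (E *_) (ℤP.abs-* (pos y) _) ⟩
  E * (y * ∣ pos W ℤ.* mertens x ℤ.+ S₁ ∣) ≡⟨ comm E y _ ⟩
  y * (E * ∣ pos W ℤ.* mertens x ℤ.+ S₁ ∣) ≤⟨ *-monoʳ-≤ y (turán-kubilius av x len) ⟩
  y * (3 * (W * x)) ≡⟨ comm′ y W x ⟩
  3 * (W * (x * y)) ≤⟨ *-monoʳ-≤ 3 (*-monoʳ-≤ W (÷-lower N y)) ⟩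
  3 * (W * N) ∎
  where
  open ≤-Reasoning
  open Averaging av
  W = weight P
  x = N ÷ y
  S₁ = ∑ℤ P (λ a → pos (proj₁ a * proj₂ a) ℤ.* mertens (x ÷ proj₂ a))
  comm : ∀ a b c → a * (b * c) ≡ b * (a * c)
  comm = solve-∀
  comm′ : ∀ y w x → y * (3 * (w * x)) ≡ 3 * (w * (x * y))
  comm′ = solve-∀
  factor : pos W ℤ.* scaled N y ℤ.+ ∑ℤ P (λ a → pos (proj₁ a) ℤ.* scaled N (y * proj₂ a)) ≡ pos y ℤ.* (pos W ℤ.* mertens x ℤ.+ S₁)
  factor = trans (cong (ℤ._+_ (pos W ℤ.* scaled N y)) (trans (∑ℤ-cong∈ P each) (∑ℤ-*ˡ P (pos y) _))) (pull (pos W) (pos y) (mertens x) S₁)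
    where
    pull : ∀ w y m s → w ℤ.* (y ℤ.* m) ℤ.+ y ℤ.* s ≡ y ℤ.* (w ℤ.* m ℤ.+ s)
    pull = ℤR.solve-∀
    shuffle : ∀ a y p m → a ℤ.* (y ℤ.* p ℤ.* m) ≡ y ℤ.* (a ℤ.* p ℤ.* m)
    shuffle = ℤR.solve-∀
    each : ∀ a → a ∈ P → pos (proj₁ a) ℤ.* scaled N (y * proj₂ a) ≡ pos y ℤ.* (pos (proj₁ a * proj₂ a) ℤ.* mertens (x ÷ proj₂ a))
    each (α , p) a∈ = trans (cong (λ t → pos α ℤ.* (pos (y * p) ℤ.* mertens t)) (sym (÷-÷ N 1≤y (prime≥1 (primes (α , p) a∈)))))
      (trans (cong (λ t → pos α ℤ.* (t ℤ.* m)) (ℤP.pos-* y p)) (trans (shuffle (pos α) (pos y) (pos p) m)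
        (cong (λ t → pos y ℤ.* (t ℤ.* m)) (sym (ℤP.pos-* α p)))))
      where m = mertens (x ÷ p)

-- Both M and its increments are bounded by the length of the range. E z ≤ N absorbs the rounding of
-- N / z, an error below 1 that gets multiplied by z.
scaled-lipschitz : ∀ {E N y z} → 1 ≤ y → y ≤ z → E * z ≤ suc E * y → E * z ≤ N → E * ∣ scaled N y ℤ.- scaled N z ∣ ≤ 3 * N
scaled-lipschitz {E} {N} {y} {z} 1≤y y≤z Ez≤ Ez≤N = begin
  E * ∣ scaled N y ℤ.- scaled N z ∣ ≡⟨ cong (λ t → E * ∣ t ∣) split ⟩
  E * ∣ ℤ.- (pos k ℤ.* mertens n₁) ℤ.+ pos z ℤ.* (mertens n₁ ℤ.- mertens n₂) ∣ ≤⟨ *-monoʳ-≤ E (∣∣-+≤ (ℤ.- (pos k ℤ.* mertens n₁)) (pos z ℤ.* (mertens n₁ ℤ.- mertens n₂))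
     (≤-trans (≤-reflexive (trans (ℤP.∣-i∣≡∣i∣ (pos k ℤ.* mertens n₁)) (ℤP.abs-* (pos k) (mertens n₁)))) (*-monoʳ-≤ k (∣mertens∣ n₁)))
     (≤-trans (≤-reflexive (ℤP.abs-* (pos z) (mertens n₁ ℤ.- mertens n₂))) (*-monoʳ-≤ z diff))) ⟩
  E * (k * n₁ + z * δ) ≡⟨ distr E k n₁ z δ ⟩
  E * k * n₁ + E * z * δ ≤⟨ +-mono-≤ (≤-trans (*-monoˡ-≤ n₁ Ek≤y) (≤-trans (≤-reflexive (*-comm y n₁)) (÷-lower N y))) second ⟩
  N + 2 * N ≡⟨⟩
  3 * N ∎
  where
  open ≤-Reasoning
  k = z ∸ y
  z≡ : y + k ≡ z
  z≡ = m+[n∸m]≡n y≤z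
  n₁ = N ÷ y
  n₂ = N ÷ z
  δ = n₁ ∸ n₂
  n₁≡ : n₂ + δ ≡ n₁
  n₁≡ = m+[n∸m]≡n (÷-antiʳ N 1≤y y≤z)
  distr : ∀ e k n z d → e * (k * n + z * d) ≡ e * k * n + e * z * d
  distr = solve-∀
  diff : ∣ mertens n₁ ℤ.- mertens n₂ ∣ ≤ δ
  diff = subst (λ t → ∣ mertens t ℤ.- mertens n₂ ∣ ≤ δ) n₁≡ (∣mertens-diff∣ n₂ δ)
  split : scaled N y ℤ.- scaled N z ≡ ℤ.- (pos k ℤ.* mertens n₁) ℤ.+ pos z ℤ.* (mertens n₁ ℤ.- mertens n₂)
  split = subst (λ t → scaled N y ℤ.- pos t ℤ.* mertens n₂ ≡ ℤ.- (pos k ℤ.* mertens n₁) ℤ.+ pos t ℤ.* (mertens n₁ ℤ.- mertens n₂)) z≡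
      (subst (λ t → scaled N y ℤ.- t ℤ.* mertens n₂ ≡ ℤ.- (pos k ℤ.* mertens n₁) ℤ.+ t ℤ.* (mertens n₁ ℤ.- mertens n₂)) (sym (ℤP.pos-+ y k)) (ring (pos y) (pos k) (mertens n₁) (mertens n₂)))
    where
    ring : ∀ y k a b → y ℤ.* a ℤ.- (y ℤ.+ k) ℤ.* b ≡ ℤ.- (k ℤ.* a) ℤ.+ (y ℤ.+ k) ℤ.* (a ℤ.- b)
    ring = ℤR.solve-∀
  Ek≤y : E * k ≤ y
  Ek≤y = +-cancelˡ-≤ (E * y) (E * k) y (≤-trans (≤-reflexive (trans (sym (*-distribˡ-+ E y k)) (cong (E *_) z≡))) (≤-trans Ez≤ (≤-reflexive (+-comm y (E * y)))))
  1≤z = ≤-trans 1≤y y≤z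
  second : E * z * δ ≤ 2 * N
  second = by-lin (+-mono-≤ (*-monoʳ-≤ E (<⇒≤ (÷-upper N 1≤z))) (+-mono-≤ Ez≤N (+-mono-≤ (*-monoˡ-≤ n₁ Ez≤) (*-monoʳ-≤ (suc E) (÷-lower N y)))))
    (≤-reflexive (subst (λ n → E * (suc n₂ * z) + (N + (suc E * y * n + suc E * N)) + E * z * δ ≡ E * N + (E * z + (E * z * n + suc E * (n * y))) + 2 * N) n₁≡ (identity E n₂ z N y δ)))
    where
    identity : ∀ E n z N y d → E * (suc n * z) + (N + (suc E * y * (n + d) + suc E * N)) + E * z * d ≡ E * N + (E * z + (E * z * (n + d) + suc E * ((n + d) * y))) + 2 * N
    identity = solve-∀

left right : ℕ × ℕ × ℕ → ℕ × ℕ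
left (α , p , q) = α , p
right (α , p , q) = α , q

-- p and q carry the same weight α, so that the averages over the two families can be subtracted
-- term by term.
record Twinned (E F K : ℕ) (R : List (ℕ × ℕ × ℕ)) : Set where
  field
    average₁ : Averaging K (map left R)
    average₂ : Averaging K (map right R)
    apart : ∀ a → a ∈ R → suc F * proj₁ (proj₂ a) ≤ F * proj₂ (proj₂ a)
    near : ∀ a → a ∈ R → E * proj₂ (proj₂ a) ≤ suc E * proj₁ (proj₂ a)

∈⇒≤∑ : ∀ {A : Set} {xs : List A} (f : A → ℕ) {x} → x ∈ xs → f x ≤ ∑ xs f
∈⇒≤∑ f (here refl) = m≤m+n _ _
∈⇒≤∑ {xs = y ∷ _} f (there i) = ≤-trans (∈⇒≤∑ f i) (m≤n+m _ (f y))

-- Multiplying the larger of y and z by p and the smaller by q shrinks their ratio by at least 1 + 1/F, and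
-- averaging relates the values at y and z to those at y p and z q; once the order is reversed, the two are
-- within 1 + 1/E of each other.
module SlowVariation (E E₁ F N : ℕ) (1≤E₁ : 1 ≤ E₁) (R : List (ℕ × ℕ × ℕ)) (tw : Twinned E F E₁ R) where
  open Twinned tw

  p-of q-of : ℕ × ℕ × ℕ → ℕ
  p-of a = proj₁ (proj₂ a)
  q-of a = proj₂ (proj₂ a)

  bound : ℕ
  bound = suc (∑ R (λ a → p-of a + q-of a))

  W K : ℕ
  W = ∑ R proj₁
  -- One factor for two demands on N: E z q ≤ N for `scaled-lipschitz`, and `length R ≤ N ÷ y` for
  -- the averaging.
  K = E + length R

  p≤bound : ∀ a → a ∈ R → p-of a ≤ bound
  p≤bound a i = ≤-trans (≤-trans (m≤m+n (p-of a) (q-of a)) (∈⇒≤∑ (λ a → p-of a + q-of a) i)) (n≤1+n _)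

  q≤bound : ∀ a → a ∈ R → q-of a ≤ bound
  q≤bound a i = ≤-trans (≤-trans (m≤n+m (q-of a) (p-of a)) (∈⇒≤∑ (λ a → p-of a + q-of a) i)) (n≤1+n _)

  1≤p : ∀ a → a ∈ R → 1 ≤ p-of a
  1≤p a i = prime≥1 (Averaging.primes average₁ (left a) (∈-map⁺ left i))

  1≤q : ∀ a → a ∈ R → 1 ≤ q-of a
  1≤q a i = prime≥1 (Averaging.primes average₂ (right a) (∈-map⁺ right i))

  1≤W : 1 ≤ W
  1≤W = ≤-trans (1≤* (1≤* 1≤E₁ 1≤E₁) (Averaging.1≤V average₁)) (≤-trans (Averaging.large average₁) (≤-reflexive (∑-map left R proj₁)))

  -- After division by E E₁: 3 N / E for the Lipschitz step that ends the recursion, and 6 N / E₁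
  -- for the two averagings in each of the i rounds.
  error : ℕ → ℕ
  error i = 3 * (E₁ * N) + 6 * (i * (E * N))

  average : ∀ (f : ℕ × ℕ × ℕ → ℕ × ℕ) → Averaging E₁ (map f R) → (∀ a → proj₁ (f a) ≡ proj₁ a) → ∀ {y} → 1 ≤ y → y * length R ≤ N →
    E₁ * ∣ pos W ℤ.* scaled N y ℤ.+ ∑ℤ R (λ a → pos (proj₁ a) ℤ.* scaled N (y * proj₂ (f a))) ∣ ≤ 3 * (W * N)
  average f av e {y} 1≤y h = subst₂ (λ w s → E₁ * ∣ pos w ℤ.* scaled N y ℤ.+ s ∣ ≤ 3 * (w * N))
    (trans (∑-map f R proj₁) (∑-cong R e))
    (trans (∑ℤ-map f R _) (∑ℤ-cong R λ a → cong (λ t → pos t ℤ.* scaled N (y * proj₂ (f a))) (e a)))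
    (scaled-average av N 1≤y (≤-trans (≤-reflexive (length-map f R)) (÷-greatest 1≤y (≤-trans (≤-reflexive (*-comm (length R) y)) h))))

  slow : ∀ i {y z} → 1 ≤ z → z < y → y * F ^ i ≤ z * suc F ^ i → y * (bound ^ i * K) ≤ N →
    E * E₁ * ∣ scaled N y ℤ.- scaled N z ∣ ≤ error i
  -- With no rounds left the ratio y / z would be at most 1.
  slow zero {y} {z} 1≤z z<y h _ = contradiction (subst₂ _≤_ (*-identityʳ y) (*-identityʳ z) h) (<⇒≱ z<y)
  slow (suc i) {y} {z} 1≤z z<y h small = *-cancelˡ-≤ W {{>-nonZero 1≤W}} (begin
    W * (E * E₁ * ∣ G y ℤ.- G z ∣) ≡⟨ pull W E E₁ _ ⟩
    E * (E₁ * (W * ∣ G y ℤ.- G z ∣)) ≡⟨ cong (λ t → E * (E₁ * t)) (trans (sym (ℤP.abs-* (pos W) (G y ℤ.- G z))) (cong ∣_∣ rearranged)) ⟩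
    E * (E₁ * ∣ A₁ ℤ.+ ℤ.- A₂ ℤ.+ S₃ ∣) ≤⟨ *-monoʳ-≤ E (*-monoʳ-≤ E₁ (∣∣-+≤ (A₁ ℤ.+ ℤ.- A₂) S₃ (∣∣-+≤ A₁ (ℤ.- A₂) ≤-refl (≤-reflexive (ℤP.∣-i∣≡∣i∣ A₂))) S₃-bound)) ⟩
    E * (E₁ * (∣ A₁ ∣ + ∣ A₂ ∣ + T₃)) ≡⟨ distribute E E₁ ∣ A₁ ∣ ∣ A₂ ∣ T₃ ⟩
    E * (E₁ * ∣ A₁ ∣) + E * (E₁ * ∣ A₂ ∣) + E * E₁ * T₃ ≤⟨ +-mono-≤ (+-mono-≤ (*-monoʳ-≤ E (average left average₁ (λ _ → refl) 1≤y y-len))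
         (*-monoʳ-≤ E (average right average₂ (λ _ → refl) 1≤z (≤-trans (*-monoˡ-≤ (length R) (<⇒≤ z<y)) y-len)))) T₃-bound ⟩
    E * (3 * (W * N)) + E * (3 * (W * N)) + W * error i ≡⟨ collect E W N E₁ i ⟩
    W * error (suc i) ∎)
    where
    open ≤-Reasoning
    G = scaled N
    1≤y : 1 ≤ y
    1≤y = ≤-trans 1≤z (<⇒≤ z<y)
    1≤bound^ : ∀ j → 1 ≤ bound ^ j
    1≤bound^ j = 1≤^ j (s≤s z≤n)
    y-len : y * length R ≤ N
    y-len = ≤-trans (*-monoʳ-≤ y (≤-trans (m≤n+m (length R) E) (≤-trans (≤-reflexive (sym (*-identityˡ K))) (*-monoˡ-≤ K (1≤bound^ (suc i)))))) small
    A₁ = pos W ℤ.* G y ℤ.+ ∑ℤ R (λ a → pos (proj₁ a) ℤ.* G (y * p-of a))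
    A₂ = pos W ℤ.* G z ℤ.+ ∑ℤ R (λ a → pos (proj₁ a) ℤ.* G (z * q-of a))
    S₃ = ∑ℤ R (λ a → pos (proj₁ a) ℤ.* G (z * q-of a)) ℤ.- ∑ℤ R (λ a → pos (proj₁ a) ℤ.* G (y * p-of a))
    T₃ = ∑ R (λ a → proj₁ a * ∣ G (z * q-of a) ℤ.- G (y * p-of a) ∣)
    pull : ∀ w e f x → w * (e * f * x) ≡ e * (f * (w * x))
    pull = solve-∀
    distribute : ∀ e f a b c → e * (f * (a + b + c)) ≡ e * (f * a) + e * (f * b) + e * f * c
    distribute = solve-∀
    collect : ∀ E W N E₁ i → E * (3 * (W * N)) + E * (3 * (W * N)) + W * (3 * (E₁ * N) + 6 * (i * (E * N))) ≡ W * (3 * (E₁ * N) + 6 * (suc i * (E * N)))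
    collect = solve-∀
    rearranged : pos W ℤ.* (G y ℤ.- G z) ≡ A₁ ℤ.+ ℤ.- A₂ ℤ.+ S₃
    rearranged = ring (pos W) (G y) (G z) _ _
      where
      ring : ∀ w a b s t → w ℤ.* (a ℤ.- b) ≡ w ℤ.* a ℤ.+ s ℤ.+ ℤ.- (w ℤ.* b ℤ.+ t) ℤ.+ (t ℤ.- s)
      ring = ℤR.solve-∀
    S₃-bound : ∣ S₃ ∣ ≤ T₃
    S₃-bound = ≤-trans (≤-reflexive (cong ∣_∣ (sym (∑ℤ-- R _ _)))) (≤-trans (∑ℤ-abs R _) (∑-mono R λ a →
      ≤-reflexive (trans (cong ∣_∣ (factor (pos (proj₁ a)) (G (z * q-of a)) (G (y * p-of a)))) (ℤP.abs-* (pos (proj₁ a)) _))))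
      where
      factor : ∀ a b c → a ℤ.* b ℤ.- a ℤ.* c ≡ a ℤ.* (b ℤ.- c)
      factor = ℤR.solve-∀
    each : ∀ a → a ∈ R → E * E₁ * ∣ G (z * q-of a) ℤ.- G (y * p-of a) ∣ ≤ error i
    each a a∈ with z * q-of a <? y * p-of a
    ... | yes lt = ≤-trans (≤-reflexive (cong (E * E₁ *_) (ℤP.∣i-j∣≡∣j-i∣ (G (z * q-of a)) (G (y * p-of a)))))
        (slow i (1≤* 1≤z (1≤q a a∈)) lt progress next-small)
      where
      p = p-of a
      q = q-of a
      progress : y * p * F ^ i ≤ z * q * suc F ^ i
      progress = *-cancelˡ-≤ (suc F) (begin
        suc F * (y * p * F ^ i) ≡⟨ r₁ (suc F) y p (F ^ i) ⟩
        y * F ^ i * (suc F * p) ≤⟨ *-monoʳ-≤ (y * F ^ i) (apart a a∈) ⟩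
        y * F ^ i * (F * q) ≡⟨ r₂ y (F ^ i) F q ⟩
        y * (F * F ^ i) * q ≤⟨ *-monoˡ-≤ q h ⟩
        z * (suc F * suc F ^ i) * q ≡⟨ r₃ z (suc F) (suc F ^ i) q ⟩
        suc F * (z * q * suc F ^ i) ∎)
        where
        r₁ : ∀ f y p g → f * (y * p * g) ≡ y * g * (f * p)
        r₁ = solve-∀
        r₂ : ∀ y g f q → y * g * (f * q) ≡ y * (f * g) * q
        r₂ = solve-∀
        r₃ : ∀ z f g q → z * (f * g) * q ≡ f * (z * q * g)
        r₃ = solve-∀
      next-small : y * p * (bound ^ i * K) ≤ N
      next-small = ≤-trans (*-monoˡ-≤ (bound ^ i * K) (*-monoʳ-≤ y (p≤bound a a∈))) (≤-trans (≤-reflexive (r y bound (bound ^ i) K)) small)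
        where
        r : ∀ y b c k → y * b * (c * k) ≡ y * (b * c * k)
        r = solve-∀
    ... | no ge = begin
        E * E₁ * ∣ G (z * q-of a) ℤ.- G (y * p-of a) ∣ ≡⟨ trans (cong (E * E₁ *_) (ℤP.∣i-j∣≡∣j-i∣ (G (z * q-of a)) (G (y * p-of a)))) (r E E₁ _) ⟩
        E₁ * (E * ∣ G (y * p-of a) ℤ.- G (z * q-of a) ∣) ≤⟨ *-monoʳ-≤ E₁ (scaled-lipschitz {E} (1≤* 1≤y (1≤p a a∈)) (≮⇒≥ ge) close tiny) ⟩
        E₁ * (3 * N) ≡⟨ r′ E₁ N ⟩
        3 * (E₁ * N) ≤⟨ m≤m+n _ _ ⟩
        error i ∎
      where
      r : ∀ e f x → e * f * x ≡ f * (e * x)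
      r = solve-∀
      r′ : ∀ e n → e * (3 * n) ≡ 3 * (e * n)
      r′ = solve-∀
      close : E * (z * q-of a) ≤ suc E * (y * p-of a)
      close = begin
        E * (z * q-of a) ≡⟨ x₁ E z (q-of a) ⟩
        z * (E * q-of a) ≤⟨ *-mono-≤ (<⇒≤ z<y) (near a a∈) ⟩
        y * (suc E * p-of a) ≡⟨ x₁ y (suc E) (p-of a) ⟩
        suc E * (y * p-of a) ∎
        where
        x₁ : ∀ a b c → a * (b * c) ≡ b * (a * c)
        x₁ = solve-∀
      tiny : E * (z * q-of a) ≤ N
      tiny = begin
        E * (z * q-of a) ≤⟨ *-mono-≤ (m≤m+n E (length R)) (*-mono-≤ (<⇒≤ z<y) (q≤bound a a∈)) ⟩
        K * (y * bound) ≡⟨ x₁ K y bound ⟩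
        y * (bound * 1 * K) ≤⟨ *-monoʳ-≤ y (*-monoˡ-≤ K (*-monoʳ-≤ bound (1≤bound^ i))) ⟩
        y * (bound ^ suc i * K) ≤⟨ small ⟩
        N ∎
        where
        x₁ : ∀ k y b → k * (y * b) ≡ y * (b * 1 * k)
        x₁ = solve-∀
    T₃-bound : E * E₁ * T₃ ≤ W * error i
    T₃-bound = begin
      E * E₁ * T₃ ≡⟨ sym (∑-*ˡ R (E * E₁) _) ⟩
      ∑ R (λ a → E * E₁ * (proj₁ a * ∣ G (z * q-of a) ℤ.- G (y * p-of a) ∣)) ≤⟨ ∑-mono∈ R (λ a a∈ → ≤-trans (≤-reflexive (x₁ (E * E₁) (proj₁ a) _)) (*-monoʳ-≤ (proj₁ a) (each a a∈))) ⟩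
      ∑ R (λ a → proj₁ a * error i) ≡⟨ ∑-*ʳ R (error i) proj₁ ⟩
      W * error i ∎
      where
      x₁ : ∀ a b c → a * (b * c) ≡ b * (a * c)
      x₁ = solve-∀

-- From slow variation to M (N) = o(N)

bernoulli : ∀ F n → (F + n) * F ^ n ≤ F * suc F ^ n
bernoulli F zero = ≤-reflexive (cong (_* 1) (+-identityʳ F))
bernoulli F (suc n) = begin
  (F + suc n) * (F * F ^ n) ≡⟨ x₁ F n (F ^ n) ⟩
  F * ((F + n) * F ^ n) + F * F ^ n ≤⟨ +-mono-≤ (≤-refl {F * ((F + n) * F ^ n)}) (*-monoˡ-≤ (F ^ n) (m≤m+n F n)) ⟩
  F * ((F + n) * F ^ n) + (F + n) * F ^ n ≡⟨ x₂ F ((F + n) * F ^ n) ⟩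
  suc F * ((F + n) * F ^ n) ≤⟨ *-monoʳ-≤ (suc F) (bernoulli F n) ⟩
  suc F * (F * suc F ^ n) ≡⟨ x₃ F (suc F ^ n) ⟩
  F * (suc F * suc F ^ n) ∎
  where
  open ≤-Reasoning
  x₁ : ∀ F n g → (F + suc n) * (F * g) ≡ F * ((F + n) * g) + F * g
  x₁ = solve-∀
  x₂ : ∀ F g → F * g + g ≡ suc F * g
  x₂ = solve-∀
  x₃ : ∀ F g → suc F * (F * g) ≡ F * (suc F * g)
  x₃ = solve-∀

2*F^F≤ : ∀ F → 1 ≤ F → 2 * F ^ F ≤ suc F ^ F
2*F^F≤ F 1≤F = *-cancelˡ-≤ F {{>-nonZero 1≤F}} (≤-trans (≤-reflexive (x F (F ^ F))) (bernoulli F F))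
  where
  x : ∀ F g → F * (2 * g) ≡ (F + F) * g
  x = solve-∀

*-^ : ∀ a b k → (a * b) ^ k ≡ a ^ k * b ^ k
*-^ a b zero = refl
*-^ a b (suc k) = trans (cong (a * b *_) (*-^ a b k)) (swap a b (a ^ k) (b ^ k))
  where
  swap : ∀ a b c d → a * b * (c * d) ≡ a * c * (b * d)
  swap = solve-∀

-- (1 + 1 / F)^F ≥ 2 and 2^c ≥ c. So F c rounds are enough to bring down any initial ratio up to c.
growth : ∀ F c → 1 ≤ F → c * F ^ (F * c) ≤ suc F ^ (F * c)
growth F c 1≤F = begin
  c * F ^ (F * c) ≡⟨ cong (c *_) (sym (^-*-assoc F F c)) ⟩
  c * (F ^ F) ^ c ≤⟨ *-monoˡ-≤ ((F ^ F) ^ c) (<⇒≤ (n<2^n c)) ⟩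
  2 ^ c * (F ^ F) ^ c ≡⟨ sym (*-^ 2 (F ^ F) c) ⟩
  (2 * F ^ F) ^ c ≤⟨ ^-monoˡ-≤ c (2*F^F≤ F 1≤F) ⟩
  (suc F ^ F) ^ c ≡⟨ ^-*-assoc (suc F) F c ⟩
  suc F ^ (F * c) ∎
  where open ≤-Reasoning

-- The order of the quantifiers matters: F depends on E alone and governs the number of rounds; K is
-- chosen afterwards, large enough for the errors of all these rounds.
TwinnedFamilies : Set
TwinnedFamilies = ∀ E → 1 ≤ E → ∃ λ F → 1 ≤ F × (∀ K → 1 ≤ K → ∃ λ R → Twinned E F K R)

-- Averaging at y = 1 gives W G (1) ≈ - ∑ α G (p), while slow variation gives G (p) ≈ G (1) for the
-- finitely many p of a fixed family. So 2 W G (1) is small, and G (1) = M (N).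
mertens-small : TwinnedFamilies → ∀ E → 1 ≤ E → ∃ λ N₀ → ∀ N → N₀ ≤ N → E * ∣ mertens N ∣ ≤ 4 * N
mertens-small families E 1≤E = c * (SV.bound {0} ^ I * SV.K {0}) + length P₀ , λ N h → conclude N (≤-trans (m≤m+n _ _) h) (≤-trans (m≤n+m _ _) h)
  where
  F = proj₁ (families E 1≤E)
  1≤F = proj₁ (proj₂ (families E 1≤E))
  with-strength = proj₂ (proj₂ (families E 1≤E))
  R₀ = proj₁ (with-strength E 1≤E)
  P₀ = map left R₀
  av₀ : Averaging E P₀
  av₀ = Twinned.average₁ (proj₂ (with-strength E 1≤E))
  -- All ratios p / 1 in the fixed family are at most c, so F c rounds suffice by `growth`.
  c = suc (∑ P₀ proj₂)
  I = F * c
  -- Makes 6 I E N equal to E₁ N, so that `error I` is 4 E₁ N.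
  E₁ = 6 * (E * I)
  1≤I : 1 ≤ I
  1≤I = 1≤* 1≤F (s≤s z≤n)
  1≤E₁ : 1 ≤ E₁
  1≤E₁ = 1≤* {6} (s≤s z≤n) (1≤* 1≤E 1≤I)
  R = proj₁ (with-strength E₁ 1≤E₁)
  tw = proj₂ (with-strength E₁ 1≤E₁)
  module SV {N : ℕ} = SlowVariation E E₁ F N 1≤E₁ R tw

  conclude : ∀ N → c * (SV.bound {N} ^ I * SV.K {N}) ≤ N → length P₀ ≤ N → E * ∣ mertens N ∣ ≤ 4 * N
  conclude N small len = *-cancelˡ-≤ (2 * W) {{>-nonZero (*-mono-≤ {1} {2} (s≤s z≤n) 1≤W)}} (begin
    2 * W * (E * ∣ mertens N ∣) ≡⟨ x₁ W E ∣ mertens N ∣ ⟩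
    E * (2 * W * ∣ mertens N ∣) ≡⟨ cong (E *_) (trans (sym (ℤP.abs-* (pos (2 * W)) (mertens N))) (cong ∣_∣ rearranged)) ⟩
    E * ∣ A ℤ.+ S ∣ ≤⟨ *-monoʳ-≤ E (∣∣-+≤ A S ≤-refl S-bound) ⟩
    E * (∣ A ∣ + T) ≡⟨ *-distribˡ-+ E ∣ A ∣ T ⟩
    E * ∣ A ∣ + E * T ≤⟨ +-mono-≤ (scaled-average av₀ N (s≤s z≤n) (≤-trans len (÷-greatest (s≤s z≤n) (≤-reflexive (*-identityʳ N))))) T-bound ⟩
    3 * (W * N) + W * (4 * N) ≤⟨ m≤m+n _ (W * N) ⟩
    3 * (W * N) + W * (4 * N) + W * N ≡⟨ x₂ W N ⟩
    2 * W * (4 * N) ∎)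
    where
    open ≤-Reasoning
    open Averaging av₀
    W = weight P₀
    1≤W : 1 ≤ W
    1≤W = ≤-trans (1≤* (1≤* 1≤E 1≤E) 1≤V) large
    G = scaled N
    A = pos W ℤ.* G 1 ℤ.+ ∑ℤ P₀ (λ a → pos (proj₁ a) ℤ.* G (1 * proj₂ a))
    S = ∑ℤ P₀ (λ a → pos (proj₁ a) ℤ.* (G 1 ℤ.- G (1 * proj₂ a)))
    T = ∑ P₀ (λ a → proj₁ a * ∣ G 1 ℤ.- G (1 * proj₂ a) ∣)
    x₁ : ∀ w e m → 2 * w * (e * m) ≡ e * (2 * w * m)
    x₁ = solve-∀
    x₂ : ∀ w n → 3 * (w * n) + w * (4 * n) + w * n ≡ 2 * w * (4 * n)
    x₂ = solve-∀
    G1≡ : G 1 ≡ mertens N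
    G1≡ = trans (ℤP.*-identityˡ _) (cong mertens (÷-unique {N} {N} {1} (≤-reflexive (*-identityʳ N)) (≤-reflexive (cong suc (sym (*-identityʳ N))))))
    rearranged : pos (2 * W) ℤ.* mertens N ≡ A ℤ.+ S
    rearranged = trans (cong (pos (2 * W) ℤ.*_) (sym G1≡)) (trans (cong (ℤ._* G 1) (ℤP.pos-* 2 W)) (trans (ring (pos W) (G 1) Σ₁)
      (cong (λ t → A ℤ.+ t) (sym (trans (∑ℤ-cong P₀ (λ a → distr (pos (proj₁ a)) (G 1) (G (1 * proj₂ a)))) (trans (∑ℤ-- P₀ _ _)
        (cong (ℤ._- Σ₁) (trans (∑ℤ-*ˡ P₀ (G 1) _) (trans (cong (G 1 ℤ.*_) (∑ℤ-pos P₀ proj₁)) (ℤP.*-comm (G 1) (pos W)))))))))))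
      where
      Σ₁ = ∑ℤ P₀ (λ a → pos (proj₁ a) ℤ.* G (1 * proj₂ a))
      ring : ∀ w g s → pos 2 ℤ.* w ℤ.* g ≡ w ℤ.* g ℤ.+ s ℤ.+ (w ℤ.* g ℤ.- s)
      ring = ℤR.solve-∀
      distr : ∀ a g h → a ℤ.* (g ℤ.- h) ≡ g ℤ.* a ℤ.- a ℤ.* h
      distr = ℤR.solve-∀
    S-bound : ∣ S ∣ ≤ T
    S-bound = ≤-trans (∑ℤ-abs P₀ _) (∑-mono P₀ λ a → ≤-reflexive (ℤP.abs-* (pos (proj₁ a)) (G 1 ℤ.- G (1 * proj₂ a))))
    each : ∀ a → a ∈ P₀ → E * ∣ G 1 ℤ.- G (1 * proj₂ a) ∣ ≤ 4 * N
    each (α , p) a∈ = *-cancelˡ-≤ E₁ {{>-nonZero 1≤E₁}} (begin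
      E₁ * (E * ∣ G 1 ℤ.- G (1 * p) ∣) ≡⟨ trans (x₃ E₁ E _) (cong (E * E₁ *_) (trans (ℤP.∣i-j∣≡∣j-i∣ (G 1) (G (1 * p))) (cong (λ t → ∣ G t ℤ.- G 1 ∣) (*-identityˡ p)))) ⟩
      E * E₁ * ∣ G p ℤ.- G 1 ∣ ≤⟨ SV.slow I ≤-refl (prime≥2 (primes (α , p) a∈)) ratio (≤-trans (*-monoˡ-≤ (SV.bound {N} ^ I * SV.K {N}) p≤c) small) ⟩
      3 * (E₁ * N) + 6 * (I * (E * N)) ≡⟨ x₄ E I N ⟩
      E₁ * (4 * N) ∎)
      where
      x₃ : ∀ a b c → a * (b * c) ≡ b * a * c
      x₃ = solve-∀
      x₄ : ∀ E I N → 3 * (6 * (E * I) * N) + 6 * (I * (E * N)) ≡ 6 * (E * I) * (4 * N)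
      x₄ = solve-∀
      p≤c : p ≤ c
      p≤c = ≤-trans (∈⇒≤∑ proj₂ a∈) (n≤1+n _)
      ratio : p * F ^ I ≤ 1 * suc F ^ I
      ratio = ≤-trans (*-monoˡ-≤ (F ^ I) p≤c) (≤-trans (growth F c 1≤F) (≤-reflexive (sym (*-identityˡ _))))
    T-bound : E * T ≤ W * (4 * N)
    T-bound = ≤-trans (≤-reflexive (sym (∑-*ˡ P₀ E _))) (≤-trans (∑-mono∈ P₀ λ a a∈ →
      ≤-trans (≤-reflexive (x₅ E (proj₁ a) _)) (*-monoʳ-≤ (proj₁ a) (each a a∈))) (≤-reflexive (∑-*ʳ P₀ (4 * N) proj₁)))
      where
      x₅ : ∀ a b c → a * (b * c) ≡ b * (a * c)
      x₅ = solve-∀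

-- Logarithms, factorials and Chebyshev's function

lg-unique : ∀ {k n} → 2 ^ k ≤ n → n < 2 ^ suc k → lg n ≡ k
lg-unique {k} {n} l u = ≤-antisym (≤-pred (2^-cancel-< (≤-<-trans a u))) (≤-pred (2^-cancel-< (≤-<-trans l b)))
  where
  ab = lg-spec {n} (≤-trans (m^n>0 2 k) l)
  a = proj₁ ab
  b = proj₂ ab

additive-mono : ∀ {h h′} → (∀ q → h q ≤ h′ q) → ∀ n → 1 ≤ n → additive h n ≤ additive h′ n
additive-mono {h} {h′} le = factor-ind (λ n → additive h n ≤ additive h′ n)
  (≤-reflexive (trans (additive-1 h) (sym (additive-1 h′))))
  λ p m pp 1≤m ih → subst₂ _≤_ (sym (trans (additive-* h (prime≥1 pp) 1≤m) (cong (_+ additive h m) (additive-prime h pp))))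
     (sym (trans (additive-* h′ (prime≥1 pp) 1≤m) (cong (_+ additive h′ m) (additive-prime h′ pp)))) (+-mono-≤ (le p) ih)

2^additive≤^ : ∀ S h → (∀ p → Prime p → 2 ^ h p ≤ p ^ S) → ∀ n → 1 ≤ n → 2 ^ additive h n ≤ n ^ S
2^additive≤^ S h le = factor-ind (λ n → 2 ^ additive h n ≤ n ^ S)
  (≤-reflexive (trans (cong (2 ^_) (additive-1 h)) (sym (^-zeroˡ S))))
  λ p m pp 1≤m ih → subst₂ _≤_
    (sym (trans (cong (2 ^_) (trans (additive-* h (prime≥1 pp) 1≤m) (cong (_+ additive h m) (additive-prime h pp)))) (^-distribˡ-+-* 2 (h p) (additive h m))))
    (sym (*-^ p m S)) (*-mono-≤ (le p pp) ih)

^≤2^additive : ∀ S h → (∀ p → Prime p → p ^ S ≤ 2 ^ h p) → ∀ n → 1 ≤ n → n ^ S ≤ 2 ^ additive h n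
^≤2^additive S h le = factor-ind (λ n → n ^ S ≤ 2 ^ additive h n)
  (≤-reflexive (trans (^-zeroˡ S) (sym (cong (2 ^_) (additive-1 h)))))
  λ p m pp 1≤m ih → subst₂ _≤_ (sym (*-^ p m S))
    (sym (trans (cong (2 ^_) (trans (additive-* h (prime≥1 pp) 1≤m) (cong (_+ additive h m) (additive-prime h pp)))) (^-distribˡ-+-* 2 (h p) (additive h m))))
    (*-mono-≤ (le p pp) ih)

additive-+ : ∀ h h′ n → 1 ≤ n → additive (λ q → h q + h′ q) n ≡ additive h n + additive h′ n
additive-+ h h′ = factor-ind (λ n → additive (λ q → h q + h′ q) n ≡ additive h n + additive h′ n)
  (trans (additive-1 (λ q → h q + h′ q)) (sym (cong₂ _+_ (additive-1 h) (additive-1 h′))))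
  λ p m pp 1≤m ih → trans (trans (additive-* _ (prime≥1 pp) 1≤m) (cong₂ _+_ (additive-prime _ pp) ih))
    (trans (swap (h p) (h′ p) (additive h m) (additive h′ m))
      (sym (cong₂ _+_ (trans (additive-* h (prime≥1 pp) 1≤m) (cong (_+ additive h m) (additive-prime h pp)))
                      (trans (additive-* h′ (prime≥1 pp) 1≤m) (cong (_+ additive h′ m) (additive-prime h′ pp))))))
  where
  swap : ∀ a b c d → a + b + (c + d) ≡ a + c + (b + d)
  swap = solve-∀

valuation-count : ∀ {p} → Prime p → ∀ K n → 1 ≤ n → valuation p n ≤ K → ∑ (rng K) (λ k → ⟦ p ^ k ∣? n ⟧) ≡ valuation p n
valuation-count pp zero n 1≤n v≤0 = sym (n≤0⇒n≡0 v≤0)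
valuation-count {p} pp (suc K) n 1≤n v≤K with p ∣? n
... | no p∤n = trans (∑-zero (rng (suc K)) none) (sym (valuation-∤ pp n 1≤n p∤n))
  where
  none : ∀ k → k ∈ rng (suc K) → ⟦ p ^ k ∣? n ⟧ ≡ 0
  none k k∈ with k | proj₁ (∈-rng⁻ (suc K) k∈)
  ... | suc k′ | _ = ⟦⟧-false (p ^ suc k′ ∣? n) (λ d → p∤n (∣-trans (m∣m*n (p ^ k′)) d))
... | yes (divides m refl) = begin
  ∑ (rng (suc K)) (λ k → ⟦ p ^ k ∣? m * p ⟧) ≡⟨ ∑-rng-suc K _ ⟩
  ⟦ p ^ 1 ∣? m * p ⟧ + ∑ (rng K) (λ k → ⟦ p * p ^ k ∣? m * p ⟧) ≡⟨ cong₂ _+_ (⟦⟧-true (p ^ 1 ∣? m * p) (subst (_∣ m * p) (sym (*-identityʳ p)) (n∣m*n m)))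
      (∑-cong (rng K) λ k → ⟦⟧-iff (p * p ^ k ∣? m * p) (p ^ k ∣? m) (λ d → *-cancelˡ-∣ p {{prime⇒nonZero pp}} (subst (p * p ^ k ∣_) (*-comm m p) d))
         (λ d → subst (p * p ^ k ∣_) (*-comm p m) (*-monoʳ-∣ p d))) ⟩
  1 + ∑ (rng K) (λ k → ⟦ p ^ k ∣? m ⟧) ≡⟨ cong suc (valuation-count pp K m 1≤m (≤-pred (subst (_≤ suc K) split v≤K))) ⟩
  suc (valuation p m) ≡⟨ sym split ⟩
  valuation p (m * p) ∎
  where
  open ≡-Reasoning
  1≤m : 1 ≤ m
  1≤m = positive m 1≤n
    where
    positive : ∀ m → 1 ≤ m * p → 1 ≤ m
    positive (suc m) _ = s≤s z≤n
  split : valuation p (m * p) ≡ suc (valuation p m)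
  split = trans (additive-* _ 1≤m (prime≥1 pp)) (trans (cong (valuation p m +_) (valuation-self pp)) (+-comm _ 1))

count-≤ : ∀ B s → ∑ (rng B) (λ p → ⟦ p ≤? s ⟧) ≤ s
count-≤ zero s = z≤n
count-≤ (suc B) s with suc B ≤? s
... | no _ = count-≤ B s
... | yes B<s = ≤-trans (s≤s (∑⟦⟧≤ B (λ p → p ≤? s))) B<s

π : ℕ → ℕ
π x = ∑ (rng x) (λ p → ⟦ prime? p ⟧)

-- ℓ is B⁴ log₂, made completely additive by rounding at primes only; on [1, B] it is off by at most B.
module Log (B : ℕ) where

  S : ℕ
  S = B * B * (B * B)

  ℓₚ ℓ T : ℕ → ℕ
  ℓₚ p = lg (p ^ S)
  ℓ = additive ℓₚ
  T n = ∑ (rng n) ℓ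

  ℓ-* : ∀ {m n} → 1 ≤ m → 1 ≤ n → ℓ (m * n) ≡ ℓ m + ℓ n
  ℓ-* = additive-* ℓₚ

  ℓ-1 : ℓ 1 ≡ 0
  ℓ-1 = additive-1 ℓₚ

  ℓ-2 : ℓ 2 ≡ S
  ℓ-2 = trans (additive-prime ℓₚ prime[2]) (lg-unique ≤-refl (^-monoʳ-< 2 (s≤s (s≤s z≤n)) (n<1+n S)))

  ℓ-2^ : ∀ k → ℓ (2 ^ k) ≡ k * S
  ℓ-2^ k = trans (additive-^ ℓₚ k (s≤s z≤n)) (cong (k *_) ℓ-2)

  ℓₚ-lower : ∀ p → Prime p → 2 ^ ℓₚ p ≤ p ^ S
  ℓₚ-lower p pp = proj₁ (lg-spec (1≤^ S (prime≥1 pp)))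

  ℓ-lower : ∀ n → 1 ≤ n → 2 ^ ℓ n ≤ n ^ S
  ℓ-lower = 2^additive≤^ S ℓₚ ℓₚ-lower

  Ω : ℕ → ℕ
  Ω = additive (λ _ → 1)

  ℓ-upper : ∀ n → 1 ≤ n → n ^ S ≤ 2 ^ (ℓ n + Ω n)
  ℓ-upper n 1≤n = subst (λ e → n ^ S ≤ 2 ^ e) (additive-+ ℓₚ (λ _ → 1) n 1≤n)
    (^≤2^additive S (λ q → ℓₚ q + 1) (λ p pp → subst (λ e → p ^ S ≤ 2 ^ e) (+-comm 1 (ℓₚ p)) (<⇒≤ (proj₂ (lg-spec (1≤^ S (prime≥1 pp)))))) n 1≤n)

  Ω≤ : ∀ {n} → 1 ≤ n → n ≤ B → Ω n ≤ B
  Ω≤ {n} 1≤n n≤B = <⇒≤ (2^-cancel-< (≤-<-trans (2^additive≤^ 1 (λ _ → 1) (λ p pp → subst (2 ≤_) (sym (*-identityʳ p)) (prime≥2 pp)) n 1≤n)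
    (≤-<-trans (≤-trans (≤-reflexive (*-identityʳ n)) n≤B) (n<2^n B))))

  -- ℓ n falls short of B⁴ log₂ n by at most one per prime factor, and n ≤ B has at most B of them.
  ℓ-mono : ∀ {m n} → m ≤ n → n ≤ B → ℓ m ≤ ℓ n + B
  ℓ-mono {zero} _ _ = z≤n
  ℓ-mono {m@(suc _)} {n} m≤n n≤B = ≤-trans (2^-cancel-≤ (≤-trans (ℓ-lower m (s≤s z≤n)) (≤-trans (^-monoˡ-≤ S m≤n) (ℓ-upper n 1≤n))))
    (+-monoʳ-≤ (ℓ n) (Ω≤ 1≤n n≤B))
    where
    1≤n : 1 ≤ n
    1≤n = ≤-trans (s≤s z≤n) m≤n

  ℓ≤ : ∀ {m k} → m ≤ 2 ^ k → ℓ m ≤ S * k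
  ℓ≤ {zero} _ = z≤n
  ℓ≤ {m@(suc _)} {k} m≤ = 2^-cancel-≤ (≤-trans (ℓ-lower m (s≤s z≤n)) (≤-trans (^-monoˡ-≤ S m≤)
    (≤-reflexive (trans (^-*-assoc 2 k S) (cong (2 ^_) (*-comm k S))))))

  T-suc : ∀ m n → T (m + n) ≡ T m + ∑ (rng n) (λ i → ℓ (m + i))
  T-suc m n = ∑-rng-+ m n ℓ

  -- The range is cut into blocks of length a. Each number is compared with the multiple a (q + 1)
  -- that ends its block, where ℓ splits exactly as ℓ a + ℓ (q + 1).
  T-mult-upper : ∀ a q → 1 ≤ a → a * q ≤ B → T (a * q) ≤ a * T q + a * q * ℓ a + a * q * B
  T-mult-upper a zero 1≤a _ rewrite *-zeroʳ a = z≤n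
  T-mult-upper a (suc q) 1≤a aq≤B = begin
    T (a * suc q) ≡⟨ cong T (trans (*-suc a q) (+-comm a (a * q))) ⟩
    T (a * q + a) ≡⟨ T-suc (a * q) a ⟩
    T (a * q) + ∑ (rng a) (λ i → ℓ (a * q + i)) ≤⟨ +-mono-≤ (T-mult-upper a q 1≤a (≤-trans (*-monoʳ-≤ a (n≤1+n q)) aq≤B)) (≤-trans (∑-mono∈ (rng a) each)
         (≤-reflexive (∑-rng-const a (ℓ a + ℓ (suc q) + B)))) ⟩
    a * T q + a * q * ℓ a + a * q * B + a * (ℓ a + ℓ (suc q) + B) ≡⟨ collect a (T q) q (ℓ a) B (ℓ (suc q)) ⟩
    a * (ℓ (suc q) + T q) + a * suc q * ℓ a + a * suc q * B ∎
    where
    open ≤-Reasoning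
    collect : ∀ a t q l b m → a * t + a * q * l + a * q * b + a * (l + m + b) ≡ a * (m + t) + a * suc q * l + a * suc q * b
    collect = solve-∀
    each : ∀ i → i ∈ rng a → ℓ (a * q + i) ≤ ℓ a + ℓ (suc q) + B
    each i i∈ = subst (λ t → ℓ (a * q + i) ≤ t + B) (ℓ-* 1≤a (s≤s z≤n))
      (ℓ-mono (≤-trans (+-monoʳ-≤ (a * q) (proj₂ (∈-rng⁻ a i∈))) (≤-reflexive (trans (+-comm (a * q) a) (sym (*-suc a q))))) aq≤B)

  -- Here each block is compared with the multiple of a just before it. This shifts the sum by one
  -- block and leaves a ℓ (a q) over.
  T-mult-lower : ∀ a q → 1 ≤ a → a * q ≤ B → a * T q + a * q * ℓ a ≤ T (a * q) + a * ℓ (a * q) + a * q * B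
  T-mult-lower a zero 1≤a _ rewrite *-zeroʳ a = z≤n
  T-mult-lower a (suc q) 1≤a aq≤B = begin
    a * (ℓ (suc q) + T q) + a * suc q * ℓ a ≡⟨ regroup a (ℓ (suc q)) (T q) q (ℓ a) ⟩
    a * T q + a * q * ℓ a + a * (ℓ a + ℓ (suc q)) ≤⟨ +-mono-≤ (T-mult-lower a q 1≤a (≤-trans (*-monoʳ-≤ a (n≤1+n q)) aq≤B)) (≤-reflexive (cong (a *_) (sym (ℓ-* 1≤a (s≤s z≤n))))) ⟩
    T (a * q) + a * ℓ (a * q) + a * q * B + a * ℓ (a * suc q) ≤⟨ +-monoˡ-≤ (a * ℓ (a * suc q)) (+-monoˡ-≤ (a * q * B) (+-monoʳ-≤ (T (a * q)) block)) ⟩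
    T (a * q) + (∑ (rng a) (λ i → ℓ (a * q + i)) + a * B) + a * q * B + a * ℓ (a * suc q) ≡⟨ regroup′ (T (a * q)) _ a B q (a * ℓ (a * suc q)) ⟩
    T (a * q) + ∑ (rng a) (λ i → ℓ (a * q + i)) + a * ℓ (a * suc q) + a * suc q * B ≡⟨ cong (λ t → t + a * ℓ (a * suc q) + a * suc q * B)
        (trans (sym (T-suc (a * q) a)) (cong T (trans (+-comm (a * q) a) (sym (*-suc a q))))) ⟩
    T (a * suc q) + a * ℓ (a * suc q) + a * suc q * B ∎
    where
    open ≤-Reasoning
    regroup : ∀ a m t q l → a * (m + t) + a * suc q * l ≡ a * t + a * q * l + a * (l + m)
    regroup = solve-∀
    regroup′ : ∀ t s a b q x → t + (s + a * b) + a * q * b + x ≡ t + s + x + a * suc q * b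
    regroup′ = solve-∀
    block : a * ℓ (a * q) ≤ ∑ (rng a) (λ i → ℓ (a * q + i)) + a * B
    block = begin
      a * ℓ (a * q) ≡⟨ sym (∑-rng-const a (ℓ (a * q))) ⟩
      ∑ (rng a) (λ _ → ℓ (a * q)) ≤⟨ ∑-mono∈ (rng a) (λ i i∈ → ℓ-mono (m≤m+n (a * q) i) (≤-trans (+-monoʳ-≤ (a * q) (proj₂ (∈-rng⁻ a i∈)))
            (≤-trans (≤-reflexive (trans (+-comm (a * q) a) (sym (*-suc a q)))) aq≤B))) ⟩
      ∑ (rng a) (λ i → ℓ (a * q + i) + B) ≡⟨ trans (∑-+ (rng a) _ _) (cong (∑ (rng a) (λ i → ℓ (a * q + i)) +_) (∑-rng-const a B)) ⟩
      ∑ (rng a) (λ i → ℓ (a * q + i)) + a * B ∎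

  -- A crude Stirling formula, log₂ n! ≥ n log₂ n - 2 n at n = 2^g, by doubling: the numbers beyond
  -- 2^g have binary logarithm at least g.
  T-2^-lower : ∀ g → 2 ^ g ≤ B → g * 2 ^ g * S ≤ T (2 ^ g) + 2 * 2 ^ g * S + 2 ^ g * B
  T-2^-lower zero _ = z≤n
  T-2^-lower (suc g) h = begin
    suc g * (2 * x) * S ≡⟨ r₁ g x S ⟩
    g * x * S + x * (g * S) + 2 * x * S ≤⟨ +-monoˡ-≤ (2 * x * S) (+-mono-≤ (T-2^-lower g x≤B) block) ⟩
    T x + 2 * x * S + x * B + (Δ + x * B) + 2 * x * S ≡⟨ r₂ (T x) x S B Δ ⟩
    T x + Δ + 2 * (2 * x) * S + 2 * x * B ≡⟨ cong (λ t → t + 2 * (2 * x) * S + 2 * x * B) (trans (sym (T-suc x x)) (cong T (cong (x +_) (sym (+-identityʳ x))))) ⟩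
    T (2 * x) + 2 * (2 * x) * S + 2 * x * B ∎
    where
    open ≤-Reasoning
    x = 2 ^ g
    Δ = ∑ (rng x) (λ i → ℓ (x + i))
    x≤B : x ≤ B
    x≤B = ≤-trans (m≤m+n x (x + 0)) h
    r₁ : ∀ g x s → suc g * (2 * x) * s ≡ g * x * s + x * (g * s) + 2 * x * s
    r₁ = solve-∀
    r₂ : ∀ t x s b d → t + 2 * x * s + x * b + (d + x * b) + 2 * x * s ≡ t + d + 2 * (2 * x) * s + 2 * x * b
    r₂ = solve-∀
    block : x * (g * S) ≤ Δ + x * B
    block = begin
      x * (g * S) ≡⟨ sym (∑-rng-const x (g * S)) ⟩
      ∑ (rng x) (λ _ → g * S) ≤⟨ ∑-mono∈ (rng x) (λ i i∈ → ≤-trans (≤-reflexive (sym (ℓ-2^ g))) (ℓ-mono (m≤m+n x i)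
           (≤-trans (+-monoʳ-≤ x (proj₂ (∈-rng⁻ x i∈))) (≤-trans (≤-reflexive (cong (x +_) (sym (+-identityʳ x)))) h)))) ⟩
      ∑ (rng x) (λ i → ℓ (x + i) + B) ≡⟨ trans (∑-+ (rng x) _ _) (cong (Δ +_) (∑-rng-const x B)) ⟩
      Δ + x * B ∎

  T-increment : ∀ x h {k} → x + h ≤ 2 ^ k → T (x + h) ≤ T x + h * (S * k)
  T-increment x h {k} le = ≤-trans (≤-reflexive (T-suc x h)) (+-monoʳ-≤ (T x) (≤-trans (∑-mono∈ (rng h) λ i i∈ →
    ℓ≤ {x + i} {k} (≤-trans (+-monoʳ-≤ x (proj₂ (∈-rng⁻ h i∈))) le)) (≤-reflexive (∑-rng-const h (S * k)))))

  coef : ℕ → ℕ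
  coef p = ⟦ prime? p ⟧ * ℓₚ p

  -- sums over prime powers p ^ k with the von Mangoldt weight
  ∑ₚ : (ℕ → ℕ → ℕ) → ℕ
  ∑ₚ f = ∑ (rng B) (λ p → ∑ (rng B) (λ k → coef p * f p k))

  ∑ₚ-mono : ∀ {f g} → (∀ p k → 1 ≤ p → f p k ≤ g p k) → ∑ₚ f ≤ ∑ₚ g
  ∑ₚ-mono h = ∑-mono∈ (rng B) λ p p∈ → ∑-mono (rng B) λ k → *-monoʳ-≤ (coef p) (h p k (proj₁ (∈-rng⁻ B p∈)))

  ∑ₚ-+ : ∀ f g → ∑ₚ (λ p k → f p k + g p k) ≡ ∑ₚ f + ∑ₚ g
  ∑ₚ-+ f g = trans (∑-cong (rng B) λ p → trans (∑-cong (rng B) λ k → *-distribˡ-+ (coef p) (f p k) (g p k)) (∑-+ (rng B) _ _)) (∑-+ (rng B) _ _)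

  -- Chebyshev's function times B⁴ / log 2, with rounded logarithms. For x ≤ B no prime power is
  -- missed, since p^k ≤ B forces k ≤ B.
  ψ : ℕ → ℕ
  ψ x = ∑ₚ (λ p k → ⟦ p ^ k ≤? x ⟧)

  -- The identity log n = ∑ Λ (d) over d ∣ n. It holds without error because ℓ is rounded at the
  -- primes and extended additively; hence `legendre` is exact too.
  ∑ₚ-divisors : ∀ n → 1 ≤ n → n ≤ B → ∑ₚ (λ p k → ⟦ p ^ k ∣? n ⟧) ≡ ℓ n
  ∑ₚ-divisors n 1≤n n≤B = trans (∑-cong (rng B) λ p → trans (∑-*ˡ (rng B) (coef p) _) (inner p)) (outer n 1≤n n≤B)
    where
    inner : ∀ p → coef p * ∑ (rng B) (λ k → ⟦ p ^ k ∣? n ⟧) ≡ coef p * valuation p n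
    inner p with prime? p
    ... | no _ = refl
    ... | yes pp = cong (1 * ℓₚ p *_) (valuation-count pp B n 1≤n (≤-trans (additive-mono (λ q → ⟦⟧≤1 (p ≟ q)) n 1≤n) (Ω≤ 1≤n n≤B)))
    outer : ∀ n → 1 ≤ n → n ≤ B → ∑ (rng B) (λ p → coef p * valuation p n) ≡ ℓ n
    outer = factor-ind (λ n → n ≤ B → ∑ (rng B) (λ p → coef p * valuation p n) ≡ ℓ n)
      (λ _ → trans (∑-zero (rng B) λ p _ → trans (cong (coef p *_) (additive-1 (λ q → ⟦ p ≟ q ⟧))) (*-zeroʳ (coef p))) (sym ℓ-1))
      λ q m pq 1≤m ih qm≤B → trans (∑-cong (rng B) (λ p → trans (cong (coef p *_) (trans (additive-* _ (prime≥1 pq) 1≤m) (cong (_+ valuation p m) (additive-prime _ pq))))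
          (trans (*-distribˡ-+ (coef p) ⟦ p ≟ q ⟧ (valuation p m)) (cong (_+ coef p * valuation p m) (trans (*-comm (coef p) _) (cong (_* coef p) (⟦⟧-iff (p ≟ q) (q ≟ p) sym sym)))))))
        (trans (∑-+ (rng B) _ _) (trans (cong₂ _+_ (trans (∑-delta B q coef (prime≥1 pq) (≤-trans (m≤m*n q m {{>-nonZero 1≤m}}) qm≤B))
            (trans (cong (_* ℓₚ q) (⟦⟧-true (prime? q) pq)) (*-identityˡ (ℓₚ q))))
          (ih (≤-trans (m≤n*m m q {{prime⇒nonZero pq}}) qm≤B)))
        (sym (trans (ℓ-* (prime≥1 pq) 1≤m) (cong (_+ ℓ m) (additive-prime ℓₚ pq))))))

  legendre : ∀ n → n ≤ B → T n ≡ ∑ₚ (λ p k → n ÷ p ^ k)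
  legendre n n≤B = begin
    ∑ (rng n) ℓ ≡⟨ ∑-cong∈ (rng n) (λ m m∈ → let a , b = ∈-rng⁻ n m∈ in sym (∑ₚ-divisors m a (≤-trans b n≤B))) ⟩
    ∑ (rng n) (λ m → ∑ₚ (λ p k → ⟦ p ^ k ∣? m ⟧)) ≡⟨ ∑-swap (rng n) (rng B) _ ⟩
    ∑ (rng B) (λ p → ∑ (rng n) (λ m → ∑ (rng B) (λ k → coef p * ⟦ p ^ k ∣? m ⟧))) ≡⟨ ∑-cong∈ (rng B) (λ p p∈ → trans (∑-swap (rng n) (rng B) _) (∑-cong (rng B) λ k →
        trans (∑-*ˡ (rng n) (coef p) _) (cong (coef p *_) (count-multiples n (1≤^ k (proj₁ (∈-rng⁻ B p∈))))))) ⟩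
    ∑ₚ (λ p k → n ÷ p ^ k) ∎
    where open ≡-Reasoning

  ψ-mono : ∀ {x y} → x ≤ y → ψ x ≤ ψ y
  ψ-mono {x} {y} x≤y = ∑ₚ-mono λ p k _ → ⟦⟧-mono (p ^ k ≤? x) (p ^ k ≤? y) (λ h → ≤-trans h x≤y)

  -- Compare term by term in Legendre's formula: a prime power m in (x, x + h] exceeds both x and h,
  -- so ⌊x / m⌋ and ⌊h / m⌋ are 0 while ⌊(x + h) / m⌋ is at least 1.
  ψ-short-interval : ∀ x h → h ≤ x → x + h ≤ B → T x + T h + ψ (x + h) ≤ T (x + h) + ψ x
  ψ-short-interval x h h≤x x+h≤B = subst₂ _≤_
    (trans (∑ₚ-+ _ _) (cong (_+ ψ (x + h)) (trans (∑ₚ-+ _ _) (sym (cong₂ _+_ (legendre x (≤-trans (m≤m+n x h) x+h≤B)) (legendre h (≤-trans (m≤n+m h x) x+h≤B)))))))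
    (trans (∑ₚ-+ _ _) (cong (_+ ψ x) (sym (legendre (x + h) x+h≤B))))
    (∑ₚ-mono λ p k 1≤p → termwise (p ^ k) (1≤^ k 1≤p))
    where
    open ≤-Reasoning
    termwise : ∀ m → 1 ≤ m → x ÷ m + h ÷ m + ⟦ m ≤? x + h ⟧ ≤ (x + h) ÷ m + ⟦ m ≤? x ⟧
    termwise m 1≤m with m ≤? x
    ... | yes m≤x = +-mono-≤ (÷-greatest 1≤m (≤-trans (≤-reflexive (*-distribʳ-+ m (x ÷ m) (h ÷ m))) (+-mono-≤ (÷-lower x m) (÷-lower h m)))) (⟦⟧≤1 (m ≤? x + h))
    ... | no m≰x rewrite ÷-zero {x} {m} (≰⇒> m≰x) | ÷-zero {h} {m} (≤-<-trans h≤x (≰⇒> m≰x)) with m ≤? x + h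
    ... | yes m≤ = ≤-trans (÷-greatest 1≤m (≤-trans (≤-reflexive (*-identityˡ m)) m≤)) (m≤m+n _ 0)
    ... | no _ = z≤n

  -- ⌊2 q / m⌋ - 2 ⌊q / m⌋ is at most 1, and it is 0 when m > 2 q. So ψ (2 q) dominates the
  -- logarithm of the central binomial coefficient.
  ψ-central : ∀ q → q + q ≤ B → T (q + q) ≤ T q + T q + ψ (q + q)
  ψ-central q 2q≤B = subst₂ _≤_ (sym (legendre (q + q) 2q≤B))
    (trans (∑ₚ-+ _ _) (cong (_+ ψ (q + q)) (trans (∑ₚ-+ _ _) (sym (cong₂ _+_ lq lq)))))
    (∑ₚ-mono λ p k 1≤p → termwise (p ^ k) (1≤^ k 1≤p))
    where
    lq = legendre q (≤-trans (m≤m+n q q) 2q≤B)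
    termwise : ∀ m → 1 ≤ m → (q + q) ÷ m ≤ q ÷ m + q ÷ m + ⟦ m ≤? q + q ⟧
    termwise m 1≤m with m ≤? q + q
    ... | yes _ = ÷-least (≤-trans (+-mono-< (÷-upper q 1≤m) (÷-upper q 1≤m)) (≤-reflexive (r (q ÷ m) m)))
      where
      r : ∀ a m → suc a * m + suc a * m ≡ suc (a + a + 1) * m
      r = solve-∀
    ... | no m≰ = ≤-trans (≤-reflexive (÷-zero (≰⇒> m≰))) z≤n

  -- `T-mult-lower` with a = 2 bounds the central binomial coefficient from below by 4^q / (2 q)²,
  -- up to rounding.
  chebyshev : ∀ q → q + q ≤ B → 2 * q * S ≤ ψ (q + q) + 2 * ℓ (q + q) + 2 * q * B
  chebyshev q 2q≤B = by-lin (+-mono-≤ (T-mult-lower 2 q (s≤s z≤n) (subst (_≤ B) (sym 2q) 2q≤B)) (ψ-central q 2q≤B))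
    (≤-reflexive (subst₂ (λ s d → T (2 * q) + 2 * ℓ (2 * q) + 2 * q * B + (T q + T q + ψ (q + q)) + 2 * q * S ≡ 2 * T q + 2 * q * s + d + (ψ (q + q) + 2 * ℓ (q + q) + 2 * q * B))
      (sym ℓ-2) (cong T 2q) (subst (λ e → T (2 * q) + 2 * ℓ (2 * q) + 2 * q * B + (T q + T q + ψ (q + q)) + 2 * q * S ≡ 2 * T q + 2 * q * S + T (2 * q) + (ψ (q + q) + 2 * ℓ e + 2 * q * B)) 2q
         (r (T (2 * q)) (ℓ (2 * q)) q B (T q) (ψ (q + q)) S))))
    where
    2q : 2 * q ≡ q + q
    2q = cong (q +_) (+-identityʳ q)
    r : ∀ t l q b u p s → t + 2 * l + 2 * q * b + (u + u + p) + 2 * q * s ≡ 2 * u + 2 * q * s + t + (p + 2 * l + 2 * q * b)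
    r = solve-∀

  π-as-∑ : ∀ {x} → x ≤ B → ∑ (rng B) (λ p → ⟦ prime? p ⟧ * ⟦ p ≤? x ⟧) ≡ π x
  π-as-∑ {x} x≤B = trans (cong (λ n → ∑ (rng n) (λ p → ⟦ prime? p ⟧ * ⟦ p ≤? x ⟧)) (sym (m+[n∸m]≡n x≤B)))
    (trans (∑-rng-+ x (B ∸ x) _) (trans (cong₂ _+_
      (∑-cong∈ (rng x) λ p p∈ → trans (cong (⟦ prime? p ⟧ *_) (⟦⟧-true (p ≤? x) (proj₂ (∈-rng⁻ x p∈)))) (*-identityʳ _))
      (∑-zero (rng (B ∸ x)) λ i i∈ → trans (cong (⟦ prime? (x + i) ⟧ *_) (⟦⟧-false (x + i ≤? x) (<⇒≱ (m<m+n x (proj₁ (∈-rng⁻ (B ∸ x) i∈)))))) (*-zeroʳ ⟦ prime? (x + i) ⟧)))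
      (+-identityʳ _)))

  ^-big : ∀ {p x k} → 1 ≤ p → x < p → 1 ≤ k → ¬ p ^ k ≤ x
  ^-big {p} {x} {suc k} 1≤p x<p _ h = <⇒≱ x<p (≤-trans (m≤m*n p (p ^ k) {{>-nonZero (1≤^ k 1≤p)}}) h)

  powers : ℕ → ℕ → ℕ
  powers p x = ∑ (rng B) (λ k → coef p * ⟦ p ^ k ≤? x ⟧)

  powers-mono : ∀ p {x y} → x ≤ y → powers p x ≤ powers p y
  powers-mono p {x} {y} x≤y = ∑-mono (rng B) λ k → *-monoʳ-≤ (coef p) (⟦⟧-mono (p ^ k ≤? x) (p ^ k ≤? y) (λ h → ≤-trans h x≤y))

  powers-none : ∀ {p x} → 1 ≤ p → x < p → powers p x ≡ 0
  powers-none {p} {x} 1≤p x<p = ∑-zero (rng B) λ k k∈ → trans (cong (coef p *_) (⟦⟧-false (p ^ k ≤? x) (^-big 1≤p x<p (proj₁ (∈-rng⁻ B k∈))))) (*-zeroʳ (coef p))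

  coef-prime : ∀ {p} → Prime p → coef p ≡ ℓₚ p
  coef-prime {p} pp = trans (cong (_* ℓₚ p) (⟦⟧-true (prime? p) pp)) (*-identityˡ _)

  powers-some : ∀ {p x} → 1 ≤ B → p ≤ x → coef p ≤ powers p x
  powers-some {p} {x} 1≤B p≤x = ≤-trans (≤-reflexive (sym (trans (cong (coef p *_) (⟦⟧-true (p ^ 1 ≤? x) (subst (_≤ x) (sym (*-identityʳ p)) p≤x))) (*-identityʳ _))))
    (∈⇒≤∑ (λ k → coef p * ⟦ p ^ k ≤? x ⟧) (∈-rng⁺ B ≤-refl 1≤B))

  -- If p^K is the largest power counted, the sum is at most K ℓ p = ℓ (p^K), and p^K ≤ x.
  powers≤ : ∀ {p x k} → Prime p → x ≤ 2 ^ k → powers p x ≤ S * k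
  powers≤ {p} {x} {e} pp x≤ = ≤-trans (≤-reflexive (trans (∑-*ˡ (rng B) (coef p) _) (*-comm (coef p) _))) (go B)
    where
    open ≤-Reasoning
    go : ∀ K → ∑ (rng K) (λ k → ⟦ p ^ k ≤? x ⟧) * coef p ≤ S * e
    go zero = z≤n
    go (suc K) with p ^ suc K ≤? x
    ... | no _ = go K
    ... | yes h = begin
      suc (∑ (rng K) (λ k → ⟦ p ^ k ≤? x ⟧)) * coef p ≤⟨ *-mono-≤ (s≤s (∑⟦⟧≤ K (λ k → p ^ k ≤? x))) (≤-reflexive (trans (coef-prime pp) (sym (additive-prime ℓₚ pp)))) ⟩
      suc K * ℓ p ≡⟨ sym (additive-^ ℓₚ (suc K) (prime≥1 pp)) ⟩
      ℓ (p ^ suc K) ≤⟨ ℓ≤ {p ^ suc K} {e} (≤-trans h x≤) ⟩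
      S * e ∎

  powers-single : ∀ {p x s} → 1 ≤ p → x < suc s * suc s → s < p → powers p x ≤ coef p * ⟦ p ≤? x ⟧
  powers-single {p} {x} {s} 1≤p x< s<p = ≤-trans (≤-reflexive (∑-*ˡ (rng B) (coef p) _)) (*-monoʳ-≤ (coef p) (go B))
    where
    go : ∀ K → ∑ (rng K) (λ k → ⟦ p ^ k ≤? x ⟧) ≤ ⟦ p ≤? x ⟧
    go zero = z≤n
    go (suc zero) = ≤-trans (≤-reflexive (+-identityʳ _)) (⟦⟧-mono (p ^ 1 ≤? x) (p ≤? x) (subst (_≤ x) (*-identityʳ p)))
    go (suc (suc K)) = ≤-trans (≤-reflexive (cong (_+ ∑ (rng (suc K)) (λ k → ⟦ p ^ k ≤? x ⟧)) (⟦⟧-false (p ^ suc (suc K) ≤? x) (λ h → <⇒≱ x< (≤-trans (*-mono-≤ s<p s<p) (≤-trans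
       (≤-trans (m≤m*n (p * p) (p ^ K) {{>-nonZero (1≤^ K 1≤p)}}) (≤-reflexive (*-assoc p p (p ^ K)))) h)))))) (go (suc K))

  ψ-count-lower : ∀ {x y m} → x ≤ y → y ≤ B → (∀ p → Prime p → x < p → p ≤ y → m ≤ ℓₚ p) → ψ x + m * π y ≤ ψ y + m * π x
  ψ-count-lower {x} {y} {m} x≤y y≤B big = subst₂ (λ u v → ψ x + m * u ≤ ψ y + m * v) (π-as-∑ y≤B) (π-as-∑ (≤-trans x≤y y≤B))
    (subst₂ _≤_ (join x y) (join y x) (∑-mono∈ (rng B) λ p p∈ → each p (proj₁ (∈-rng⁻ B p∈)) (proj₂ (∈-rng⁻ B p∈))))
    where
    open ≤-Reasoning
    join : ∀ x y → ∑ (rng B) (λ p → powers p x + m * (⟦ prime? p ⟧ * ⟦ p ≤? y ⟧)) ≡ ψ x + m * ∑ (rng B) (λ p → ⟦ prime? p ⟧ * ⟦ p ≤? y ⟧)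
    join x y = trans (∑-+ (rng B) _ _) (cong (ψ x +_) (∑-*ˡ (rng B) m _))
    each : ∀ p → 1 ≤ p → p ≤ B → powers p x + m * (⟦ prime? p ⟧ * ⟦ p ≤? y ⟧) ≤ powers p y + m * (⟦ prime? p ⟧ * ⟦ p ≤? x ⟧)
    each p 1≤p p≤B = cases (p ≤? x) (p ≤? y) (prime? p)
      where
      cases : (a : Dec (p ≤ x)) (b : Dec (p ≤ y)) (c : Dec (Prime p)) → powers p x + m * (⟦ c ⟧ * ⟦ b ⟧) ≤ powers p y + m * (⟦ c ⟧ * ⟦ a ⟧)
      cases (yes _) b c = +-mono-≤ (powers-mono p x≤y) (*-monoʳ-≤ m (*-monoʳ-≤ ⟦ c ⟧ (⟦⟧≤1 b)))
      cases (no _) (no _) c = +-monoˡ-≤ _ (powers-mono p x≤y)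
      cases (no _) (yes _) (no _) = +-monoˡ-≤ _ (powers-mono p x≤y)
      cases (no p≰x) (yes p≤y) (yes pp) = begin
        powers p x + m * 1 ≡⟨ cong₂ _+_ (powers-none 1≤p (≰⇒> p≰x)) (*-identityʳ m) ⟩
        m ≤⟨ big p pp (≰⇒> p≰x) p≤y ⟩
        ℓₚ p ≡⟨ sym (coef-prime pp) ⟩
        coef p ≤⟨ powers-some (≤-trans 1≤p p≤B) p≤y ⟩
        powers p y ≤⟨ m≤m+n _ _ ⟩
        powers p y + m * 0 ∎

  -- A prime beyond s ≥ ⌊√y⌋ enters ψ through its first power only, with at most S k; the primes up
  -- to s, with all their powers, are covered by the extra s.
  ψ-count-upper : ∀ {x y k s} → x ≤ y → y ≤ B → y ≤ 2 ^ k → y < suc s * suc s → ψ y + S * k * π x ≤ ψ x + S * k * (π y + s)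
  ψ-count-upper {x} {y} {k} {s} x≤y y≤B y≤2^k y<s² = subst₂ (λ u v → ψ y + L * u ≤ ψ x + L * (v + s)) (π-as-∑ (≤-trans x≤y y≤B)) (π-as-∑ y≤B)
    (begin
      ψ y + L * ∑ (rng B) (λ p → ⟦ prime? p ⟧ * ⟦ p ≤? x ⟧) ≡⟨ sym (trans (∑-+ (rng B) _ _) (cong (ψ y +_) (∑-*ˡ (rng B) L _))) ⟩
      ∑ (rng B) (λ p → powers p y + L * (⟦ prime? p ⟧ * ⟦ p ≤? x ⟧)) ≤⟨ ∑-mono∈ (rng B) (λ p p∈ → each p (proj₁ (∈-rng⁻ B p∈)) (proj₂ (∈-rng⁻ B p∈))) ⟩
      ∑ (rng B) (λ p → powers p x + L * (⟦ prime? p ⟧ * ⟦ p ≤? y ⟧ + ⟦ p ≤? s ⟧)) ≡⟨ trans (∑-+ (rng B) _ _) (cong (ψ x +_) (trans (∑-*ˡ (rng B) L _) (cong (L *_) (∑-+ (rng B) _ _)))) ⟩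
      ψ x + L * (∑ (rng B) (λ p → ⟦ prime? p ⟧ * ⟦ p ≤? y ⟧) + ∑ (rng B) (λ p → ⟦ p ≤? s ⟧)) ≤⟨ +-monoʳ-≤ (ψ x) (*-monoʳ-≤ L (+-monoʳ-≤ _ (count-≤ B s))) ⟩
      ψ x + L * (∑ (rng B) (λ p → ⟦ prime? p ⟧ * ⟦ p ≤? y ⟧) + s) ∎)
    where
    open ≤-Reasoning
    L = S * k
    each : ∀ p → 1 ≤ p → p ≤ B → powers p y + L * (⟦ prime? p ⟧ * ⟦ p ≤? x ⟧) ≤ powers p x + L * (⟦ prime? p ⟧ * ⟦ p ≤? y ⟧ + ⟦ p ≤? s ⟧)
    each p 1≤p p≤B = by-primality (prime? p)
      where
      by-primality : (d : Dec (Prime p)) → powers p y + L * (⟦ d ⟧ * ⟦ p ≤? x ⟧) ≤ powers p x + L * (⟦ d ⟧ * ⟦ p ≤? y ⟧ + ⟦ p ≤? s ⟧)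
      by-primality (no ¬pp) = ≤-trans (≤-reflexive (cong (_+ L * 0) (∑-zero (rng B) λ j _ → cong (λ t → t * ℓₚ p * ⟦ p ^ j ≤? y ⟧) (⟦⟧-false (prime? p) ¬pp))))
                     (≤-trans (≤-reflexive (*-zeroʳ L)) z≤n)
      by-primality (yes pp) = cases (p ≤? x) (p ≤? y) (p ≤? s)
       where
       cases : (a : Dec (p ≤ x)) (b : Dec (p ≤ y)) (c : Dec (p ≤ s)) → powers p y + L * (1 * ⟦ a ⟧) ≤ powers p x + L * (1 * ⟦ b ⟧ + ⟦ c ⟧)
       cases a b (yes _) = begin
         powers p y + L * (1 * ⟦ a ⟧) ≤⟨ +-mono-≤ (powers≤ {p} {y} {k} pp y≤2^k) (*-monoʳ-≤ L (*-monoʳ-≤ 1 (⟦⟧-mono a b (λ h → ≤-trans h x≤y)))) ⟩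
         L + L * (1 * ⟦ b ⟧) ≡⟨ r L ⟦ b ⟧ ⟩
         L * (1 * ⟦ b ⟧ + 1) ≤⟨ m≤n+m _ (powers p x) ⟩
         powers p x + L * (1 * ⟦ b ⟧ + 1) ∎
         where
         r : ∀ l b → l + l * (1 * b) ≡ l * (1 * b + 1)
         r = solve-∀
       cases (yes p≤x) (no p≰y) (no _) = contradiction (≤-trans p≤x x≤y) p≰y
       cases (yes p≤x) (yes p≤y) (no p≰s) = +-mono-≤ (≤-trans (powers-single 1≤p y<s² (≰⇒> p≰s)) (≤-trans (*-monoʳ-≤ (coef p) (⟦⟧≤1 (p ≤? y)))
          (≤-trans (≤-reflexive (*-identityʳ _)) (powers-some (≤-trans 1≤p p≤B) p≤x)))) (≤-refl {L * 1})
       cases (no p≰x) (yes p≤y) (no p≰s) = begin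
         powers p y + L * 0 ≡⟨ trans (cong (powers p y +_) (*-zeroʳ L)) (+-identityʳ _) ⟩
         powers p y ≤⟨ powers≤ {p} {y} {k} pp y≤2^k ⟩
         L ≡⟨ sym (*-identityʳ L) ⟩
         L * 1 ≤⟨ m≤n+m _ (powers p x) ⟩
         powers p x + L * 1 ∎
       cases (no p≰x) (no p≰y) (no p≰s) = begin
         powers p y + L * 0 ≡⟨ cong (_+ L * 0) (powers-none 1≤p (≰⇒> p≰y)) ⟩
         L * 0 ≤⟨ m≤n+m _ (powers p x) ⟩
         powers p x + L * 0 ∎

-- Chebyshev's bounds for primes in intervals

length-filter : ∀ {A : Set} {P : A → Set} (P? : ∀ x → Dec (P x)) (xs : List A) → length (filter P? xs) ≡ ∑ xs (λ x → ⟦ P? x ⟧)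
length-filter P? [] = refl
length-filter P? (x ∷ xs) with P? x
... | yes _ = cong suc (length-filter P? xs)
... | no _ = length-filter P? xs

rng-unique : ∀ n → Unique (rng n)
rng-unique zero = []
rng-unique (suc n) = LAll.tabulate (λ { i refl → 1+n≰n (proj₂ (∈-rng⁻ n i)) }) ∷ rng-unique n

primesIn : ℕ → ℕ → List ℕ
primesIn a h = filter prime? (map (λ i → a + i) (rng h))

count : ℕ → ℕ → ℕ
count a h = ∑ (rng h) (λ i → ⟦ prime? (a + i) ⟧)

length-primesIn : ∀ a h → length (primesIn a h) ≡ count a h
length-primesIn a h = trans (length-filter prime? (map (λ i → a + i) (rng h))) (∑-map (λ i → a + i) (rng h) _)

primesIn-unique : ∀ a h → Unique (primesIn a h)
primesIn-unique a h = Uniq.filter⁺ prime? (Uniq.map⁺ (+-cancelˡ-≡ a _ _) (rng-unique h))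

∈-primesIn : ∀ {p} a h → p ∈ primesIn a h → Prime p × a < p × p ≤ a + h
∈-primesIn {p} a h i with ∈-filter⁻ prime? {xs = map (λ i → a + i) (rng h)} i
... | i∈ , pp with ∈-map⁻ (λ i → a + i) i∈
... | j , j∈ , refl = pp , m<m+n a (proj₁ (∈-rng⁻ h j∈)) , +-monoʳ-≤ a (proj₂ (∈-rng⁻ h j∈))

π-count : ∀ a h → π (a + h) ≡ π a + count a h
π-count a h = ∑-rng-+ a h _

∑-blocks : ∀ C w (f : ℕ → ℕ) → ∑ (rng (C * w)) f ≡ ∑ (rng C) (λ i → ∑ (rng w) (λ j → f (pred i * w + j)))
∑-blocks zero w f = refl
∑-blocks (suc C) w f = trans (cong (λ n → ∑ (rng n) f) (+-comm w (C * w))) (trans (∑-rng-+ (C * w) w f)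
  (trans (cong (_+ ∑ (rng w) (λ j → f (C * w + j))) (∑-blocks C w f)) (+-comm _ (∑ (rng w) (λ j → f (C * w + j))))))

count-blocks : ∀ a C w → count a (C * w) ≡ ∑ (rng C) (λ i → count (a + pred i * w) w)
count-blocks a C w = trans (∑-blocks C w _) (∑-cong (rng C) λ i → ∑-cong (rng w) λ j → cong (λ n → ⟦ prime? n ⟧) (sym (+-assoc a (pred i * w) j)))

pigeonhole : ∀ C t f → 1 ≤ C → C * t ≤ ∑ (rng C) f → ∃ λ i → 1 ≤ i × i ≤ C × t ≤ f i
pigeonhole (suc C) t f _ h with t ≤? f (suc C)
... | yes p = suc C , s≤s z≤n , ≤-refl , p
pigeonhole (suc zero) t f _ h | no ¬p = contradiction (subst₂ _≤_ (+-identityʳ t) (+-identityʳ (f 1)) h) ¬p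
pigeonhole (suc (suc C)) t f _ h | no ¬p =
  let i , a , b , c = pigeonhole (suc C) t f (s≤s z≤n) (+-cancelˡ-≤ t _ _ (≤-trans h (+-monoˡ-≤ _ (<⇒≤ (≰⇒> ¬p))))) in i , a , m≤n⇒m≤1+n b , c

-- Take the largest index j with f j ≥ R. It and its lower neighbour account for at most 2 U, and
-- the rest still averages at least R over the indices below.
pigeonhole-two : ∀ C R U f → 1 ≤ R → (∀ i → 1 ≤ i → i ≤ C → f i ≤ U) → C * R + 2 * U < ∑ (rng C) f →
  ∃ λ i → ∃ λ j → 1 ≤ i × suc (suc i) ≤ j × j ≤ C × R ≤ f i × R ≤ f j
pigeonhole-two zero R U f 1≤R fU ()
pigeonhole-two (suc C) R U f 1≤R fU h with R ≤? f (suc C)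
... | no ¬p =
  let i , j , a , b , c , d , e = pigeonhole-two C R U f 1≤R (λ i a b → fU i a (m≤n⇒m≤1+n b)) (+-cancelˡ-< R _ _ (<-≤-trans (≤-<-trans (≤-reflexive (sym (+-assoc R (C * R) (2 * U)))) h) (+-monoˡ-≤ _ (<⇒≤ (≰⇒> ¬p)))))
  in i , j , a , b , m≤n⇒m≤1+n c , d , e
... | yes p = second C fU h p
  where
  open ≤-Reasoning
  second : ∀ C → (∀ i → 1 ≤ i → i ≤ suc C → f i ≤ U) → suc C * R + 2 * U < ∑ (rng (suc C)) f → R ≤ f (suc C) →
    ∃ λ i → ∃ λ j → 1 ≤ i × suc (suc i) ≤ j × j ≤ suc C × R ≤ f i × R ≤ f j
  second zero fU h _ = contradiction h (≤⇒≯ (≤-trans (≤-reflexive (+-identityʳ (f 1))) (≤-trans (fU 1 ≤-refl ≤-refl) (≤-trans (m≤m+n U (U + 0)) (m≤n+m (2 * U) (1 * R))))))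
  second (suc zero) fU h _ = contradiction h (≤⇒≯ (≤-trans (+-mono-≤ (fU 2 (s≤s z≤n) ≤-refl) (+-monoˡ-≤ 0 (fU 1 ≤-refl (s≤s z≤n)))) (m≤n+m (2 * U) (2 * R))))
  second (suc (suc C)) fU h p = let i , a , b , c = pigeonhole (suc C) R f (s≤s z≤n) rest in i , suc (suc (suc C)) , a , s≤s (s≤s b) , ≤-refl , c , p
    where
    rest : suc C * R ≤ ∑ (rng (suc C)) f
    rest = by-lin (+-mono-≤ (<⇒≤ h) (+-mono-≤ (fU (suc (suc (suc C))) (s≤s z≤n) ≤-refl) (fU (suc (suc C)) (s≤s z≤n) (n≤1+n _))))
      (≤-trans (m≤m+n _ (2 * R)) (≤-reflexive (r (f (suc (suc (suc C)))) (f (suc (suc C))) (∑ (rng (suc C)) f) U C R)))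
      where
      r : ∀ a b s U C R → a + (b + s) + (U + U) + suc C * R + 2 * R ≡ suc (suc (suc C)) * R + 2 * U + (a + b) + s
      r = solve-∀

module LogBounds (B : ℕ) where
  open Log B

  ℓₚ≥ : ∀ {p k} → 2 ^ k ≤ p → S * k ≤ ℓₚ p
  ℓₚ≥ {p} {k} h = ≤-pred (2^-cancel-< (≤-<-trans (≤-trans (≤-reflexive (trans (cong (2 ^_) (*-comm S k)) (sym (^-*-assoc 2 k S)))) (^-monoˡ-≤ S h))
    (proj₂ (lg-spec (1≤^ S (≤-trans (m^n>0 2 k) h))))))

  ψ-0 : ψ 0 ≡ 0
  ψ-0 = ∑-zero (rng B) λ p p∈ → powers-none (proj₁ (∈-rng⁻ B p∈)) (proj₁ (∈-rng⁻ B p∈))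

  -- Passing from q to 2 q adds at most the logarithm of the central binomial coefficient, about 2
  -- q, and these bounds form a geometric series.
  ψ-2^-upper : ∀ k → 2 ^ k ≤ B → ψ (2 ^ k) ≤ 2 * 2 ^ k * (S + B)
  ψ-2^-upper zero 1≤B = ≤-trans (by-lin (ψ-count-upper {0} {1} {0} {1} z≤n 1≤B ≤-refl (s≤s (s≤s z≤n))) (≤-reflexive base)) z≤n
    where
    base : ψ 0 + S * 0 * (π 1 + 1) + ψ 1 ≡ ψ 1 + S * 0 * π 0 + 0
    base rewrite ψ-0 | *-zeroʳ S = r (ψ 1)
      where
      r : ∀ x → x ≡ x + 0 + 0
      r = solve-∀
  ψ-2^-upper (suc k) h = by-lin (+-mono-≤ (ψ-short-interval q q ≤-refl qq≤B) (+-mono-≤ (T-mult-upper 2 q (s≤s z≤n) h) (ψ-2^-upper k (≤-trans (m≤m+n q (q + 0)) h))))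
    (≤-reflexive (subst₂ (λ l d → T d + ψ q + (2 * T q + 2 * q * l + 2 * q * B + 2 * q * (S + B)) + ψ (2 * q) ≡ T q + T q + ψ d + (T (2 * q) + ψ q) + 2 * (2 * q) * (S + B))
       (sym ℓ-2) (cong (q +_) (+-identityʳ q)) (r (T (2 * q)) (ψ q) (T q) q S B (ψ (2 * q)))))
    where
    q = 2 ^ k
    qq≤B : q + q ≤ B
    qq≤B = subst (_≤ B) (cong (q +_) (+-identityʳ q)) h
    r : ∀ t p u q s b v → t + p + (2 * u + 2 * q * s + 2 * q * b + 2 * q * (s + b)) + v ≡ u + u + v + (t + p) + 2 * (2 * q) * (s + b)
    r = solve-∀

2^-+ : ∀ a b → 2 ^ (a + b) ≡ 2 ^ a * 2 ^ b
2^-+ = ^-distribˡ-+-* 2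

-- With X = 2^(6 n), Chebyshev's bounds give ψ (64 X) - ψ (X) ≥ (32 - 4) X in units of S. The ratio
-- 64 leaves room for crude constants; prime powers cost only K s, which is of order n √X.
chebyshev-scale : ∀ n → 3 ≤ n → 2 * 2 ^ (6 * n) ≤ n * count (2 ^ (6 * n)) (63 * 2 ^ (6 * n))
chebyshev-scale n 3≤n = *-cancelˡ-≤ 12 (by-lin (+-mono-≤ reduced (+-mono-≤ (*-monoˡ-≤ (D + s) K≤) (*-monoʳ-≤ 4 s-small)))
    (≤-reflexive (r₁ X K D s n)))
  where
  X = 2 ^ (6 * n)
  K = 6 * n + 6
  Y = 2 ^ K
  D = count X (63 * X)
  s = 8 * 2 ^ (3 * n)
  open Log Y
  open LogBounds Y
  r₁ : ∀ X K D s n → K * (D + s) + (12 * n * (D + s) + 4 * X) + 12 * (2 * X) ≡ 28 * X + (K * (D + s) + 4 * (3 * (n * s))) + 12 * (n * D)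
  r₁ = solve-∀
  1≤n : 1 ≤ n
  1≤n = ≤-trans (s≤s z≤n) 3≤n
  K≤ : K ≤ 12 * n
  K≤ = ≤-trans (+-monoʳ-≤ (6 * n) (*-monoʳ-≤ 6 1≤n)) (≤-reflexive (r n))
    where
    r : ∀ n → 6 * n + 6 * n ≡ 12 * n
    r = solve-∀
  Y≡ : Y ≡ X + 63 * X
  Y≡ = trans (2^-+ (6 * n) 6) (r X)
    where
    r : ∀ x → x * 64 ≡ x + 63 * x
    r = solve-∀
  1≤Y : 1 ≤ Y
  1≤Y = m^n>0 2 K
  Y²≤S : Y * Y ≤ S
  Y²≤S = ≤-trans (≤-reflexive (sym (*-identityʳ (Y * Y)))) (*-monoʳ-≤ (Y * Y) (1≤* 1≤Y 1≤Y))
  Y≤S : Y ≤ S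
  Y≤S = ≤-trans (≤-trans (≤-reflexive (sym (*-identityʳ Y))) (*-monoʳ-≤ Y 1≤Y)) Y²≤S
  x³ : 2 ^ (6 * n) ≡ 2 ^ (3 * n) * 2 ^ (3 * n)
  x³ = trans (cong (2 ^_) (r n)) (2^-+ (3 * n) (3 * n))
    where
    r : ∀ n → 6 * n ≡ 3 * n + 3 * n
    r = solve-∀
  24n≤ : ∀ m → 24 * (3 + m) ≤ 2 ^ (3 * (3 + m))
  24n≤ zero = ≤ᵇ⇒≤ 72 512 _
  24n≤ (suc m) = begin
    24 * (3 + suc m) ≡⟨ r m ⟩
    24 * (3 + m) + 24 ≤⟨ +-mono-≤ (24n≤ m) (≤-trans (*-monoʳ-≤ 24 {1} {3 + m} (s≤s z≤n)) (24n≤ m)) ⟩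
    P + P ≤⟨ m≤m+n (P + P) (6 * P) ⟩
    P + P + 6 * P ≡⟨ r′ P ⟩
    8 * P ≡⟨ sym (2^-+ 3 (3 * (3 + m))) ⟩
    2 ^ (3 + 3 * (3 + m)) ≡⟨ cong (2 ^_) (sym (*-suc 3 (3 + m))) ⟩
    2 ^ (3 * suc (3 + m)) ∎
    where
    open ≤-Reasoning
    P = 2 ^ (3 * (3 + m))
    r : ∀ m → 24 * (3 + suc m) ≡ 24 * (3 + m) + 24
    r = solve-∀
    r′ : ∀ p → p + p + 6 * p ≡ 8 * p
    r′ = solve-∀
  s-small : 3 * (n * s) ≤ X
  s-small = begin
    3 * (n * (8 * 2 ^ (3 * n))) ≡⟨ r n (2 ^ (3 * n)) ⟩
    24 * n * 2 ^ (3 * n) ≤⟨ *-monoˡ-≤ (2 ^ (3 * n)) (subst (λ t → 24 * t ≤ 2 ^ (3 * t)) (m+[n∸m]≡n 3≤n) (24n≤ (n ∸ 3))) ⟩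
    2 ^ (3 * n) * 2 ^ (3 * n) ≡⟨ sym x³ ⟩
    X ∎
    where
    open ≤-Reasoning
    r : ∀ n p → 3 * (n * (8 * p)) ≡ 24 * n * p
    r = solve-∀
  Y<s² : Y < suc s * suc s
  Y<s² = ≤-trans (s≤s (≤-reflexive (trans Y≡ (trans (cong (λ t → t + 63 * t) x³) (r (2 ^ (3 * n))))))) (≤-trans (m≤m+n _ (s + s)) (≤-reflexive (r′ s)))
    where
    r : ∀ p → p * p + 63 * (p * p) ≡ 8 * p * (8 * p)
    r = solve-∀
    r′ : ∀ s → suc (s * s) + (s + s) ≡ suc s * suc s
    r′ = solve-∀
  K+1≤X : 2 * K + 1 ≤ 32 * X
  K+1≤X = begin
    2 * K + 1 ≤⟨ +-mono-≤ (*-monoʳ-≤ 2 K≤) 1≤n ⟩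
    2 * (12 * n) + n ≡⟨ r n ⟩
    25 * n ≤⟨ *-mono-≤ (≤ᵇ⇒≤ 25 32 _) (≤-trans (<⇒≤ (n<2^n n)) (^-monoʳ-≤ 2 (m≤n*m n 6))) ⟩
    32 * X ∎
    where
    open ≤-Reasoning
    r : ∀ n → 2 * (12 * n) + n ≡ 25 * n
    r = solve-∀
  q = 2 ^ (6 * n + 5)
  qq : q + q ≡ Y
  qq = trans (cong (q +_) (sym (+-identityʳ q))) (cong (2 ^_) (sym (+-suc (6 * n) 5)))
  ψY : 32 * X * S ≤ ψ Y
  ψY = by-lin (+-mono-≤ step (+-mono-≤ (*-monoˡ-≤ S K+1≤X) Y²≤S)) (≤-reflexive (r X S (ψ Y) K (Y * Y)))
    where
    step : (X + 63 * X) * S ≤ ψ Y + 2 * (K * S) + Y * Y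
    step = subst₂ _≤_ (cong (_* S) (trans 2q Y≡)) (trans (cong₂ (λ a b → ψ a + 2 * b + 2 * q * Y) qq (trans (cong ℓ qq) (ℓ-2^ K))) (cong (λ t → ψ Y + 2 * (K * S) + t * Y) 2q))
        (chebyshev q (≤-reflexive qq))
      where
      2q : 2 * q ≡ Y
      2q = trans (cong (q +_) (+-identityʳ q)) qq
    r : ∀ X S p K y → p + 2 * (K * S) + y + (32 * X * S + S) + 32 * X * S ≡ (X + 63 * X) * S + ((2 * K + 1) * S + y) + p
    r = solve-∀
  reduced : 28 * X ≤ K * (D + s)
  reduced = *-cancelˡ-≤ S {{>-nonZero (1≤* (1≤* 1≤Y 1≤Y) (1≤* 1≤Y 1≤Y))}} (by-lin (+-mono-≤ ψY (+-mono-≤ (ψ-count-upper {X} {Y} {K} {s} X≤Y ≤-refl ≤-refl Y<s²)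
     (+-mono-≤ (ψ-2^-upper (6 * n) X≤Y) (*-monoʳ-≤ (2 * X) Y≤S))))
     (≤-reflexive (subst (λ t → ψ Y + (ψ X + S * K * (t + s) + (2 * X * (S + Y) + 2 * X * S)) + S * (28 * X)
         ≡ 32 * X * S + (ψ Y + S * K * π X + (ψ X + 2 * X * Y)) + S * (K * (D + s))) (sym πY) (r (ψ Y) (ψ X) S K (π X) D s X Y))))
    where
    X≤Y : X ≤ Y
    X≤Y = ^-monoʳ-≤ 2 (m≤m+n (6 * n) 6)
    πY : π Y ≡ π X + D
    πY = trans (cong π Y≡) (π-count X (63 * X))
    r : ∀ y x S K p D s X Y → y + (x + S * K * (p + D + s) + (2 * X * (S + Y) + 2 * X * S)) + S * (28 * X)
         ≡ 32 * X * S + (y + S * K * p + (x + 2 * X * Y)) + S * (K * (D + s))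
    r = solve-∀

-- T (x + h) - T x - T h is the logarithm of the binomial coefficient (x + h choose h), which all primes in (x, x + h] divide.
short-interval-count : ∀ n γ g x → γ + g ≡ 6 * n → 2 ^ (6 * n) ≤ x → x + 2 ^ g ≤ 2 ^ (6 * n + 6) → n * count x (2 ^ g) ≤ 2 ^ g * (γ + 9)
short-interval-count n γ g x γ+g X≤x x+h≤Y = *-cancelˡ-≤ S {{>-nonZero (1≤* (1≤* 1≤Y 1≤Y) (1≤* 1≤Y 1≤Y))}} (≤-trans weaken six)
  where
  open ≤-Reasoning
  K = 6 * n + 6
  Y = 2 ^ K
  h = 2 ^ g
  c = count x h
  open Log Y
  open LogBounds Y
  1≤Y : 1 ≤ Y
  1≤Y = m^n>0 2 K
  Y≤S : Y ≤ S
  Y≤S = ≤-trans (≤-reflexive (sym (*-identityʳ Y))) (≤-trans (*-monoʳ-≤ Y 1≤Y) (≤-trans (≤-reflexive (sym (*-identityʳ (Y * Y)))) (*-monoʳ-≤ (Y * Y) (1≤* 1≤Y 1≤Y))))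
  h≤x : h ≤ x
  h≤x = ≤-trans (^-monoʳ-≤ 2 (≤-trans (m≤n+m g γ) (≤-reflexive γ+g))) X≤x
  weaken : S * (n * c) ≤ S * (6 * n) * c
  weaken = ≤-trans (m≤m+n _ (5 * (S * (n * c)))) (≤-reflexive (r S n c))
    where
    r : ∀ s n c → s * (n * c) + 5 * (s * (n * c)) ≡ s * (6 * n) * c
    r = solve-∀
  six : S * (6 * n) * c ≤ S * (h * (γ + 9))
  -- The 9 is 6 + 2 + 1: each of the h factors of the numerator has logarithm at most γ + g + 6, h!
  -- takes off at least g h - 2 h, and rounding costs at most h.
  six = by-lin (+-mono-≤ (ψ-count-lower {x} {x + h} {S * (6 * n)} (m≤m+n x h) x+h≤Y (λ p _ x<p _ → ℓₚ≥ {p} {6 * n} (≤-trans X≤x (<⇒≤ x<p))))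
     (+-mono-≤ (ψ-short-interval x h h≤x x+h≤Y) (+-mono-≤ (T-increment x h {K} x+h≤Y) (+-mono-≤ (T-2^-lower g (≤-trans h≤x (≤-trans (m≤m+n x h) x+h≤Y))) (*-monoʳ-≤ h Y≤S)))))
     (≤-reflexive (subst₂ (λ u v → ψ (x + h) + S * (6 * n) * π x + (T (x + h) + ψ x + (T x + h * (S * (v + 6)) + (T h + 2 * h * S + h * Y + h * S))) + S * (6 * n) * c
         ≡ ψ x + S * (6 * n) * u + (T x + T h + ψ (x + h) + (T (x + h) + (g * h * S + h * Y))) + S * (h * (γ + 9))) (sym (π-count x h)) γ+g
         (r (ψ (x + h)) S n (π x) (T (x + h)) (ψ x) (T x) h γ g (T h) Y c)))
    where
    r : ∀ p S n u t q v h γ g w Y c → p + S * (6 * n) * u + (t + q + (v + h * (S * (γ + g + 6)) + (w + 2 * h * S + h * Y + h * S))) + S * (6 * n) * c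
       ≡ q + S * (6 * n) * (u + c) + (v + w + p + (t + (g * h * S + h * Y))) + S * (h * (γ + 9))
    r = solve-∀

-- Rich pairs of neighbouring primes

∈-zip : ∀ {a} (xs ys : List ℕ) → a ∈ zip xs ys → proj₁ a ∈ xs × proj₂ a ∈ ys
∈-zip (x ∷ xs) (y ∷ ys) (here refl) = here refl , here refl
∈-zip (x ∷ xs) (y ∷ ys) (there i) = let a , b = ∈-zip xs ys i in there a , there b

zip-length : ∀ {R} (xs ys : List ℕ) → R ≤ length xs → R ≤ length ys → R ≤ length (zip xs ys)
zip-length {zero} xs ys _ _ = z≤n
zip-length {suc R} (x ∷ xs) (y ∷ ys) (s≤s a) (s≤s b) = s≤s (zip-length xs ys a b)

zip-unique₁ : ∀ (xs ys : List ℕ) → Unique xs → Unique (map proj₁ (zip xs ys))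
zip-unique₁ [] ys _ = []
zip-unique₁ (x ∷ xs) [] _ = []
zip-unique₁ (x ∷ xs) (y ∷ ys) (x∉ ∷ u) = LAll.tabulate (λ i → let a , a∈ , e = ∈-map⁻ proj₁ i in
  λ x≡ → LAll.lookup x∉ (proj₁ (∈-zip xs ys a∈)) (trans x≡ e)) ∷ zip-unique₁ xs ys u

zip-unique₂ : ∀ (xs ys : List ℕ) → Unique ys → Unique (map proj₂ (zip xs ys))
zip-unique₂ [] ys _ = []
zip-unique₂ (x ∷ xs) [] _ = []
zip-unique₂ (x ∷ xs) (y ∷ ys) (y∉ ∷ u) = LAll.tabulate (λ i → let a , a∈ , e = ∈-map⁻ proj₂ i in
  λ y≡ → LAll.lookup y∉ (proj₂ (∈-zip xs ys a∈)) (trans y≡ e)) ∷ zip-unique₂ xs ys u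

InScale : ℕ → ℕ → Set
InScale n p = Prime p × 2 ^ (6 * n) ≤ p × p < 2 ^ (6 * suc n)

-- `H` does not depend on n: the pairs are a fixed proportion of the primes in the scale, whose
-- number is of order 2^(6 n) / n.
record Scale (E F H n : ℕ) : Set where
  field
    pairs : List (ℕ × ℕ)
    many : 2 ^ (6 * n) ≤ length pairs * n * H
    in₁ : ∀ a → a ∈ pairs → InScale n (proj₁ a)
    in₂ : ∀ a → a ∈ pairs → InScale n (proj₂ a)
    unique₁ : Unique (map proj₁ pairs)
    unique₂ : Unique (map proj₂ pairs)
    apart : ∀ a → a ∈ pairs → suc F * proj₁ a ≤ F * proj₂ a
    near : ∀ a → a ∈ pairs → E * proj₂ a ≤ suc E * proj₁ a

scale-of : ∀ {E F H n R} ps qs → 2 ^ (6 * n) ≤ R * n * H → R ≤ length ps → R ≤ length qs → Unique ps → Unique qs →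
  (∀ p → p ∈ ps → InScale n p) → (∀ q → q ∈ qs → InScale n q) →
  (∀ p q → p ∈ ps → q ∈ qs → suc F * p ≤ F * q × E * q ≤ suc E * p) → Scale E F H n
scale-of {H = H} {n = n} ps qs many lp lq up uq inp inq rel = record
  { pairs = zip ps qs
  ; many = ≤-trans many (*-monoˡ-≤ H (*-monoˡ-≤ n (zip-length ps qs lp lq)))
  ; in₁ = λ a i → inp (proj₁ a) (proj₁ (∈-zip ps qs i))
  ; in₂ = λ a i → inq (proj₂ a) (proj₂ (∈-zip ps qs i))
  ; unique₁ = zip-unique₁ ps qs up
  ; unique₂ = zip-unique₂ ps qs uq
  ; apart = λ a i → let j , k = ∈-zip ps qs i in proj₁ (rel (proj₁ a) (proj₂ a) j k)
  ; near = λ a i → let j , k = ∈-zip ps qs i in proj₂ (rel (proj₁ a) (proj₂ a) j k)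
  }

-- (X, 64 X] is cut into 63 · 2^E cells, each cut into 2 ^ σ boxes. A richest cell contains two rich boxes
-- that are neither equal nor adjacent, because Chebyshev's upper bound prevents two adjacent boxes from holding
-- most of the cell: 2 ^ σ exceeds E + σ by a large factor.
module ScaleConstruction (E : ℕ) (1≤E : 1 ≤ E) where

  σ γ F H : ℕ
  -- Cells have length X / 2^E, so that two primes of one cell are near. Boxes have length X / 2^γ,
  -- and a gap of one box against p ≤ 64 X gives F. In H, 252 is 4 · 63: there are 63 · 2^γ boxes in
  -- all, and 4 is a margin.
  σ = E + 14
  γ = E + σ
  F = 64 * 2 ^ γ
  H = 252 * 2 ^ γ

  room : 252 * (γ + 9) ≤ 2 ^ σ
  room = ≤-trans (*-mono-≤ (≤ᵇ⇒≤ 252 (2 ^ 8) _) inner) (≤-reflexive (trans (sym (2^-+ 8 (6 + E))) (cong (2 ^_) (+-comm 14 E))))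
    where
    open ≤-Reasoning
    r : ∀ E → E + (E + 14) + 9 + 21 * E ≡ 23 * suc E
    r = solve-∀
    inner : γ + 9 ≤ 2 ^ (6 + E)
    inner = begin
      γ + 9 ≤⟨ m≤m+n _ (21 * E) ⟩
      γ + 9 + 21 * E ≡⟨ r E ⟩
      23 * suc E ≤⟨ *-mono-≤ (≤ᵇ⇒≤ 23 (2 ^ 6) _) (n<2^n E) ⟩
      2 ^ 6 * 2 ^ E ≡⟨ sym (2^-+ 6 E) ⟩
      2 ^ (6 + E) ∎

  module _ (n : ℕ) (3≤n : 3 ≤ n) (H≤n : H ≤ n) where
    X = 2 ^ (6 * n)
    1≤n : 1 ≤ n
    1≤n = ≤-trans (s≤s z≤n) 3≤n

    nH≤X : n * H ≤ X
    nH≤X = ≤-trans (*-mono-≤ (<⇒≤ (n<2^n n)) (≤-trans H≤n (<⇒≤ (n<2^n n)))) (≤-trans (≤-reflexive (sym (2^-+ n n)))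
      (^-monoʳ-≤ 2 (≤-trans (m≤m+n (n + n) (4 * n)) (≤-reflexive (r n)))))
      where
      r : ∀ n → n + n + 4 * n ≡ 6 * n
      r = solve-∀

    γ≤6n : γ ≤ 6 * n
    γ≤6n = ≤-trans (<⇒≤ (n<2^n γ)) (≤-trans (m≤n*m (2 ^ γ) 252) (≤-trans H≤n (m≤n*m n 6)))

    g = 6 * n ∸ γ
    γ+g : γ + g ≡ 6 * n
    γ+g = m+[n∸m]≡n γ≤6n
    h = 2 ^ g
    w = 2 ^ σ * h
    C = 63 * 2 ^ E
    hX : 2 ^ γ * h ≡ X
    hX = trans (sym (2^-+ γ g)) (cong (2 ^_) γ+g)
    wX : 2 ^ E * w ≡ X
    wX = trans (sym (*-assoc (2 ^ E) (2 ^ σ) h)) (trans (cong (_* h) (sym (2^-+ E σ))) hX)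
    Cw : C * w ≡ 63 * X
    Cw = trans (*-assoc 63 (2 ^ E) w) (cong (63 *_) wX)
    U = (h * (γ + 9)) ÷ n
    R = suc (X ÷ (n * H))
    -- What `pigeonhole-two` asks of a cell whose boxes hold at most U primes each; the successor
    -- gives its strict inequality.
    t = suc (2 ^ σ * R + 2 * U)

    nRH : X ≤ R * n * H
    nRH = ≤-trans (<⇒≤ (÷-upper X (1≤* 1≤n (1≤* {252} (s≤s z≤n) (m^n>0 2 γ))))) (≤-reflexive (sym (*-assoc R n H)))

    C-t : C * t ≤ count X (63 * X)
    C-t = *-cancelˡ-≤ n {{>-nonZero 1≤n}} (≤-trans (*-cancelˡ-≤ 4 upper) (chebyshev-scale n 3≤n))
      where
      open ≤-Reasoning
      P = 2 ^ E
      Q = 2 ^ σ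
      x = X ÷ (n * H)
      -- Of the 8 X available, X each pays for the main part of R, for rounding R up and for the
      -- successor in t, and 2 X pays for the two fullest boxes.
      upper : 4 * (n * (C * t)) ≤ 4 * (2 * X)
      upper = begin
        4 * (n * (63 * P * suc (Q * suc x + 2 * U))) ≡⟨ r₁ n P Q x U ⟩
        n * (252 * (P * Q)) * x + n * (252 * (P * Q)) + n * (252 * P) * 1 + 504 * P * (U * n) ≤⟨ +-mono-≤ (+-mono-≤ (+-mono-≤ a₁ a₂) a₃) a₄ ⟩
        X + X + X + 2 * X ≤⟨ m≤m+n _ (3 * X) ⟩
        X + X + X + 2 * X + 3 * X ≡⟨ r₂ X ⟩
        4 * (2 * X) ∎
        where
        r₁ : ∀ n P Q x U → 4 * (n * (63 * P * suc (Q * suc x + 2 * U))) ≡ n * (252 * (P * Q)) * x + n * (252 * (P * Q)) + n * (252 * P) * 1 + 504 * P * (U * n)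
        r₁ n P Q x U = r′ 63 n P Q x U
          where
          r′ : ∀ c n P Q x U → 4 * (n * (c * P * suc (Q * suc x + 2 * U))) ≡ n * (4 * c * (P * Q)) * x + n * (4 * c * (P * Q)) + n * (4 * c * P) * 1 + 8 * c * P * (U * n)
          r′ = solve-∀
        r₂ : ∀ X → X + X + X + 2 * X + 3 * X ≡ 4 * (2 * X)
        r₂ = solve-∀
        PQ : 252 * (P * Q) ≡ H
        PQ = cong (252 *_) (sym (2^-+ E σ))
        a₁ : n * (252 * (P * Q)) * x ≤ X
        a₁ = ≤-trans (≤-reflexive (trans (cong (λ e → n * e * x) PQ) (*-comm (n * H) x))) (÷-lower X (n * H))
        a₂ : n * (252 * (P * Q)) ≤ X
        a₂ = ≤-trans (≤-reflexive (cong (n *_) PQ)) nH≤X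
        a₃ : n * (252 * P) * 1 ≤ X
        a₃ = ≤-trans (≤-reflexive (*-identityʳ _)) (≤-trans (*-monoʳ-≤ n (*-monoʳ-≤ 252 (≤-trans (≤-reflexive (sym (*-identityʳ P))) (*-monoʳ-≤ P (m^n>0 2 σ))))) a₂)
        a₄ : 504 * P * (U * n) ≤ 2 * X
        a₄ = begin
          504 * P * (U * n) ≤⟨ *-monoʳ-≤ (504 * P) (÷-lower (h * (γ + 9)) n) ⟩
          504 * P * (h * (γ + 9)) ≡⟨ r₃ P h (γ + 9) ⟩
          2 * (P * (252 * (γ + 9) * h)) ≤⟨ *-monoʳ-≤ 2 (*-monoʳ-≤ P (*-monoˡ-≤ h room)) ⟩
          2 * (P * (Q * h)) ≡⟨ cong (2 *_) wX ⟩
          2 * X ∎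
          where
          r₃ : ∀ p h c → 504 * p * (h * c) ≡ 2 * (p * (252 * c * h))
          r₃ p h c = r′ 252 p h c
            where
            r′ : ∀ k p h c → 2 * k * p * (h * c) ≡ 2 * (p * (k * c * h))
            r′ = solve-∀

    cell : ∃ λ i → 1 ≤ i × i ≤ C × t ≤ count (X + pred i * w) w
    cell = pigeonhole C t _ (1≤* {63} (s≤s z≤n) (m^n>0 2 E)) (≤-trans C-t (≤-reflexive (trans (cong (count X) (sym Cw)) (count-blocks X C w))))

    i₀ = proj₁ cell
    a₀ = X + pred i₀ * w
    1≤i₀ = proj₁ (proj₂ cell)
    i₀≤C = proj₁ (proj₂ (proj₂ cell))

    cell-end : a₀ + w ≤ 64 * X
    cell-end = begin
      X + pred i₀ * w + w ≡⟨ r X (pred i₀) w ⟩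
      X + suc (pred i₀) * w ≤⟨ +-monoʳ-≤ X (≤-trans (*-monoˡ-≤ w (≤-trans (≤-reflexive (suc-pred i₀ {{>-nonZero 1≤i₀}})) i₀≤C)) (≤-reflexive Cw)) ⟩
      X + 63 * X ≡⟨⟩
      64 * X ∎
      where
      open ≤-Reasoning
      r : ∀ x i w → x + i * w + w ≡ x + suc i * w
      r = solve-∀

    64X : 64 * X ≡ 2 ^ (6 * n + 6)
    64X = trans (*-comm 64 X) (sym (2^-+ (6 * n) 6))

    box : ℕ → ℕ
    box j = a₀ + pred j * h

    f : ℕ → ℕ
    f j = count (box j) h

    box-end : ∀ {j} → 1 ≤ j → j ≤ 2 ^ σ → box j + h ≤ a₀ + w
    box-end {suc j} _ j≤ = ≤-trans (≤-reflexive (r a₀ j h)) (+-monoʳ-≤ a₀ (*-monoˡ-≤ h j≤))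
      where
      r : ∀ a j h → a + j * h + h ≡ a + suc j * h
      r = solve-∀

    f≤U : ∀ j → 1 ≤ j → j ≤ 2 ^ σ → f j ≤ U
    f≤U j 1≤j j≤ = ÷-greatest 1≤n (≤-trans (≤-reflexive (*-comm (f j) n)) (short-interval-count n γ g (box j) γ+g
      (≤-trans (m≤m+n X (pred i₀ * w)) (m≤m+n a₀ (pred j * h))) (≤-trans (box-end {j} 1≤j j≤) (≤-trans cell-end (≤-reflexive 64X)))))

    boxes : ∃ λ i → ∃ λ j → 1 ≤ i × suc (suc i) ≤ j × j ≤ 2 ^ σ × R ≤ f i × R ≤ f j
    boxes = pigeonhole-two (2 ^ σ) R U f (s≤s z≤n) f≤U (≤-trans (proj₂ (proj₂ (proj₂ cell))) (≤-reflexive (count-blocks a₀ (2 ^ σ) h)))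

    i = proj₁ boxes
    j = proj₁ (proj₂ boxes)
    1≤i = proj₁ (proj₂ (proj₂ boxes))
    i+2≤j = proj₁ (proj₂ (proj₂ (proj₂ boxes)))
    j≤ = proj₁ (proj₂ (proj₂ (proj₂ (proj₂ boxes))))
    R≤fi = proj₁ (proj₂ (proj₂ (proj₂ (proj₂ (proj₂ boxes)))))
    R≤fj = proj₂ (proj₂ (proj₂ (proj₂ (proj₂ (proj₂ boxes)))))

    ps = primesIn (box i) h
    qs = primesIn (box j) h

    in-scale : ∀ {k p} → 1 ≤ k → k ≤ 2 ^ σ → p ∈ primesIn (box k) h → InScale n p × a₀ < p × p ≤ a₀ + w
    in-scale {k} {p} 1≤k k≤ p∈ = (pp , <⇒≤ (≤-<-trans (m≤m+n X _) a₀<p) , ≤∧≢⇒< (≤-trans (≤-trans p≤ cell-end) (≤-reflexive (trans 64X (cong (2 ^_) (r n))))) not-2^) , a₀<p , p≤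
      where
      b = ∈-primesIn (box k) h p∈
      pp = proj₁ b
      a₀<p = ≤-<-trans (m≤m+n a₀ _) (proj₁ (proj₂ b))
      p≤ = ≤-trans (proj₂ (proj₂ b)) (box-end {k} 1≤k k≤)
      r : ∀ n → 6 * n + 6 ≡ 6 * suc n
      r = solve-∀
      -- The last box may end at 2^(6 n + 6), which `InScale` excludes; this end point is a power of
      -- 2 above 2, hence not prime.
      not-2^ : p ≢ 2 ^ (6 * suc n)
      not-2^ e = <⇒≢ (<-≤-trans (≤ᵇ⇒≤ 3 64 _) (≤-trans (m≤m*n 64 X {{>-nonZero (m^n>0 2 (6 * n))}}) (≤-reflexive (trans 64X (cong (2 ^_) (r n))))))
        (trans (prime∣prime prime[2] pp (subst (2 ∣_) (sym (trans e (cong (2 ^_) (*-suc 6 n)))) (m∣m*n (2 ^ (5 + 6 * n))))) e)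

    scale : Scale E F H n
    scale = scale-of ps qs nRH (enough i R≤fi) (enough j R≤fj) (primesIn-unique (box i) h) (primesIn-unique (box j) h)
      (λ p p∈ → proj₁ (in-p p∈)) (λ q q∈ → proj₁ (in-q q∈)) (λ p q p∈ q∈ → apart p∈ q∈ , near p∈ q∈)
      where
      open ≤-Reasoning
      enough : ∀ k → R ≤ f k → R ≤ length (primesIn (box k) h)
      enough k le = ≤-trans le (≤-reflexive (sym (length-primesIn (box k) h)))
      in-p : ∀ {p} → p ∈ ps → InScale n p × a₀ < p × p ≤ a₀ + w
      in-p = in-scale 1≤i (≤-trans (≤-trans (n≤1+n i) (n≤1+n (suc i))) (≤-trans i+2≤j j≤))
      in-q : ∀ {q} → q ∈ qs → InScale n q × a₀ < q × q ≤ a₀ + w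
      in-q = in-scale (≤-trans (s≤s z≤n) i+2≤j) j≤
      apart : ∀ {p q} → p ∈ ps → q ∈ qs → suc F * p ≤ F * q
      apart {p} {q} p∈ q∈ = begin
        p + F * p ≤⟨ +-monoˡ-≤ (F * p) (≤-trans (proj₂ (proj₂ (in-p p∈))) cell-end) ⟩
        64 * X + F * p ≡⟨ cong (_+ F * p) (trans (cong (64 *_) (sym hX)) (sym (*-assoc 64 (2 ^ γ) h))) ⟩
        F * h + F * p ≡⟨ sym (*-distribˡ-+ F h p) ⟩
        F * (h + p) ≤⟨ *-monoʳ-≤ F gap ⟩
        F * q ∎
        where
        gap : h + p ≤ q
        gap = begin
          h + p ≤⟨ +-monoʳ-≤ h (proj₂ (proj₂ (∈-primesIn (box i) h p∈))) ⟩
          h + (a₀ + pred i * h + h) ≡⟨ r a₀ (pred i) h ⟩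
          a₀ + suc (suc (pred i)) * h ≤⟨ +-monoʳ-≤ a₀ (*-monoˡ-≤ h (≤-trans (≤-reflexive (cong suc (suc-pred i {{>-nonZero 1≤i}}))) (pred-mono-≤ i+2≤j))) ⟩
          a₀ + pred j * h ≤⟨ <⇒≤ (proj₁ (proj₂ (∈-primesIn (box j) h q∈))) ⟩
          q ∎
          where
          r : ∀ a i h → h + (a + i * h + h) ≡ a + suc (suc i) * h
          r = solve-∀
      near : ∀ {p q} → p ∈ ps → q ∈ qs → E * q ≤ suc E * p
      near {p} {q} p∈ q∈ = begin
        E * q ≤⟨ *-monoʳ-≤ E (≤-trans (proj₂ (proj₂ (in-q q∈))) (+-monoˡ-≤ w (<⇒≤ (proj₁ (proj₂ (in-p p∈)))))) ⟩
        E * (p + w) ≡⟨ trans (*-distribˡ-+ E p w) (+-comm (E * p) (E * w)) ⟩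
        E * w + E * p ≤⟨ +-monoˡ-≤ (E * p) (≤-trans (*-monoˡ-≤ w (<⇒≤ (n<2^n E))) (≤-trans (≤-reflexive wX) (proj₁ (proj₂ (proj₁ (in-p p∈)))))) ⟩
        p + E * p ∎

-- Weighted families from many scales

harmonic : ∀ (w : ℕ → ℕ) A H Z L → 1 ≤ A → (∀ n → A < n → n ≤ A * 2 ^ L → Z ≤ w n * n * H) →
  ∃ λ m → A + m ≡ A * 2 ^ L × L * Z ≤ ∑ (rng m) (λ i → w (A + i)) * (2 * H)
harmonic w A H Z zero 1≤A hyp = 0 , trans (+-identityʳ A) (sym (*-identityʳ A)) , z≤n
harmonic w A H Z (suc L) 1≤A hyp = m + B , total , step
  where
  open ≤-Reasoning
  B = A * 2 ^ L
  B+B : B + B ≡ A * 2 ^ suc L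
  B+B = r A (2 ^ L)
    where
    r : ∀ a p → a * p + a * p ≡ a * (2 * p)
    r = solve-∀
  B≤ : B ≤ A * 2 ^ suc L
  B≤ = ≤-trans (m≤m+n B B) (≤-reflexive B+B)
  1≤B : 1 ≤ B
  1≤B = 1≤* 1≤A (m^n>0 2 L)
  rec = harmonic w A H Z L 1≤A (λ n A<n n≤ → hyp n A<n (≤-trans n≤ B≤))
  m = proj₁ rec
  A+m = proj₁ (proj₂ rec)
  total : A + (m + B) ≡ A * 2 ^ suc L
  total = trans (sym (+-assoc A m B)) (trans (cong (_+ B) A+m) B+B)
  block = ∑ (rng B) (λ i → w (B + i))
  -- The block (B, 2 B] has B terms, each at least Z / (2 B H): every doubling adds the same amount,
  -- as in the harmonic series.
  block-large : Z ≤ block * (2 * H)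
  block-large = *-cancelˡ-≤ B {{>-nonZero 1≤B}} (begin
    B * Z ≡⟨ sym (∑-rng-const B Z) ⟩
    ∑ (rng B) (λ _ → Z) ≤⟨ ∑-mono∈ (rng B) (λ i i∈ → let a , b = ∈-rng⁻ B i∈ in ≤-trans (hyp (B + i) (≤-<-trans (m≤m*n A (2 ^ L) {{>-nonZero (m^n>0 2 L)}}) (m<m+n B a)) (≤-trans (+-monoʳ-≤ B b) (≤-reflexive B+B)))
         (≤-trans (*-monoˡ-≤ H (*-monoʳ-≤ (w (B + i)) (+-monoʳ-≤ B b))) (≤-reflexive (r (w (B + i)) B H)))) ⟩
    ∑ (rng B) (λ i → w (B + i) * (B * (2 * H))) ≡⟨ ∑-*ʳ (rng B) (B * (2 * H)) _ ⟩
    block * (B * (2 * H)) ≡⟨ r′ block B (2 * H) ⟩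
    B * (block * (2 * H)) ∎)
    where
    r : ∀ w b h → w * (b + b) * h ≡ w * (b * (2 * h))
    r = solve-∀
    r′ : ∀ s b h → s * (b * h) ≡ b * (s * h)
    r′ = solve-∀
  step : suc L * Z ≤ ∑ (rng (m + B)) (λ i → w (A + i)) * (2 * H)
  step = begin
    Z + L * Z ≤⟨ +-mono-≤ block-large (proj₂ (proj₂ rec)) ⟩
    block * (2 * H) + ∑ (rng m) (λ i → w (A + i)) * (2 * H) ≡⟨ trans (+-comm (block * (2 * H)) _) (sym (*-distribʳ-+ (2 * H) (∑ (rng m) (λ i → w (A + i))) block)) ⟩
    (∑ (rng m) (λ i → w (A + i)) + block) * (2 * H) ≡⟨ cong (λ t → (∑ (rng m) (λ i → w (A + i)) + t) * (2 * H)) (∑-cong (rng B) λ i → cong w (trans (cong (_+ i) (sym A+m)) (+-assoc A m i))) ⟩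
    (∑ (rng m) (λ i → w (A + i)) + ∑ (rng B) (λ i → w (A + (m + i)))) * (2 * H) ≡⟨ cong (_* (2 * H)) (sym (∑-rng-+ m B (λ i → w (A + i)))) ⟩
    ∑ (rng (m + B)) (λ i → w (A + i)) * (2 * H) ∎

module Families (E F H A N : ℕ) (scales : ∀ n → A < n → n ≤ N → Scale E F H n) where
  -- These weights are inversely proportional to the primes of scale n, which makes α p bounded.
  tag : ℕ → ℕ × ℕ → ℕ × ℕ × ℕ
  tag n a = 2 ^ (6 * (N ∸ n)) , a

  scale-pairs : ∀ n → A < n → n ≤ N → List (ℕ × ℕ × ℕ)
  scale-pairs n a b = map (tag n) (Scale.pairs (scales n a b))

  collect : ∀ m → A + m ≤ N → List (ℕ × ℕ × ℕ)
  collect zero _ = []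
  collect (suc m) h = scale-pairs (A + suc m) (m<m+n A (s≤s z≤n)) h ++ collect m (≤-trans (+-monoʳ-≤ A (n≤1+n m)) h)

  V : ℕ
  V = 2 ^ (6 * suc N)

  Good : ℕ → ℕ × ℕ × ℕ → Set
  Good m (α , p , q) = (Prime p × 2 ^ (6 * suc A) ≤ p × p < 2 ^ (6 * suc (A + m)) × α * p ≤ V)
    × (Prime q × 2 ^ (6 * suc A) ≤ q × q < 2 ^ (6 * suc (A + m)) × α * q ≤ V)
    × suc F * p ≤ F * q × E * q ≤ suc E * p

  weighted : ∀ {n p} → n ≤ N → p < 2 ^ (6 * suc n) → 2 ^ (6 * (N ∸ n)) * p ≤ V
  weighted {n} {p} n≤N p< = ≤-trans (*-monoʳ-≤ (2 ^ (6 * (N ∸ n))) (<⇒≤ p<)) (≤-reflexive (trans (sym (2^-+ (6 * (N ∸ n)) (6 * suc n)))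
    (cong (2 ^_) (trans (sym (*-distribˡ-+ 6 (N ∸ n) (suc n))) (cong (6 *_) (trans (+-suc (N ∸ n) n) (cong suc (m∸n+n≡m n≤N))))))))

  good : ∀ m h a → a ∈ collect m h → Good m a
  good (suc m) h a i with ∈-++⁻ (scale-pairs (A + suc m) (m<m+n A (s≤s z≤n)) h) i
  ... | inj₂ j = let (a₁ , a₂ , a₃ , a₄) , (b₁ , b₂ , b₃ , b₄) , c = good m _ a j in (a₁ , a₂ , <-≤-trans a₃ up , a₄) , (b₁ , b₂ , <-≤-trans b₃ up , b₄) , c
    where
    up : 2 ^ (6 * suc (A + m)) ≤ 2 ^ (6 * suc (A + suc m))
    up = ^-monoʳ-≤ 2 (*-monoʳ-≤ 6 (s≤s (+-monoʳ-≤ A (n≤1+n m))))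
  ... | inj₁ j with ∈-map⁻ (tag (A + suc m)) j
  ... | (p , q) , a∈ , refl = let x₁ , x₂ , x₃ = in₁ (p , q) a∈ ; y₁ , y₂ , y₃ = in₂ (p , q) a∈ in
      (x₁ , ≤-trans low x₂ , x₃ , weighted h x₃) , (y₁ , ≤-trans low y₂ , y₃ , weighted h y₃) , apart (p , q) a∈ , near (p , q) a∈
    where
    open Scale (scales (A + suc m) (m<m+n A (s≤s z≤n)) h)
    low : 2 ^ (6 * suc A) ≤ 2 ^ (6 * (A + suc m))
    low = ^-monoʳ-≤ 2 (*-monoʳ-≤ 6 (≤-trans (s≤s (m≤m+n A m)) (≤-reflexive (sym (+-suc A m)))))

  unique-collect : ∀ (f : ℕ × ℕ → ℕ) → (∀ n a b → Unique (map f (Scale.pairs (scales n a b)))) →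
    (∀ n a b x → x ∈ Scale.pairs (scales n a b) → 2 ^ (6 * n) ≤ f x) →
    (∀ m h a → a ∈ collect m h → f (proj₂ a) < 2 ^ (6 * suc (A + m))) →
    ∀ m h → Unique (map (f ∘ proj₂) (collect m h))
  unique-collect f u low high zero h = []
  unique-collect f u low high (suc m) h = subst Unique (sym (map-++ (f ∘ proj₂) (scale-pairs n a h) (collect m h′)))
    (Uniq.++⁺ (subst Unique (map-∘ {g = (f ∘ proj₂)} {f = (tag n)} (Scale.pairs (scales n a h))) (u n a h)) (unique-collect f u low high m h′) disjoint)
    where
    n = A + suc m
    a = m<m+n A (s≤s z≤n)
    h′ = ≤-trans (+-monoʳ-≤ A (n≤1+n m)) h
    disjoint : ∀ {v} → v ∈ map (f ∘ proj₂) (scale-pairs n a h) × v ∈ map (f ∘ proj₂) (collect m h′) → ⊥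
    disjoint (i , j) with ∈-map⁻ (f ∘ proj₂) i | ∈-map⁻ (f ∘ proj₂) j
    ... | x , x∈ , refl | y , y∈ , e with ∈-map⁻ (tag n) x∈
    ... | z , z∈ , refl = <⇒≱ (high m h′ y y∈) (subst₂ _≤_ (cong (λ k → 2 ^ (6 * k)) (+-suc A m)) e (low n a h z z∈))

  -- `harmonic` takes a function on all n, while `scales` is given only for A < n ≤ N; elsewhere the
  -- weight is 0 by default.
  weight-of : ℕ → ℕ
  weight-of n with A <? n | n ≤? N
  ... | yes a | yes b = 2 ^ (6 * (N ∸ n)) * length (Scale.pairs (scales n a b))
  ... | _ | _ = 0

  weight-of≡ : ∀ {n} → A < n → n ≤ N → ∃ λ a → ∃ λ b → weight-of n ≡ 2 ^ (6 * (N ∸ n)) * length (Scale.pairs (scales n a b))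
  weight-of≡ {n} a b with A <? n | n ≤? N
  ... | yes a′ | yes b′ = a′ , b′ , refl
  ... | no ¬a | _ = contradiction a ¬a
  ... | yes _ | no ¬b = contradiction b ¬b

  weight-of-large : ∀ n → A < n → n ≤ N → 2 ^ (6 * N) ≤ weight-of n * n * H
  weight-of-large n A<n n≤N with weight-of≡ A<n n≤N
  ... | a , b , e = begin
    2 ^ (6 * N) ≡⟨ cong (2 ^_) (trans (cong (6 *_) (sym (m∸n+n≡m n≤N))) (*-distribˡ-+ 6 (N ∸ n) n)) ⟩
    2 ^ (6 * (N ∸ n) + 6 * n) ≡⟨ 2^-+ (6 * (N ∸ n)) (6 * n) ⟩
    2 ^ (6 * (N ∸ n)) * 2 ^ (6 * n) ≤⟨ *-monoʳ-≤ (2 ^ (6 * (N ∸ n))) (Scale.many (scales n a b)) ⟩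
    2 ^ (6 * (N ∸ n)) * (length (Scale.pairs (scales n a b)) * n * H) ≡⟨ r (2 ^ (6 * (N ∸ n))) (length (Scale.pairs (scales n a b))) n H ⟩
    2 ^ (6 * (N ∸ n)) * length (Scale.pairs (scales n a b)) * n * H ≡⟨ cong (λ t → t * n * H) (sym e) ⟩
    weight-of n * n * H ∎
    where
    open ≤-Reasoning
    r : ∀ x l n h → x * (l * n * h) ≡ x * l * n * h
    r = solve-∀

  weight-collect : ∀ m h → ∑ (collect m h) proj₁ ≡ ∑ (rng m) (λ i → weight-of (A + i))
  weight-collect zero h = refl
  weight-collect (suc m) h with weight-of≡ {A + suc m} (m<m+n A (s≤s z≤n)) h
  ... | a , b , e = trans (∑-++ (scale-pairs n a₀ h) (collect m _) proj₁)
      (cong₂ _+_ (trans (∑-map (tag n) (Scale.pairs (scales n a₀ h)) proj₁) (trans (∑-const (Scale.pairs (scales n a₀ h)) (2 ^ (6 * (N ∸ n))))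
        (trans (*-comm _ (2 ^ (6 * (N ∸ n)))) (sym (trans e (cong₂ (λ x y → 2 ^ (6 * (N ∸ n)) * length (Scale.pairs (scales n x y))) (≤-irrelevant a a₀) (≤-irrelevant b h)))))))
      (weight-collect m _))
    where
    n = A + suc m
    a₀ = m<m+n A (s≤s z≤n)

twinned-families : TwinnedFamilies
twinned-families E 1≤E = F , 1≤* {64} (s≤s z≤n) (m^n>0 2 γ) , λ K 1≤K → family K 1≤K
  where
  open ScaleConstruction E 1≤E using (F; H; γ; scale)
  family : ∀ K → 1 ≤ K → ∃ λ R → Twinned E F K R
  family K 1≤K = R , record
    { average₁ = averaging left proj₁ (λ _ → refl) (λ _ → refl) (λ a i → let (x₁ , x₂ , _ , x₄) , _ = good m A+m≤N a i in x₁ , x₂ , x₄)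
        (unique-collect proj₁ (λ n a b → Scale.unique₁ (scales n a b)) (λ n a b x i → proj₁ (proj₂ (Scale.in₁ (scales n a b) x i))) (λ m h a i → proj₁ (proj₂ (proj₂ (proj₁ (good m h a i))))) m A+m≤N)
    ; average₂ = averaging right proj₂ (λ _ → refl) (λ _ → refl) (λ a i → let _ , (x₁ , x₂ , _ , x₄) , _ = good m A+m≤N a i in x₁ , x₂ , x₄)
        (unique-collect proj₂ (λ n a b → Scale.unique₂ (scales n a b)) (λ n a b x i → proj₁ (proj₂ (Scale.in₂ (scales n a b) x i))) (λ m h a i → proj₁ (proj₂ (proj₂ (proj₁ (proj₂ (good m h a i)))))) m A+m≤N)
    ; apart = λ a i → proj₁ (proj₂ (proj₂ (good m A+m≤N a i)))
    ; near = λ a i → proj₂ (proj₂ (proj₂ (good m A+m≤N a i)))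
    }
    where
    -- For n > A the construction of the scale applies (3 ≤ n and H ≤ n), and all primes used are at
    -- least K.
    A = 3 + H + K
    -- The total weight is at least L 2^(6 N) / (2 H) and V = 64 · 2^(6 N), so this L yields K² V,
    -- while F stays as it was.
    L = 128 * H * (K * K)
    N = A * 2 ^ L
    scales : ∀ n → A < n → n ≤ N → Scale E F H n
    scales n A<n _ = scale n (≤-trans (≤-trans (m≤m+n 3 (H + K)) (≤-reflexive (sym (+-assoc 3 H K)))) (<⇒≤ A<n)) (≤-trans (≤-trans (m≤n+m H 3) (m≤m+n (3 + H) K)) (<⇒≤ A<n))
    open Families E F H A N scales
    bulk = harmonic weight-of A H (2 ^ (6 * N)) L (s≤s z≤n) weight-of-large
    m = proj₁ bulk
    A+m≤N : A + m ≤ N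
    A+m≤N = ≤-reflexive (proj₁ (proj₂ bulk))
    R = collect m A+m≤N
    1≤H : 1 ≤ H
    1≤H = 1≤* {252} (s≤s z≤n) (m^n>0 2 γ)
    large : K * K * V ≤ ∑ R proj₁
    large = *-cancelˡ-≤ (2 * H) {{>-nonZero (*-mono-≤ {1} {2} (s≤s z≤n) 1≤H)}} (begin
      2 * H * (K * K * V) ≡⟨ cong (λ t → 2 * H * (K * K * t)) (trans (cong (2 ^_) (*-suc 6 N)) (2^-+ 6 (6 * N))) ⟩
      2 * H * (K * K * (64 * 2 ^ (6 * N))) ≡⟨ r 64 H K (2 ^ (6 * N)) ⟩
      L * 2 ^ (6 * N) ≤⟨ proj₂ (proj₂ bulk) ⟩
      ∑ (rng m) (λ i → weight-of (A + i)) * (2 * H) ≡⟨ trans (cong (_* (2 * H)) (sym (weight-collect m A+m≤N))) (*-comm _ (2 * H)) ⟩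
      2 * H * ∑ R proj₁ ∎)
      where
      open ≤-Reasoning
      r : ∀ c H K z → 2 * H * (K * K * (c * z)) ≡ 2 * c * H * (K * K) * z
      r = solve-∀
    K≤ : ∀ {p} → 2 ^ (6 * suc A) ≤ p → K ≤ p
    K≤ h = ≤-trans (≤-trans (m≤n+m K (3 + H)) (≤-trans (n≤1+n A) (≤-trans (m≤n*m (suc A) 6) (<⇒≤ (n<2^n (6 * suc A)))))) h
    averaging : ∀ (side : ℕ × ℕ × ℕ → ℕ × ℕ) (f : ℕ × ℕ → ℕ) → (∀ a → proj₁ (side a) ≡ proj₁ a) → (∀ a → proj₂ (side a) ≡ f (proj₂ a)) →
      (∀ a → a ∈ R → Prime (f (proj₂ a)) × 2 ^ (6 * suc A) ≤ f (proj₂ a) × proj₁ a * f (proj₂ a) ≤ V) →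
      Unique (map (f ∘ proj₂) R) → Averaging K (map side R)
    averaging side f e₁ e₂ ok u = record
      { V = V
      ; 1≤V = m^n>0 2 (6 * suc N)
      ; large = ≤-trans large (≤-reflexive (sym (trans (∑-map side R proj₁) (∑-cong R e₁))))
      ; primes = λ b i → let a , a∈ , e = ∈-map⁻ side i in subst Prime (sym (trans (cong proj₂ e) (e₂ a))) (proj₁ (ok a a∈))
      ; big = λ b i → let a , a∈ , e = ∈-map⁻ side i in subst (K ≤_) (sym (trans (cong proj₂ e) (e₂ a))) (K≤ (proj₁ (proj₂ (ok a a∈))))
      ; bounded = λ b i → let a , a∈ , e = ∈-map⁻ side i in subst (_≤ V) (sym (cong₂ _*_ (trans (cong proj₁ e) (e₁ a)) (trans (cong proj₂ e) (e₂ a)))) (proj₂ (proj₂ (ok a a∈)))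
      ; unique = subst Unique (sym (trans (sym (map-∘ R)) (map-cong e₂ R))) u
      }

abstract
  mertens-o : ∀ E → 1 ≤ E → ∃ λ N₀ → ∀ N → N₀ ≤ N → E * ∣ mertens N ∣ ≤ 4 * N
  mertens-o = mertens-small twinned-families

-- The prime number theorem for ratios

∣-∣≤ : ∀ {u w b} → u ≤ w + b → w ≤ u + b → ∣ u - w ∣ ≤ b
∣-∣≤ {u} {w} {b} h k with ≤-total u w
... | inj₁ u≤w = ≤-trans (≤-reflexive (m≤n⇒∣m-n∣≡n∸m u≤w)) (m≤n+o⇒m∸n≤o w u k)
... | inj₂ w≤u = ≤-trans (≤-reflexive (m≤n⇒∣n-m∣≡n∸m w≤u)) (m≤n+o⇒m∸n≤o u w h)

-- Summation by parts. The invariant ∣X n - f n · A n∣ + R f n ≤ R f 0 pays for each step with the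
-- decrease of f.
abel : ∀ (c : ℕ → ℤ) (f : ℕ → ℕ) R n₀ → (∀ i → f (suc i) ≤ f i) → (∀ n → n ≤ n₀ → ∣ ∑ℤ (rng n) c ∣ ≤ R) →
  ∣ ∑ℤ (rng n₀) (λ i → c i ℤ.* pos (f i)) ∣ ≤ R * f 0
abel c f R n₀ anti bound = ≤-trans (≤-reflexive (cong ∣_∣ (add-sub (X n₀) (pos (f n₀) ℤ.* A n₀))))
  (≤-trans (∣∣-+≤ (X n₀ ℤ.- pos (f n₀) ℤ.* A n₀) (pos (f n₀) ℤ.* A n₀) ≤-refl
    (≤-trans (≤-reflexive (ℤP.abs-* (pos (f n₀)) (A n₀))) (≤-trans (*-monoʳ-≤ (f n₀) (bound n₀ ≤-refl)) (≤-reflexive (*-comm (f n₀) R)))))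
    (go n₀ ≤-refl))
  where
  X A : ℕ → ℤ
  X n = ∑ℤ (rng n) (λ i → c i ℤ.* pos (f i))
  A n = ∑ℤ (rng n) c
  add-sub : ∀ x y → x ≡ x ℤ.- y ℤ.+ y
  add-sub = ℤR.solve-∀
  go : ∀ n → n ≤ n₀ → ∣ X n ℤ.- pos (f n) ℤ.* A n ∣ + R * f n ≤ R * f 0
  go zero _ = ≤-reflexive (cong (λ t → ∣ pos 0 ℤ.- t ∣ + R * f 0) (ℤP.*-zeroʳ (pos (f 0))))
  go (suc n) n<n₀ = begin
    ∣ X (suc n) ℤ.- pos (f (suc n)) ℤ.* A (suc n) ∣ + R * f (suc n) ≡⟨ cong (λ t → ∣ t ∣ + R * f (suc n)) telescoped ⟩
    ∣ X n ℤ.- pos (f n) ℤ.* A n ℤ.+ pos δ ℤ.* A n ∣ + R * f (suc n) ≤⟨ +-monoˡ-≤ (R * f (suc n)) (∣∣-+≤ (X n ℤ.- pos (f n) ℤ.* A n) (pos δ ℤ.* A n) ≤-refl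
        (≤-trans (≤-reflexive (ℤP.abs-* (pos δ) (A n))) (*-monoʳ-≤ δ (bound n (<⇒≤ n<n₀))))) ⟩
    ∣ X n ℤ.- pos (f n) ℤ.* A n ∣ + δ * R + R * f (suc n) ≡⟨ r ∣ X n ℤ.- pos (f n) ℤ.* A n ∣ δ R (f (suc n)) ⟩
    ∣ X n ℤ.- pos (f n) ℤ.* A n ∣ + R * (f (suc n) + δ) ≡⟨ cong (λ t → ∣ X n ℤ.- pos (f n) ℤ.* A n ∣ + R * t) f≡ ⟩
    ∣ X n ℤ.- pos (f n) ℤ.* A n ∣ + R * f n ≤⟨ go n (<⇒≤ n<n₀) ⟩
    R * f 0 ∎
    where
    open ≤-Reasoning
    δ = f n ∸ f (suc n)
    f≡ : f (suc n) + δ ≡ f n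
    f≡ = m+[n∸m]≡n (anti n)
    r : ∀ x d R g → x + d * R + R * g ≡ x + R * (g + d)
    r = solve-∀
    ring : ∀ x cn g d a → cn ℤ.* g ℤ.+ x ℤ.- g ℤ.* (cn ℤ.+ a) ≡ x ℤ.- (g ℤ.+ d) ℤ.* a ℤ.+ d ℤ.* a
    ring = ℤR.solve-∀
    telescoped : X (suc n) ℤ.- pos (f (suc n)) ℤ.* A (suc n) ≡ X n ℤ.- pos (f n) ℤ.* A n ℤ.+ pos δ ℤ.* A n
    telescoped = trans (ring (X n) (c (suc n)) (pos (f (suc n))) (pos δ) (A n))
      (cong (λ t → X n ℤ.- t ℤ.* A n ℤ.+ pos δ ℤ.* A n) (trans (sym (ℤP.pos-+ (f (suc n)) δ)) (cong pos f≡)))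

module Inversion (B : ℕ) where
  open Log B

  T-mono : ∀ {m n} → m ≤ n → T m ≤ T n
  T-mono = ∑-rng-mono ℓ

  -- Legendre's formula expands T into floors, and `μ-floor-sum` inverts each of them. D may exceed
  -- x, which lets ψ (a z) and ψ (z) be summed over the same range.
  ψ-inversion : ∀ {x D} → x ≤ D → D ≤ B → ∑ℤ (rng D) (λ d → μ d ℤ.* pos (T (x ÷ d))) ≡ pos (ψ x)
  ψ-inversion {x} {D} x≤D D≤B = begin
    ∑ℤ (rng D) (λ d → μ d ℤ.* pos (T (x ÷ d))) ≡⟨ ∑ℤ-cong (rng D) (λ d → trans (cong (ℤ._*_ (μ d)) (expand (x ÷ d) (≤-trans (÷-≤ x d) (≤-trans x≤D D≤B))))
         (trans (sym (∑ℤ-*ˡ (rng B) (μ d) _)) (∑ℤ-cong (rng B) λ p → trans (sym (∑ℤ-*ˡ (rng B) (μ d) _)) (∑ℤ-cong (rng B) λ k → shuffle (μ d) (pos (coef p)) (pos (x ÷ d ÷ p ^ k)))))) ⟩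
    ∑ℤ (rng D) (λ d → ∑ℤ (rng B) (λ p → ∑ℤ (rng B) (λ k → pos (coef p) ℤ.* (μ d ℤ.* pos (x ÷ d ÷ p ^ k))))) ≡⟨ ∑ℤ-swap (rng D) (rng B) _ ⟩
    ∑ℤ (rng B) (λ p → ∑ℤ (rng D) (λ d → ∑ℤ (rng B) (λ k → pos (coef p) ℤ.* (μ d ℤ.* pos (x ÷ d ÷ p ^ k))))) ≡⟨ ∑ℤ-cong∈ (rng B) (λ p p∈ → trans (∑ℤ-swap (rng D) (rng B) _)
        (∑ℤ-cong (rng B) λ k → trans (∑ℤ-*ˡ (rng D) (pos (coef p)) _) (trans (cong (ℤ._*_ (pos (coef p))) (μ-floor-sum (1≤^ k (proj₁ (∈-rng⁻ B p∈))) x≤D)) (sym (ℤP.pos-* (coef p) ⟦ p ^ k ≤? x ⟧))))) ⟩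
    ∑ℤ (rng B) (λ p → ∑ℤ (rng B) (λ k → pos (coef p * ⟦ p ^ k ≤? x ⟧))) ≡⟨ trans (∑ℤ-cong (rng B) (λ p → ∑ℤ-pos (rng B) _)) (∑ℤ-pos (rng B) _) ⟩
    pos (ψ x) ∎
    where
    open ≡-Reasoning
    shuffle : ∀ a b c → a ℤ.* (b ℤ.* c) ≡ b ℤ.* (a ℤ.* c)
    shuffle = ℤR.solve-∀
    expand : ∀ y → y ≤ B → pos (T y) ≡ ∑ℤ (rng B) (λ p → ∑ℤ (rng B) (λ k → pos (coef p) ℤ.* pos (y ÷ p ^ k)))
    expand y y≤B = trans (cong pos (legendre y y≤B)) (trans (sym (∑ℤ-pos (rng B) _)) (∑ℤ-cong (rng B) λ p →
      trans (sym (∑ℤ-pos (rng B) _)) (∑ℤ-cong (rng B) λ k → ℤP.pos-* (coef p) (y ÷ p ^ k))))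

  ÷1 : ∀ x → x ÷ 1 ≡ x
  ÷1 x = ÷-unique {x} {x} {1} (≤-reflexive (*-identityʳ x)) (≤-reflexive (cong suc (sym (*-identityʳ x))))

  μ-floor-one : ∀ {x D} → 1 ≤ x → x ≤ D → ∑ℤ (rng D) (λ d → μ d ℤ.* pos (x ÷ d)) ≡ pos 1
  μ-floor-one {x} {D} 1≤x x≤D = trans (∑ℤ-cong (rng D) (λ d → cong (λ t → μ d ℤ.* pos t) (sym (÷1 (x ÷ d))))) (trans (μ-floor-sum ≤-refl x≤D) (cong pos (⟦⟧-true (1 ≤? x) 1≤x)))

  -- T (⌊a z / d⌋) against a T (⌊z / d⌋): the main terms cancel up to a multiple of ⌊z / d⌋.
  excess : ℕ → ℕ → ℕ → ℤ
  excess a z d = pos (T ((a * z) ÷ d)) ℤ.- pos (a * T (z ÷ d) + a * ℓ a * (z ÷ d))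

  -- The correction a ℓ a ⌊z / d⌋, although large term by term, adds up to a ℓ a only, because ∑ μ
  -- (d) ⌊z / d⌋ = 1.
  excess-sum : ∀ {a z} → 1 ≤ a → 1 ≤ z → a * z ≤ B →
    ∑ℤ (rng (a * z)) (λ d → μ d ℤ.* excess a z d) ≡ pos (ψ (a * z)) ℤ.- pos (a * ψ z + a * ℓ a)
  excess-sum {a} {z} 1≤a 1≤z az≤B = begin
    ∑ℤ (rng D) (λ d → μ d ℤ.* excess a z d) ≡⟨ ∑ℤ-cong (rng D) (λ d → trans (cong (λ t → μ d ℤ.* (pos (T (D ÷ d)) ℤ.- t)) (pull d)) (distr (μ d) (pos (T (D ÷ d))) (pos a) (pos (T (z ÷ d))) (pos (a * ℓ a)) (pos (z ÷ d)))) ⟩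
    ∑ℤ (rng D) (λ d → μ d ℤ.* pos (T (D ÷ d)) ℤ.- (pos a ℤ.* (μ d ℤ.* pos (T (z ÷ d))) ℤ.+ pos (a * ℓ a) ℤ.* (μ d ℤ.* pos (z ÷ d)))) ≡⟨ trans (∑ℤ-- (rng D) _ _) (cong₂ ℤ._-_ (ψ-inversion ≤-refl az≤B)
         (trans (∑ℤ-+ (rng D) _ _) (cong₂ ℤ._+_ (trans (∑ℤ-*ˡ (rng D) (pos a) _) (cong (ℤ._*_ (pos a)) (ψ-inversion z≤D az≤B)))
                                                   (trans (∑ℤ-*ˡ (rng D) (pos (a * ℓ a)) _) (cong (ℤ._*_ (pos (a * ℓ a))) (μ-floor-one 1≤z z≤D)))))) ⟩
    pos (ψ D) ℤ.- (pos a ℤ.* pos (ψ z) ℤ.+ pos (a * ℓ a) ℤ.* pos 1) ≡⟨ cong (λ t → pos (ψ D) ℤ.- t) (sym (trans (ℤP.pos-+ (a * ψ z) (a * ℓ a)) (cong₂ ℤ._+_ (ℤP.pos-* a (ψ z)) (sym (ℤP.*-identityʳ (pos (a * ℓ a))))))) ⟩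
    pos (ψ D) ℤ.- pos (a * ψ z + a * ℓ a) ∎
    where
    open ≡-Reasoning
    D = a * z
    z≤D : z ≤ D
    z≤D = m≤n*m z a {{>-nonZero 1≤a}}
    pull : ∀ d → pos (a * T (z ÷ d) + a * ℓ a * (z ÷ d)) ≡ pos a ℤ.* pos (T (z ÷ d)) ℤ.+ pos (a * ℓ a) ℤ.* pos (z ÷ d)
    pull d = trans (ℤP.pos-+ (a * T (z ÷ d)) (a * ℓ a * (z ÷ d))) (cong₂ ℤ._+_ (ℤP.pos-* a (T (z ÷ d))) (ℤP.pos-* (a * ℓ a) (z ÷ d)))
    distr : ∀ m t a u l q → m ℤ.* (t ℤ.- (a ℤ.* u ℤ.+ l ℤ.* q)) ≡ m ℤ.* t ℤ.- (a ℤ.* (m ℤ.* u) ℤ.+ l ℤ.* (m ℤ.* q))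
    distr = ℤR.solve-∀

  -- With q = z ÷ d, the arguments a q and (a z) ÷ d differ by at most a, so the excess is at most
  -- about a log (2 a z / d). The term a ℓ d stays on the left so that summation over d brings in a
  -- factorial.
  excess-bound : ∀ {a z d k} → 1 ≤ a → 1 ≤ d → d ≤ z → 2 * (a * z) ≤ B → 2 * (a * z) ≤ 2 ^ k →
    ∣ excess a z d ∣ + a * ℓ d ≤ a * (S * k) + 2 * (a * z * B)
  excess-bound {a} {z} {d} {k} 1≤a 1≤d d≤z 2az≤B 2az≤2^k = ≤-trans (+-monoˡ-≤ (a * ℓ d) size) (≤-trans (≤-reflexive (r₁ a (ℓ (a * suc q)) B q (ℓ d)))
      (+-mono-≤ (*-monoʳ-≤ a top) rest))
    where
    open ≤-Reasoning
    q = z ÷ d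
    y = (a * z) ÷ d
    r₁ : ∀ a l B q m → a * (l + B) + a * q * B + a * m ≡ a * (l + m) + (a * B + a * q * B)
    r₁ = solve-∀
    1≤q : 1 ≤ q
    1≤q = ÷-greatest 1≤d (≤-trans (≤-reflexive (*-identityˡ d)) d≤z)
    q≤z : q ≤ z
    q≤z = ÷-≤ z d
    1≤z : 1 ≤ z
    1≤z = ≤-trans 1≤d d≤z
    sq≤2q : suc q ≤ 2 * q
    sq≤2q = ≤-trans (+-monoˡ-≤ q 1≤q) (≤-reflexive (cong (q +_) (sym (+-identityʳ q))))
    asq≤ : a * suc q ≤ 2 * (a * z)
    asq≤ = ≤-trans (*-monoʳ-≤ a (≤-trans sq≤2q (*-monoʳ-≤ 2 q≤z))) (≤-reflexive (r a z))
      where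
      r : ∀ a z → a * (2 * z) ≡ 2 * (a * z)
      r = solve-∀
    top : ℓ (a * suc q) + ℓ d ≤ S * k
    top = ≤-trans (≤-reflexive (sym (ℓ-* (1≤* 1≤a (s≤s z≤n)) 1≤d))) (ℓ≤ {a * suc q * d} {k} (≤-trans (≤-trans (*-monoˡ-≤ d (*-monoʳ-≤ a sq≤2q)) (≤-trans (≤-reflexive (r a q d)) (*-monoʳ-≤ 2 (*-monoʳ-≤ a (÷-lower z d))))) 2az≤2^k))
      where
      r : ∀ a q d → a * (2 * q) * d ≡ 2 * (a * (q * d))
      r = solve-∀
    rest : a * B + a * q * B ≤ 2 * (a * z * B)
    rest = ≤-trans (+-mono-≤ (*-monoˡ-≤ B (≤-trans (≤-reflexive (sym (*-identityʳ a))) (*-monoʳ-≤ a 1≤z))) (*-monoˡ-≤ B (*-monoʳ-≤ a q≤z))) (≤-reflexive (cong (a * z * B +_) (sym (+-identityʳ _))))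
    aq≤y : a * q ≤ y
    aq≤y = ÷-greatest 1≤d (≤-trans (≤-reflexive (*-assoc a q d)) (*-monoʳ-≤ a (÷-lower z d)))
    y≤ : y ≤ a * q + a
    y≤ = ≤-trans (÷-least {a * suc q} (≤-trans (s≤s (*-monoʳ-≤ a (<⇒≤ (÷-upper z 1≤d)))) (≤-trans (s≤s (≤-reflexive (sym (*-assoc a (suc q) d)))) (+-monoˡ-≤ (a * suc q * d) 1≤d)))) (≤-reflexive (trans (*-suc a q) (+-comm a (a * q))))
    aq≤B : a * q ≤ B
    aq≤B = ≤-trans (*-monoʳ-≤ a (n≤1+n q)) (≤-trans asq≤ 2az≤B)
    Ty≤ : T y ≤ T (a * q) + a * (ℓ (a * suc q) + B)
    Ty≤ = ≤-trans (T-mono y≤) (≤-trans (≤-reflexive (T-suc (a * q) a)) (+-monoʳ-≤ (T (a * q)) (≤-trans (∑-mono∈ (rng a) λ i i∈ →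
      ℓ-mono (≤-trans (+-monoʳ-≤ (a * q) (proj₂ (∈-rng⁻ a i∈))) (≤-reflexive (trans (+-comm (a * q) a) (sym (*-suc a q))))) (≤-trans asq≤ 2az≤B))
      (≤-reflexive (∑-rng-const a (ℓ (a * suc q) + B))))))
    size : ∣ excess a z d ∣ ≤ a * (ℓ (a * suc q) + B) + a * q * B
    size = ≤-trans (≤-reflexive (∣pos-pos∣ (T y) _)) (∣-∣≤
      (by-lin (+-mono-≤ Ty≤ (T-mult-upper a q 1≤a aq≤B)) (≤-reflexive (r₂ (T (a * q)) (a * (ℓ (a * suc q) + B)) (a * T q) a q (ℓ a) B (T y))))
      (by-lin (+-mono-≤ (T-mult-lower a q 1≤a aq≤B) (+-mono-≤ (T-mono aq≤y) (*-monoʳ-≤ a (ℓ-mono (*-monoʳ-≤ a (n≤1+n q)) (≤-trans asq≤ 2az≤B)))))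
         (≤-reflexive (r₃ (T (a * q)) (a * ℓ (a * q)) (ℓ (a * suc q)) (a * T q) a q (ℓ a) B (T y)))))
      where
      r₂ : ∀ t x u a q l B v → t + x + (u + a * q * l + a * q * B) + v ≡ v + t + (u + a * l * q + (x + a * q * B))
      r₂ = solve-∀
      r₃ : ∀ t x m u a q l B v → t + x + a * q * B + (v + a * (m + B)) + (u + a * l * q) ≡ u + a * q * l + (t + x) + (v + (a * (m + B) + a * q * B))
      r₃ = solve-∀

linear<2^ : ∀ A → ∃ λ κ → A * suc κ ≤ 2 ^ κ
-- For κ = 4 A, 2^κ = (2^A)^4 ≥ (A + 1)^4, a polynomial that dominates A (4 A + 1).
linear<2^ A = 4 * A , (begin
  A * suc (4 * A) ≤⟨ m≤m+n _ (A * A * A * A + 4 * (A * A * A) + 2 * (A * A) + 3 * A + 1) ⟩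
  A * suc (4 * A) + (A * A * A * A + 4 * (A * A * A) + 2 * (A * A) + 3 * A + 1) ≡⟨ r A ⟩
  suc A * (suc A * (suc A * (suc A * 1))) ≤⟨ ^-monoˡ-≤ 4 (n<2^n A) ⟩
  (2 ^ A) ^ 4 ≡⟨ trans (^-*-assoc 2 A 4) (cong (2 ^_) (*-comm A 4)) ⟩
  2 ^ (4 * A) ∎)
  where
  open ≤-Reasoning
  r : ∀ A → A * suc (4 * A) + (A * A * A * A + 4 * (A * A * A) + 2 * (A * A) + 3 * A + 1) ≡ suc A * (suc A * (suc A * (suc A * 1)))
  r = solve-∀

-- ψ (a z) = a ψ (z) + o(z), uniformly in the precision B of the logarithm.
prime-scaling : ∀ a E → 1 ≤ a → 1 ≤ E → ∃ λ z₀ → ∀ z B → z₀ ≤ z → 3 * (a * z) ≤ B →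
  E * ∣ Log.ψ B (a * z) - a * Log.ψ B z ∣ ≤ Log.S B * z
prime-scaling a E 1≤a 1≤E = z₀ , conclude
  where
  -- The head is d ≤ D₀ with D₀ between z / 2^(κ + 1) and z / 2^κ. Its total is at most D₀ S times a
  -- linear function of κ, which 2^κ outweighs for this κ.
  κ = proj₁ (linear<2^ (4 * E * (a * (a + 4) + 1)))
  κ-large : 4 * E * (a * (κ + a + 4) + 1) ≤ 2 ^ κ
  κ-large = ≤-trans (≤-trans (m≤m+n _ (4 * E * (κ * (a * a) + 3 * a * κ + κ))) (≤-reflexive (r E a κ))) (proj₂ (linear<2^ (4 * E * (a * (a + 4) + 1))))
    where
    r : ∀ E a κ → 4 * E * (a * (κ + a + 4) + 1) + 4 * E * (κ * (a * a) + 3 * a * κ + κ) ≡ 4 * E * (a * (a + 4) + 1) * suc κ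
    r = solve-∀
  -- In the tail, d > D₀, the quotients (a z) ÷ d are at most Kc, so the two monotone functions to
  -- be summed are together at most S c₂. E₂ is the quality of M (x) = o(x) that brings the tail
  -- down to S z / (4 E).
  Kc = a * 2 ^ suc κ
  λ₂ = a + suc κ
  c₂ = suc a * (Kc * λ₂) + a * a * Kc
  E₂ = 32 * E * a * c₂
  1≤Kc : 1 ≤ Kc
  1≤Kc = 1≤* 1≤a (m^n>0 2 (suc κ))
  1≤c₂ : 1 ≤ c₂
  1≤c₂ = ≤-trans (1≤* (1≤* 1≤a 1≤a) 1≤Kc) (m≤n+m _ (suc a * (Kc * λ₂)))
  1≤E₂ : 1 ≤ E₂
  1≤E₂ = 1≤* (1≤* (1≤* {32} (s≤s z≤n) 1≤E) 1≤a) 1≤c₂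
  N₀ = proj₁ (mertens-o E₂ 1≤E₂)
  small = proj₂ (mertens-o E₂ 1≤E₂)
  -- The power of 2 ensures N₀ ≤ D₀; the second summand absorbs the constant a ℓ a of `excess-sum`.
  z₀ = suc (2 ^ (N₀ + suc κ) + 4 * E * (a * a))

  conclude : ∀ z B → z₀ ≤ z → 3 * (a * z) ≤ B → E * ∣ Log.ψ B (a * z) - a * Log.ψ B z ∣ ≤ Log.S B * z
  conclude z B z₀≤z 3az≤B = *-cancelˡ-≤ 4 total
    where
    open ≤-Reasoning
    open Log B
    open Inversion B
    1≤z : 1 ≤ z
    1≤z = ≤-trans (s≤s z≤n) z₀≤z
    az = a * z
    1≤az : 1 ≤ az
    1≤az = 1≤* 1≤a 1≤z
    2^≤z : 2 ^ (N₀ + suc κ) ≤ z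
    2^≤z = ≤-trans (≤-trans (m≤m+n _ (4 * E * (a * a))) (n≤1+n _)) z₀≤z
    lz = lg-spec 1≤z
    N₀κ≤lg : N₀ + κ ≤ lg z
    N₀κ≤lg = ≤-trans (+-monoʳ-≤ N₀ (n≤1+n κ)) (≤-pred (2^-cancel-< {N₀ + suc κ} {suc (lg z)} (≤-<-trans 2^≤z (proj₂ lz))))
    g = lg z ∸ κ
    g+κ : g + κ ≡ lg z
    g+κ = m∸n+n≡m (≤-trans (m≤n+m κ N₀) N₀κ≤lg)
    N₀≤g : N₀ ≤ g
    N₀≤g = ≤-trans (≤-reflexive (sym (m+n∸n≡m N₀ κ))) (∸-monoˡ-≤ κ N₀κ≤lg)
    D₀ = 2 ^ g
    lower : D₀ * 2 ^ κ ≤ z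
    lower = ≤-trans (≤-reflexive (trans (sym (2^-+ g κ)) (cong (2 ^_) g+κ))) (proj₁ lz)
    upper : z < D₀ * 2 ^ suc κ
    upper = <-≤-trans (proj₂ lz) (≤-reflexive (trans (cong (2 ^_) (trans (cong suc (sym g+κ)) (sym (+-suc g κ)))) (2^-+ g (suc κ))))
    D₀≤z : D₀ ≤ z
    D₀≤z = ≤-trans (≤-trans (≤-reflexive (sym (*-identityʳ D₀))) (*-monoʳ-≤ D₀ (m^n>0 2 κ))) lower
    z≤az : z ≤ az
    z≤az = m≤n*m z a {{>-nonZero 1≤a}}
    D₀≤az : D₀ ≤ az
    D₀≤az = ≤-trans D₀≤z z≤az
    2az≤B : 2 * az ≤ B
    2az≤B = ≤-trans (m≤n+m (2 * az) az) 3az≤B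
    az≤B : az ≤ B
    az≤B = ≤-trans (m≤m+n az (1 * az)) 2az≤B
    1≤B : 1 ≤ B
    1≤B = ≤-trans 1≤az az≤B
    k = g + (κ + a + 2)
    2az≤2^k : 2 * az ≤ 2 ^ k
    2az≤2^k = begin
      2 * (a * z) ≤⟨ *-monoʳ-≤ 2 (*-mono-≤ (<⇒≤ (n<2^n a)) (<⇒≤ upper)) ⟩
      2 * (2 ^ a * (D₀ * (2 * 2 ^ κ))) ≡⟨ r (2 ^ a) D₀ (2 ^ κ) ⟩
      D₀ * (2 ^ κ * 2 ^ a * (2 * (2 * 1))) ≡⟨ cong (D₀ *_) (sym (trans (2^-+ (κ + a) 2) (cong (_* 4) (2^-+ κ a)))) ⟩
      D₀ * 2 ^ (κ + a + 2) ≡⟨ sym (2^-+ g (κ + a + 2)) ⟩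
      2 ^ k ∎
      where
      r : ∀ x d y → 2 * (x * (d * (2 * y))) ≡ d * (y * x * (2 * (2 * 1)))
      r = solve-∀
    n₁ = az ∸ D₀
    D₀+n₁ : D₀ + n₁ ≡ az
    D₀+n₁ = m+[n∸m]≡n D₀≤az
    head tail : ℤ
    head = ∑ℤ (rng D₀) (λ d → μ d ℤ.* excess a z d)
    tail = ∑ℤ (rng n₁) (λ i → μ (D₀ + i) ℤ.* excess a z (D₀ + i))
    split : pos (ψ az) ℤ.- pos (a * ψ z + a * ℓ a) ≡ head ℤ.+ tail
    split = trans (sym (excess-sum 1≤a 1≤z az≤B)) (trans (cong (λ n → ∑ℤ (rng n) (λ d → μ d ℤ.* excess a z d)) (sym D₀+n₁)) (∑ℤ-rng-+ D₀ n₁ _))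
    B³≤S : 3 * az * B ≤ S
    B³≤S = ≤-trans (*-monoˡ-≤ B 3az≤B) (≤-trans (≤-reflexive (sym (*-identityʳ (B * B)))) (*-monoʳ-≤ (B * B) (1≤* 1≤B 1≤B)))
    Σb = ∑ (rng D₀) (λ d → ∣ excess a z d ∣)
    -- By Stirling, D₀ log (2 a z) - log D₀! is of order D₀ (κ + a), since D₀ is smaller than z only
    -- by a factor of about 2^κ.
    Σb-bound : Σb ≤ D₀ * (S * (a * (κ + a + 4) + 1))
    Σb-bound = by-lin (+-mono-≤ summed (+-mono-≤ (*-monoʳ-≤ a (T-2^-lower g (≤-trans D₀≤az az≤B))) (+-mono-≤ (*-monoʳ-≤ D₀ B³≤S) (*-monoʳ-≤ (D₀ * B) (≤-trans (≤-reflexive (sym (*-identityʳ a))) (*-monoʳ-≤ a 1≤z))))))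
        (≤-reflexive (r D₀ a S g κ az B (T D₀) Σb))
      where
      summed : Σb + a * T D₀ ≤ D₀ * (a * (S * k) + 2 * (az * B))
      summed = begin
        Σb + a * T D₀ ≡⟨ cong (Σb +_) (sym (∑-*ˡ (rng D₀) a ℓ)) ⟩
        Σb + ∑ (rng D₀) (λ d → a * ℓ d) ≡⟨ sym (∑-+ (rng D₀) _ _) ⟩
        ∑ (rng D₀) (λ d → ∣ excess a z d ∣ + a * ℓ d) ≤⟨ ∑-mono∈ (rng D₀) (λ d d∈ → let x , y = ∈-rng⁻ D₀ d∈ in excess-bound {a} {z} {d} {k} 1≤a x (≤-trans y D₀≤z) 2az≤B 2az≤2^k) ⟩
        ∑ (rng D₀) (λ _ → a * (S * k) + 2 * (az * B)) ≡⟨ ∑-rng-const D₀ (a * (S * k) + 2 * (az * B)) ⟩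
        D₀ * (a * (S * k) + 2 * (az * B)) ∎
      r : ∀ D a S g κ z B t b → D * (a * (S * (g + (κ + a + 2))) + 2 * (z * B)) + (a * (t + 2 * D * S + D * B) + (D * S + D * B * z)) + b
        ≡ b + a * t + (a * (g * D * S) + (D * (3 * z * B) + D * B * a)) + D * (S * (a * (κ + a + 4) + 1))
      r = solve-∀
    head-bound : 4 * (E * ∣ head ∣) ≤ S * z
    head-bound = begin
      4 * (E * ∣ head ∣) ≤⟨ *-monoʳ-≤ 4 (*-monoʳ-≤ E (≤-trans (∑ℤ-abs (rng D₀) _) (∑-mono (rng D₀) λ d → ≤-trans (≤-reflexive (ℤP.abs-* (μ d) (excess a z d)))
           (≤-trans (*-monoˡ-≤ ∣ excess a z d ∣ (∣μ∣≤1 d)) (≤-reflexive (*-identityˡ _)))))) ⟩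
      4 * (E * Σb) ≤⟨ *-monoʳ-≤ 4 (*-monoʳ-≤ E Σb-bound) ⟩
      4 * (E * (D₀ * (S * (a * (κ + a + 4) + 1)))) ≡⟨ r E D₀ S (a * (κ + a + 4) + 1) ⟩
      S * (D₀ * (4 * E * (a * (κ + a + 4) + 1))) ≤⟨ *-monoʳ-≤ S (≤-trans (*-monoʳ-≤ D₀ κ-large) lower) ⟩
      S * z ∎
      where
      r : ∀ E D S c → 4 * (E * (D * (S * c))) ≡ S * (D * (4 * E * c))
      r = solve-∀
    R = (8 * az) ÷ E₂
    M-bound : ∀ n → n ≤ n₁ → ∣ ∑ℤ (rng n) (λ i → μ (D₀ + i)) ∣ ≤ R
    M-bound n n≤ = ÷-greatest 1≤E₂ (≤-trans (≤-reflexive (*-comm _ E₂)) (begin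
      E₂ * ∣ ∑ℤ (rng n) (λ i → μ (D₀ + i)) ∣ ≡⟨ cong (λ t → E₂ * ∣ t ∣) (trans (ring (mertens D₀) _) (cong (ℤ._+ (ℤ.- mertens D₀)) (sym (∑ℤ-rng-+ D₀ n μ)))) ⟩
      E₂ * ∣ mertens (D₀ + n) ℤ.+ ℤ.- mertens D₀ ∣ ≤⟨ *-monoʳ-≤ E₂ (∣∣-+≤ (mertens (D₀ + n)) (ℤ.- mertens D₀) ≤-refl (≤-reflexive (ℤP.∣-i∣≡∣i∣ (mertens D₀)))) ⟩
      E₂ * (∣ mertens (D₀ + n) ∣ + ∣ mertens D₀ ∣) ≡⟨ *-distribˡ-+ E₂ ∣ mertens (D₀ + n) ∣ ∣ mertens D₀ ∣ ⟩
      E₂ * ∣ mertens (D₀ + n) ∣ + E₂ * ∣ mertens D₀ ∣ ≤⟨ +-mono-≤ (≤-trans (small (D₀ + n) (≤-trans N₀≤D₀ (m≤m+n D₀ n))) (*-monoʳ-≤ 4 (≤-trans (+-monoʳ-≤ D₀ n≤) (≤-reflexive D₀+n₁)))) (≤-trans (small D₀ N₀≤D₀) (*-monoʳ-≤ 4 D₀≤az)) ⟩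
      4 * az + 4 * az ≡⟨ r az ⟩
      8 * az ∎))
      where
      N₀≤D₀ : N₀ ≤ D₀
      N₀≤D₀ = ≤-trans (<⇒≤ (n<2^n N₀)) (^-monoʳ-≤ 2 N₀≤g)
      ring : ∀ m s → s ≡ m ℤ.+ s ℤ.+ ℤ.- m
      ring = ℤR.solve-∀
      r : ∀ x → 4 * x + 4 * x ≡ 8 * x
      r = solve-∀
    abel-at : ∀ (x : ℕ) (f : ℕ → ℕ) → (∀ {m n} → m ≤ n → f m ≤ f n) → ∣ ∑ℤ (rng n₁) (λ i → μ (D₀ + i) ℤ.* pos (f (x ÷ (D₀ + i)))) ∣ ≤ R * f (x ÷ D₀)
    abel-at x f mono = ≤-trans (abel (λ i → μ (D₀ + i)) (λ i → f (x ÷ (D₀ + i))) R n₁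
      (λ i → mono (÷-antiʳ x (≤-trans (m^n>0 2 g) (m≤m+n D₀ i)) (+-monoʳ-≤ D₀ (n≤1+n i)))) M-bound) (≤-reflexive (cong (λ d → R * f (x ÷ d)) (+-identityʳ D₀)))
    az÷≤ : az ÷ D₀ ≤ Kc
    az÷≤ = ÷-least (≤-<-trans (*-monoʳ-≤ a (<⇒≤ upper)) (≤-trans (≤-reflexive (cong suc (r a D₀ (2 ^ suc κ)))) (+-monoˡ-≤ (Kc * D₀) (m^n>0 2 g))))
      where
      r : ∀ a d p → a * (d * p) ≡ a * p * d
      r = solve-∀
    z÷≤ : z ÷ D₀ ≤ Kc
    z÷≤ = ≤-trans (÷-monoˡ D₀ z≤az) az÷≤
    TKc : T Kc ≤ Kc * (S * λ₂)
    TKc = T-increment 0 Kc {λ₂} (≤-trans (*-monoˡ-≤ (2 ^ suc κ) (<⇒≤ (n<2^n a))) (≤-reflexive (sym (2^-+ a (suc κ)))))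
    ℓa : ℓ a ≤ S * a
    ℓa = ℓ≤ {a} {a} (<⇒≤ (n<2^n a))
    tail-split : tail ≡ ∑ℤ (rng n₁) (λ i → μ (D₀ + i) ℤ.* pos (T (az ÷ (D₀ + i)))) ℤ.+ ℤ.- (∑ℤ (rng n₁) (λ i → μ (D₀ + i) ℤ.* pos (a * T (z ÷ (D₀ + i)) + a * ℓ a * (z ÷ (D₀ + i)))))
    tail-split = trans (∑ℤ-cong (rng n₁) (λ i → distr (μ (D₀ + i)) (pos (T (az ÷ (D₀ + i)))) _)) (∑ℤ-- (rng n₁) _ _)
      where
      distr : ∀ m a b → m ℤ.* (a ℤ.- b) ≡ m ℤ.* a ℤ.- m ℤ.* b
      distr = ℤR.solve-∀
    tail-bound : 4 * (E * ∣ tail ∣) ≤ S * z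
    tail-bound = *-cancelˡ-≤ (8 * a) {{>-nonZero (*-mono-≤ {1} {8} (s≤s z≤n) 1≤a)}} (begin
      8 * a * (4 * (E * ∣ tail ∣)) ≤⟨ *-monoʳ-≤ (8 * a) (*-monoʳ-≤ 4 (*-monoʳ-≤ E (≤-trans (≤-reflexive (cong ∣_∣ tail-split)) (∣∣-+≤ Σ₁ (ℤ.- Σ₂)
          (≤-trans (abel-at az T T-mono) (*-monoʳ-≤ R (≤-trans (T-mono az÷≤) TKc)))
          (≤-trans (≤-reflexive (ℤP.∣-i∣≡∣i∣ Σ₂)) (≤-trans (abel-at z (λ q → a * T q + a * ℓ a * q) (λ h → +-mono-≤ (*-monoʳ-≤ a (T-mono h)) (*-monoʳ-≤ (a * ℓ a) h)))
             (*-monoʳ-≤ R (+-mono-≤ (*-monoʳ-≤ a (≤-trans (T-mono z÷≤) TKc)) (*-mono-≤ (*-monoʳ-≤ a ℓa) z÷≤)))))))))  ⟩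
      8 * a * (4 * (E * (R * (Kc * (S * λ₂)) + R * (a * (Kc * (S * λ₂)) + a * (S * a) * Kc)))) ≡⟨ r 8 4 a E R Kc S λ₂ ⟩
      S * (R * (8 * 4 * E * a * c₂)) ≤⟨ *-monoʳ-≤ S (÷-lower (8 * az) E₂) ⟩
      S * (8 * az) ≡⟨ r′ S 8 a z ⟩
      8 * a * (S * z) ∎)
      where
      Σ₁ = ∑ℤ (rng n₁) (λ i → μ (D₀ + i) ℤ.* pos (T (az ÷ (D₀ + i))))
      Σ₂ = ∑ℤ (rng n₁) (λ i → μ (D₀ + i) ℤ.* pos (a * T (z ÷ (D₀ + i)) + a * ℓ a * (z ÷ (D₀ + i))))
      r : ∀ u v a E R K S l → u * a * (v * (E * (R * (K * (S * l)) + R * (a * (K * (S * l)) + a * (S * a) * K)))) ≡ S * (R * (u * v * E * a * (suc a * (K * l) + a * a * K)))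
      r = solve-∀
      r′ : ∀ S u a z → S * (u * (a * z)) ≡ u * a * (S * z)
      r′ = solve-∀
    constant-bound : 4 * (E * (a * ℓ a)) ≤ S * z
    constant-bound = begin
      4 * (E * (a * ℓ a)) ≤⟨ *-monoʳ-≤ 4 (*-monoʳ-≤ E (*-monoʳ-≤ a ℓa)) ⟩
      4 * (E * (a * (S * a))) ≡⟨ r E a S ⟩
      S * (4 * E * (a * a)) ≤⟨ *-monoʳ-≤ S (≤-trans (≤-trans (m≤n+m _ (2 ^ (N₀ + suc κ))) (n≤1+n _)) z₀≤z) ⟩
      S * z ∎
      where
      r : ∀ E a S → 4 * (E * (a * (S * a))) ≡ S * (4 * E * (a * a))
      r = solve-∀
    total : 4 * (E * ∣ ψ az - a * ψ z ∣) ≤ 4 * (S * z)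
    total = begin
      4 * (E * ∣ ψ az - a * ψ z ∣) ≡⟨ cong (λ t → 4 * (E * t)) (trans (sym (∣pos-pos∣ (ψ az) (a * ψ z))) (cong ∣_∣ regroup)) ⟩
      4 * (E * ∣ head ℤ.+ tail ℤ.+ pos (a * ℓ a) ∣) ≤⟨ *-monoʳ-≤ 4 (*-monoʳ-≤ E (∣∣-+≤ (head ℤ.+ tail) (pos (a * ℓ a)) (∣∣-+≤ head tail ≤-refl ≤-refl) ≤-refl)) ⟩
      4 * (E * (∣ head ∣ + ∣ tail ∣ + a * ℓ a)) ≡⟨ r E ∣ head ∣ ∣ tail ∣ (a * ℓ a) ⟩
      4 * (E * ∣ head ∣) + 4 * (E * ∣ tail ∣) + 4 * (E * (a * ℓ a)) ≤⟨ +-mono-≤ (+-mono-≤ head-bound tail-bound) constant-bound ⟩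
      S * z + S * z + S * z ≤⟨ m≤m+n _ (S * z) ⟩
      S * z + S * z + S * z + S * z ≡⟨ r′ (S * z) ⟩
      4 * (S * z) ∎
      where
      r : ∀ E x y w → 4 * (E * (x + y + w)) ≡ 4 * (E * x) + 4 * (E * y) + 4 * (E * w)
      r = solve-∀
      r′ : ∀ x → x + x + x + x ≡ 4 * x
      r′ = solve-∀
      ring : ∀ p q l → p ℤ.- q ≡ p ℤ.- (q ℤ.+ l) ℤ.+ l
      ring = ℤR.solve-∀
      regroup : pos (ψ az) ℤ.- pos (a * ψ z) ≡ head ℤ.+ tail ℤ.+ pos (a * ℓ a)
      regroup = trans (ring (pos (ψ az)) (pos (a * ψ z)) (pos (a * ℓ a))) (cong (ℤ._+ pos (a * ℓ a)) (trans (cong (λ t → pos (ψ az) ℤ.- t) (sym (ℤP.pos-+ (a * ψ z) (a * ℓ a)))) split))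

prime-scaling-uniform : ∀ A E → 1 ≤ E → ∃ λ z₀ → ∀ a z B → 1 ≤ a → a ≤ A → z₀ ≤ z → 3 * (A * z) ≤ B →
  E * ∣ Log.ψ B (a * z) - a * Log.ψ B z ∣ ≤ Log.S B * z
prime-scaling-uniform zero E 1≤E = 0 , λ a z B 1≤a a≤0 _ _ → contradiction (≤-trans 1≤a a≤0) λ ()
prime-scaling-uniform (suc A) E 1≤E = z₁ + z₂ , go
  where
  rec = prime-scaling-uniform A E 1≤E
  new = prime-scaling (suc A) E (s≤s z≤n) 1≤E
  z₁ = proj₁ rec
  z₂ = proj₁ new
  go : ∀ a z B → 1 ≤ a → a ≤ suc A → z₁ + z₂ ≤ z → 3 * (suc A * z) ≤ B → E * ∣ Log.ψ B (a * z) - a * Log.ψ B z ∣ ≤ Log.S B * z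
  go a z B 1≤a a≤ z≥ hB with m≤n⇒m<n∨m≡n a≤
  ... | inj₁ a<sA = proj₂ rec a z B 1≤a (≤-pred a<sA) (≤-trans (m≤m+n z₁ z₂) z≥) (≤-trans (*-monoʳ-≤ 3 (*-monoˡ-≤ z (n≤1+n A))) hB)
  ... | inj₂ refl = proj₂ new z B (≤-trans (m≤n+m z₂ z₁) z≥) hB

-- Comparison of prime counts in windows

linear≤2^ : ∀ C → ∃ λ h₀ → ∀ h → h₀ ≤ h → C * suc h ≤ 2 ^ h
linear≤2^ C = h₀ , λ h h₀≤h → subst (λ h → C * suc h ≤ 2 ^ h) (m+[n∸m]≡n h₀≤h) (go (h ∸ h₀))
  where
  h₀ = proj₁ (linear<2^ C)
  go : ∀ i → C * suc (h₀ + i) ≤ 2 ^ (h₀ + i)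
  go zero = subst (λ h → C * suc h ≤ 2 ^ h) (sym (+-identityʳ h₀)) (proj₂ (linear<2^ C))
  go (suc i) = subst (λ h → C * suc h ≤ 2 ^ h) (sym (+-suc h₀ i)) (begin
    C * suc (suc (h₀ + i)) ≤⟨ m≤m+n _ (C * (h₀ + i)) ⟩
    C * suc (suc (h₀ + i)) + C * (h₀ + i) ≡⟨ r C (h₀ + i) ⟩
    2 * (C * suc (h₀ + i)) ≤⟨ *-monoʳ-≤ 2 (go i) ⟩
    2 * 2 ^ (h₀ + i) ∎)
    where
    open ≤-Reasoning
    r : ∀ C h → C * suc (suc h) + C * h ≡ 2 * (C * suc h)
    r = solve-∀

π≤ : ∀ x → π x ≤ x
π≤ x = ∑⟦⟧≤ x prime?

square-cancel : ∀ {a b} → a * a ≤ b * b → a ≤ b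
square-cancel {a} {b} h with a ≤? b
... | yes p = p
... | no p = contradiction h (<⇒≱ (*-mono-< (≰⇒> p) (≰⇒> p)))

-- The windows (j z, (j + 1) z] hold asymptotically equally many primes; a factor 2 suffices here.
module Windows (k : ℕ) (1≤k : 1 ≤ k) where
  Q′ Q A : ℕ
  -- Of the windows up to √N about four stay unmatched: the one below z and three at the top. Among
  -- 20 k windows this is a share below 2 / k, although logarithms are compared only within a factor
  -- 4 (`l≤4h`).
  Q′ = 20 * k
  Q = 3 + Q′
  A = 2 * Q

  C : ℕ
  -- Collects the coefficients of all terms of lower order; once √z outgrows C log z, they are
  -- jointly at most z.
  C = 8 * (4 * k + 2 * (k * Q * suc Q) + 4 * (suc Q * 2 ^ suc Q)) + 64 * (suc Q * 2 ^ suc Q)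

  h₀ z₁ e₀ z₀ : ℕ
  h₀ = proj₁ (linear≤2^ C)
  z₁ = proj₁ (prime-scaling-uniform A 208 (s≤s z≤n))
  e₀ = 2 * (h₀ + (4 * Q + 2))
  z₀ = 2 ^ e₀ + z₁

  module Large (z : ℕ) (z₀≤z : z₀ ≤ z) where
    open ≤-Reasoning
    B : ℕ
    B = 3 * (A * z)
    open Log B public
    open LogBounds B
    e h l s x₀ P L : ℕ
    -- For the primes in the windows, e is a lower and l an upper bound for the logarithm; h is a
    -- lower bound for the primes above x₀, which is about √z.
    e = lg z
    h = e ÷ 2
    l = e + 1 + 2 * Q
    s = isqrt (A * z)
    x₀ = 2 ^ h
    P = ψ z
    L = S * l

    2^e₀≤z : 2 ^ e₀ ≤ z
    2^e₀≤z = ≤-trans (m≤m+n _ z₁) z₀≤z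
    1≤z : 1 ≤ z
    1≤z = ≤-trans (m^n>0 2 e₀) 2^e₀≤z
    z-spec : 2 ^ e ≤ z × z < 2 ^ suc e
    z-spec = lg-spec 1≤z
    e₀≤e : e₀ ≤ e
    e₀≤e = ≤-pred (2^-cancel-< {e₀} {suc e} (≤-<-trans 2^e₀≤z (proj₂ z-spec)))
    h≥ : h₀ + (4 * Q + 2) ≤ h
    h≥ = ÷-greatest {d = 2} (s≤s z≤n) (≤-trans (≤-reflexive (*-comm (h₀ + (4 * Q + 2)) 2)) e₀≤e)
    2h≤e : 2 * h ≤ e
    2h≤e = ≤-trans (≤-reflexive (*-comm 2 h)) (÷-lower e 2)
    e≤2h+1 : e ≤ 2 * h + 1
    e≤2h+1 = ≤-pred (≤-trans (÷-upper e {2} (s≤s z≤n)) (≤-reflexive (r h)))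
      where
      r : ∀ h → suc h * 2 ≡ suc (2 * h + 1)
      r = solve-∀
    4Q+2≤h : 4 * Q + 2 ≤ h
    4Q+2≤h = ≤-trans (m≤n+m _ h₀) h≥
    1≤h : 1 ≤ h
    1≤h = ≤-trans (≤-trans (s≤s z≤n) (m≤n+m 2 (4 * Q))) 4Q+2≤h
    4l≤5e : 4 * l ≤ 5 * e
    4l≤5e = by-lin (+-mono-≤ 2h≤e (*-monoʳ-≤ 2 4Q+2≤h)) (≤-reflexive (r e Q h))
      where
      r : ∀ e Q h → e + 2 * h + 4 * (e + 1 + 2 * Q) ≡ 2 * h + 2 * (4 * Q + 2) + 5 * e
      r = solve-∀
    l≤2h : l ≤ 2 * (suc Q * suc h)
    l≤2h = ≤-trans (+-monoˡ-≤ (2 * Q) (+-monoˡ-≤ 1 e≤2h+1)) (≤-trans (m≤m+n _ (2 * (Q * h))) (≤-reflexive (r h Q)))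
      where
      r : ∀ h Q → 2 * h + 1 + 1 + 2 * Q + 2 * (Q * h) ≡ 2 * (suc Q * suc h)
      r = solve-∀
    l≤4h : l ≤ 4 * h
    l≤4h = by-lin (+-mono-≤ e≤2h+1 (*-monoʳ-≤ 2 4Q+2≤h)) (≤-trans (m≤m+n _ (6 * Q + 2)) (≤-reflexive (r e Q h)))
      where
      r : ∀ e Q h → 2 * h + 1 + 2 * h + (e + 1 + 2 * Q) + (6 * Q + 2) ≡ e + 2 * (4 * Q + 2) + 4 * h
      r = solve-∀
    Az≤ : A * z ≤ 2 ^ l
    Az≤ = begin
      2 * Q * z ≤⟨ *-mono-≤ (<⇒≤ (n<2^n (2 * Q))) (<⇒≤ (proj₂ z-spec)) ⟩
      2 ^ (2 * Q) * 2 ^ suc e ≡⟨ sym (2^-+ (2 * Q) (suc e)) ⟩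
      2 ^ (2 * Q + suc e) ≡⟨ cong (2 ^_) (r Q e) ⟩
      2 ^ l ∎
      where
      r : ∀ Q e → 2 * Q + suc e ≡ e + 1 + 2 * Q
      r = solve-∀
    s≤ : s ≤ 2 ^ suc Q * x₀
    s≤ = square-cancel (begin
      s * s ≤⟨ proj₁ (isqrt-spec (A * z)) ⟩
      A * z ≤⟨ Az≤ ⟩
      2 ^ l ≤⟨ ^-monoʳ-≤ 2 (≤-trans (+-monoˡ-≤ (2 * Q) (+-monoˡ-≤ 1 e≤2h+1)) (≤-reflexive (r h Q))) ⟩
      2 ^ (suc Q + h + (suc Q + h)) ≡⟨ trans (2^-+ (suc Q + h) (suc Q + h)) (cong₂ _*_ (2^-+ (suc Q) h) (2^-+ (suc Q) h)) ⟩
      2 ^ suc Q * x₀ * (2 ^ suc Q * x₀) ∎)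
      where
      r : ∀ h Q → 2 * h + 1 + 1 + 2 * Q ≡ suc Q + h + (suc Q + h)
      r = solve-∀
    x₀²≤z : x₀ * x₀ ≤ z
    x₀²≤z = ≤-trans (≤-reflexive (sym (2^-+ h h))) (≤-trans (^-monoʳ-≤ 2 (≤-trans (≤-reflexive (cong (h +_) (sym (+-identityʳ h)))) 2h≤e)) (proj₁ z-spec))
    ls≤ : l * s ≤ 2 * (suc Q * 2 ^ suc Q) * suc h * x₀
    ls≤ = ≤-trans (*-mono-≤ l≤2h s≤) (≤-reflexive (r (suc Q) (suc h) (2 ^ suc Q) x₀))
      where
      r : ∀ a b c d → 2 * (a * b) * (c * d) ≡ 2 * (a * c) * b * d
      r = solve-∀
    Ch : C * suc h * x₀ ≤ z
    Ch = ≤-trans (*-monoˡ-≤ x₀ (proj₂ (linear≤2^ C) h (≤-trans (m≤m+n h₀ _) h≥))) x₀²≤z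
    32ls≤z : 32 * (l * s) ≤ z
    32ls≤z = begin
      32 * (l * s) ≤⟨ *-monoʳ-≤ 32 ls≤ ⟩
      32 * (2 * (suc Q * 2 ^ suc Q) * suc h * x₀) ≡⟨ r 32 2 (suc Q * 2 ^ suc Q) (suc h) x₀ ⟩
      64 * (suc Q * 2 ^ suc Q) * suc h * x₀ ≤⟨ *-monoˡ-≤ x₀ (*-monoˡ-≤ (suc h) (m≤n+m (64 * (suc Q * 2 ^ suc Q)) (8 * (4 * k + 2 * (k * Q * suc Q) + 4 * (suc Q * 2 ^ suc Q))))) ⟩
      C * suc h * x₀ ≤⟨ Ch ⟩
      z ∎
      where
      r : ∀ u v a b c → u * (v * a * b * c) ≡ u * v * a * b * c
      r = solve-∀
    small-terms : 8 * (4 * (k * (h * x₀)) + l * (k * Q) + 2 * (l * s)) ≤ z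
    small-terms = begin
      8 * (4 * (k * (h * x₀)) + l * (k * Q) + 2 * (l * s)) ≤⟨ *-monoʳ-≤ 8 (+-mono-≤ (+-mono-≤ (*-monoʳ-≤ 4 (*-monoʳ-≤ k (*-monoˡ-≤ x₀ (n≤1+n h))))
           (≤-trans (*-monoˡ-≤ (k * Q) l≤2h) (m≤m*n _ x₀ {{>-nonZero (m^n>0 2 h)}}))) (*-monoʳ-≤ 2 ls≤)) ⟩
      8 * (4 * (k * (suc h * x₀)) + 2 * (suc Q * suc h) * (k * Q) * x₀ + 2 * (2 * (suc Q * 2 ^ suc Q) * suc h * x₀)) ≡⟨ r k (suc h) x₀ (suc Q) (k * Q) (2 ^ suc Q) ⟩
      8 * (4 * k + 2 * (k * Q * suc Q) + 4 * (suc Q * 2 ^ suc Q)) * suc h * x₀ ≤⟨ *-monoˡ-≤ x₀ (*-monoˡ-≤ (suc h) (m≤m+n (8 * (4 * k + 2 * (k * Q * suc Q) + 4 * (suc Q * 2 ^ suc Q))) (64 * (suc Q * 2 ^ suc Q)))) ⟩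
      C * suc h * x₀ ≤⟨ Ch ⟩
      z ∎
      where
      r : ∀ k h x q m p → 8 * (4 * (k * (h * x)) + 2 * (q * h) * m * x + 2 * (2 * (q * p) * h * x)) ≡ 8 * (4 * k + 2 * (m * q) + 4 * (q * p)) * h * x
      r = solve-∀

    Az≤B : A * z ≤ B
    Az≤B = m≤n*m (A * z) 3
    az≤B : ∀ {a} → a ≤ A → a * z ≤ B
    az≤B a≤A = ≤-trans (*-monoˡ-≤ z a≤A) Az≤B
    z≤B : z ≤ B
    z≤B = ≤-trans (≤-reflexive (sym (*-identityˡ z))) (az≤B {1} (s≤s z≤n))
    2≤B : 2 ≤ B
    2≤B = ≤-trans (*-monoʳ-≤ 2 1≤z) (az≤B {2} (s≤s (s≤s z≤n)))
    1≤B : 1 ≤ B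
    1≤B = ≤-trans (s≤s z≤n) 2≤B
    1≤S : 1 ≤ S
    1≤S = 1≤* (1≤* 1≤B 1≤B) (1≤* 1≤B 1≤B)
    4B≤S : 4 * B ≤ S
    4B≤S = ≤-trans (≤-trans (*-monoˡ-≤ B (*-mono-≤ 2≤B 2≤B)) (*-monoʳ-≤ (B * B) (≤-trans (≤-reflexive (sym (*-identityʳ B))) (*-monoʳ-≤ B 1≤B)))) ≤-refl

    -- Chebyshev's lower bound makes S z, the unit of the error terms, a bounded multiple of P.
    P-large : S * z ≤ 8 * P
    P-large = begin
      S * z ≤⟨ *-monoʳ-≤ S (<⇒≤ (proj₂ z-spec)) ⟩
      S * (2 * 2 ^ e) ≡⟨ r S (2 ^ e) ⟩
      2 * (S * 2 ^ e) ≤⟨ *-monoʳ-≤ 2 quarter ⟩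
      2 * (4 * ψ (2 ^ e)) ≤⟨ *-monoʳ-≤ 2 (*-monoʳ-≤ 4 (ψ-mono (proj₁ z-spec))) ⟩
      2 * (4 * P) ≡⟨ sym (*-assoc 2 4 P) ⟩
      8 * P ∎
      where
      r : ∀ s x → s * (2 * x) ≡ 2 * (s * x)
      r = solve-∀
      1≤e : 1 ≤ e
      1≤e = ≤-trans 1≤h (≤-trans (m≤n*m h 2) 2h≤e)
      q = 2 ^ pred e
      2q : 2 * q ≡ 2 ^ e
      2q = cong (2 ^_) (suc-pred e {{>-nonZero 1≤e}})
      qq : q + q ≡ 2 ^ e
      qq = trans (cong (q +_) (sym (+-identityʳ q))) 2q
      raw : 2 ^ e * S ≤ ψ (2 ^ e) + 2 * (e * S) + 2 ^ e * B
      raw = subst₂ _≤_ (cong (_* S) 2q) (trans (cong₂ (λ a b → ψ a + 2 * b + 2 * q * B) qq (trans (cong ℓ qq) (ℓ-2^ e))) (cong (λ t → ψ (2 ^ e) + 2 * (e * S) + t * B) 2q))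
        (chebyshev q (≤-trans (≤-reflexive qq) (≤-trans (proj₁ z-spec) z≤B)))
      C≥16 : 16 ≤ C
      C≥16 = ≤-trans (≤-trans (*-monoʳ-≤ 16 (1≤* {suc Q} (s≤s z≤n) (m^n>0 2 (suc Q)))) (*-monoˡ-≤ (suc Q * 2 ^ suc Q) (≤ᵇ⇒≤ 16 64 _))) (m≤n+m _ (8 * (4 * k + 2 * (k * Q * suc Q) + 4 * (suc Q * 2 ^ suc Q))))
      8e≤ : 8 * e ≤ 2 ^ e
      8e≤ = begin
        8 * e ≤⟨ *-monoʳ-≤ 8 (≤-trans e≤2h+1 (≤-trans (n≤1+n _) (≤-reflexive (r′ h)))) ⟩
        8 * (2 * suc h) ≡⟨ sym (*-assoc 8 2 (suc h)) ⟩
        16 * suc h ≤⟨ *-monoˡ-≤ (suc h) C≥16 ⟩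
        C * suc h ≤⟨ proj₂ (linear≤2^ C) h (≤-trans (m≤m+n h₀ _) h≥) ⟩
        2 ^ h ≤⟨ ^-monoʳ-≤ 2 (≤-trans (m≤n*m h 2) 2h≤e) ⟩
        2 ^ e ∎
        where
        r′ : ∀ h → suc (2 * h + 1) ≡ 2 * suc h
        r′ = solve-∀
      quarter : S * 2 ^ e ≤ 4 * ψ (2 ^ e)
      quarter = by-lin (+-mono-≤ (*-monoʳ-≤ 4 raw) (+-mono-≤ (*-monoˡ-≤ S 8e≤) (*-monoʳ-≤ (2 ^ e) 4B≤S)))
        (≤-trans (m≤m+n _ (2 ^ e * S)) (≤-reflexive (r″ (ψ (2 ^ e)) e S (2 ^ e) B)))
        where
        r″ : ∀ p e s x b → 4 * (p + 2 * (e * s) + x * b) + (x * s + x * s) + s * x + x * s ≡ 4 * (x * s) + (8 * e * s + x * (4 * b)) + 4 * p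
        r″ = solve-∀

    scaling : ∀ {a} → 1 ≤ a → a ≤ A → 208 * ∣ ψ (a * z) - a * P ∣ ≤ S * z
    scaling {a} 1≤a a≤A = proj₂ (prime-scaling-uniform A 208 (s≤s z≤n)) a z B 1≤a a≤A (≤-trans (m≤n+m z₁ (2 ^ e₀)) z₀≤z) ≤-refl
    scaling-upper : ∀ {a} → 1 ≤ a → a ≤ A → 208 * ψ (a * z) ≤ 208 * (a * P) + S * z
    scaling-upper {a} 1≤a a≤A = ≤-trans (*-monoʳ-≤ 208 (m≤n+∣m-n∣ (ψ (a * z)) (a * P))) (≤-trans (≤-reflexive (*-distribˡ-+ 208 (a * P) _)) (+-monoʳ-≤ (208 * (a * P)) (scaling 1≤a a≤A)))
    scaling-lower : ∀ {a} → 1 ≤ a → a ≤ A → 208 * (a * P) ≤ 208 * ψ (a * z) + S * z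
    scaling-lower {a} 1≤a a≤A = ≤-trans (*-monoʳ-≤ 208 (m≤n+∣n-m∣ (a * P) (ψ (a * z)))) (≤-trans (≤-reflexive (*-distribˡ-+ 208 (ψ (a * z)) _)) (+-monoʳ-≤ (208 * ψ (a * z)) (scaling 1≤a a≤A)))

    Az<s² : ∀ {y} → y ≤ A * z → y < suc s * suc s
    Az<s² y≤ = ≤-<-trans y≤ (proj₂ (isqrt-spec (A * z)))

    next : ∀ i → i * z + z ≡ suc i * z
    next i = +-comm (i * z) z

    window-lower : ∀ i → 1 ≤ i → suc i ≤ A → 208 * P ≤ 208 * (L * (count (i * z) z + s)) + 2 * (S * z)
    window-lower i 1≤i i<A = by-lin (+-mono-≤ (scaling-lower {suc i} (s≤s z≤n) i<A) (+-mono-≤ (scaling-upper 1≤i (<⇒≤ i<A)) (*-monoʳ-≤ 208 upper)))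
       (≤-reflexive (r (ψ (suc i * z)) (S * z) i P (ψ (i * z)) L (count (i * z) z) s (π (i * z))))
      where
      upper : ψ (suc i * z) + L * π (i * z) ≤ ψ (i * z) + L * (π (i * z) + count (i * z) z + s)
      upper = subst (λ t → ψ (suc i * z) + L * π (i * z) ≤ ψ (i * z) + L * (t + s)) (trans (cong π (sym (next i))) (π-count (i * z) z))
        (ψ-count-upper {i * z} {suc i * z} {l} {s} (*-monoˡ-≤ z (n≤1+n i)) (az≤B i<A) (≤-trans (*-monoˡ-≤ z i<A) Az≤) (Az<s² (*-monoˡ-≤ z i<A)))
      r : ∀ y Z i P x L c s p → 208 * y + Z + (208 * (i * P) + Z + 208 * (x + L * (p + c + s))) + 208 * P
         ≡ 208 * (suc i * P) + (208 * x + 208 * (y + L * p)) + (208 * (L * (c + s)) + 2 * Z)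
      r y Z i P x L c s p = r′ 208 y Z i P x L c s p
        where
        r′ : ∀ u y Z i P x L c s p → u * y + Z + (u * (i * P) + Z + u * (x + L * (p + c + s))) + u * P
           ≡ u * (suc i * P) + (u * x + u * (y + L * p)) + (u * (L * (c + s)) + 2 * Z)
        r′ = solve-∀

    window-upper : ∀ i → 1 ≤ i → suc i ≤ A → 208 * (S * e * count (i * z) z) ≤ 208 * P + 2 * (S * z)
    window-upper i 1≤i i<A = by-lin (+-mono-≤ (scaling-upper {suc i} (s≤s z≤n) i<A) (+-mono-≤ (scaling-lower 1≤i (<⇒≤ i<A)) (*-monoʳ-≤ 208 lower)))
       (≤-reflexive (r 208 (ψ (suc i * z)) (S * z) i P (ψ (i * z)) (S * e) (count (i * z) z) (π (i * z))))
      where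
      z≤iz : z ≤ i * z
      z≤iz = m≤n*m z i {{>-nonZero 1≤i}}
      lower : ψ (i * z) + S * e * (π (i * z) + count (i * z) z) ≤ ψ (suc i * z) + S * e * π (i * z)
      lower = subst (λ t → ψ (i * z) + S * e * t ≤ ψ (suc i * z) + S * e * π (i * z)) (trans (cong π (sym (next i))) (π-count (i * z) z))
        (ψ-count-lower {i * z} {suc i * z} {S * e} (*-monoˡ-≤ z (n≤1+n i)) (az≤B i<A) (λ p _ x<p _ → ℓₚ≥ {p} {e} (≤-trans (proj₁ z-spec) (≤-trans z≤iz (<⇒≤ x<p)))))
      r : ∀ u y Z i P x m c p → u * (suc i * P) + Z + (u * x + Z + u * (y + m * p)) + u * (m * c)
         ≡ u * y + (u * (i * P) + u * (x + m * (p + c))) + (u * P + 2 * Z)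
      r = solve-∀

    -- In a window ψ grows by P up to errors: `scaling` costs 2 S z / 208 ≤ P / 13, prime powers
    -- cost S z / 32 ≤ P / 4, and the logarithms e and l differ by a factor of at most 5 / 4. Then
    -- (14 / 13) · (5 / 4) / (12 / 13 - 1 / 4) = 2, so 208 is just enough.
    equidistributed : ∀ i j → 1 ≤ i → suc i ≤ A → 1 ≤ j → suc j ≤ A → count (j * z) z ≤ 2 * count (i * z) z
    equidistributed i j 1≤i i<A 1≤j j<A = *-cancelˡ-≤ (208 * (5 * (S * e))) {{>-nonZero (1≤* {208} (s≤s z≤n) (1≤* {5} (s≤s z≤n) (1≤* 1≤S 1≤e)))}}
      (by-lin (+-mono-≤ (*-monoʳ-≤ 5 (window-upper j 1≤j j<A)) (+-mono-≤ (*-monoʳ-≤ 8 (window-lower i 1≤i i<A))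
        (+-mono-≤ (*-monoʳ-≤ 52 (*-monoʳ-≤ S 32ls≤z)) (+-mono-≤ (*-monoʳ-≤ 78 P-large) (*-monoʳ-≤ (416 * (S * c_i)) 4l≤5e)))))
        (≤-reflexive (r P S l c_i s e c_j z)))
      where
      c_i = count (i * z) z
      c_j = count (j * z) z
      1≤e : 1 ≤ e
      1≤e = ≤-trans 1≤h (≤-trans (m≤n*m h 2) 2h≤e)
      r : ∀ P S l c s e d z → 5 * (208 * P + 2 * (S * z)) + (8 * (208 * (S * l * (c + s)) + 2 * (S * z)) + (52 * (S * z) + (78 * (8 * P) + 416 * (S * c) * (5 * e)))) + 208 * (5 * (S * e)) * d
        ≡ 5 * (208 * (S * e * d)) + (8 * (208 * P) + (52 * (S * (32 * (l * s))) + (78 * (S * z) + 416 * (S * c) * (4 * l)))) + 208 * (5 * (S * e)) * (2 * c)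
      r = solve-∀

    h≤e : h ≤ e
    h≤e = ≤-trans (m≤n*m h 2) 2h≤e
    x₀≤z : x₀ ≤ z
    x₀≤z = ≤-trans (^-monoʳ-≤ 2 h≤e) (proj₁ z-spec)

    π-z : S * h * π z ≤ P + S * (h * x₀)
    π-z = by-lin (+-mono-≤ (ψ-count-lower {x₀} {z} {S * h} x₀≤z z≤B (λ p _ x<p _ → ℓₚ≥ {p} {h} (<⇒≤ x<p))) (*-monoʳ-≤ (S * h) (π≤ x₀)))
      (≤-trans (m≤m+n _ (ψ x₀)) (≤-reflexive (r P (S * h) (π x₀) (π z) S h x₀ (ψ x₀))))
      where
      r : ∀ P m a b S h x y → P + m * a + S * h * x + m * b + y ≡ y + m * b + m * a + (P + S * (h * x))
      r = solve-∀

    top-windows : 208 * (S * h * π ((4 + Q′) * z)) ≤ 208 * (S * h * π ((1 + Q′) * z)) + 624 * P + 2 * (S * z)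
    top-windows = by-lin (+-mono-≤ (*-monoʳ-≤ 208 (ψ-count-lower {(1 + Q′) * z} {(4 + Q′) * z} {S * h} (*-monoˡ-≤ z (+-monoˡ-≤ Q′ {1} {4} (s≤s z≤n))) (az≤B 4+Q′≤A)
        (λ p _ x<p _ → ℓₚ≥ {p} {h} (≤-trans (≤-trans (^-monoʳ-≤ 2 h≤e) (proj₁ z-spec)) (≤-trans (m≤m+n z (Q′ * z)) (<⇒≤ x<p))))))
        (+-mono-≤ (scaling-upper {4 + Q′} (s≤s z≤n) 4+Q′≤A) (scaling-lower {1 + Q′} (s≤s z≤n) (≤-trans (+-monoˡ-≤ Q′ {1} {4} (s≤s z≤n)) 4+Q′≤A))))
      (≤-reflexive (r (ψ ((1 + Q′) * z)) (ψ ((4 + Q′) * z)) (S * h * π ((4 + Q′) * z)) (S * h * π ((1 + Q′) * z)) Q′ P (S * z)))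
      where
      4+Q′≤A : 4 + Q′ ≤ A
      4+Q′≤A = ≤-trans (≤-reflexive (+-comm 1 Q)) (+-monoʳ-≤ Q {1} {Q + 0} (s≤s z≤n))
      r : ∀ x y a b q P Z → 208 * (y + b) + (208 * ((4 + q) * P) + Z + (208 * x + Z)) + 208 * a
        ≡ 208 * (x + a) + (208 * y + 208 * ((1 + q) * P)) + (208 * b + 624 * P + 2 * Z)
      r = solve-∀

    -- Lost are the primes up to z, those in the three windows of ((1 + Q′) z, (4 + Q′) z], and one
    -- per window for parity, counted by Q. The four windows hold at most about 4 P / (S h) primes,
    -- against at least about (3 + Q′) P / (S l) up to Q z.
    few-lost : k * (Q + π z + π ((4 + Q′) * z)) ≤ 2 * π (Q * z) + k * π ((1 + Q′) * z)
    few-lost = subst (λ u → k * (Q + π z + u) ≤ 2 * pQ + k * π ((1 + Q′) * z)) (sym πt)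
      (*-cancelˡ-≤ (208 * L) {{>-nonZero (1≤* {208} (s≤s z≤n) (1≤* 1≤S 1≤l))}} (by-lin hyps cert))
      where
      1≤l : 1 ≤ l
      1≤l = ≤-trans (m≤n+m 1 e) (m≤m+n (e + 1) (2 * Q))
      t = count ((1 + Q′) * z) (3 * z)
      πt : π ((4 + Q′) * z) ≡ π ((1 + Q′) * z) + t
      πt = trans (cong π (r Q′ z)) (π-count ((1 + Q′) * z) (3 * z))
        where
        r : ∀ q z → (4 + q) * z ≡ (1 + q) * z + 3 * z
        r = solve-∀
      ψQ : ψ (Q * z) ≤ L * (π (Q * z) + s)
      ψQ = by-lin (ψ-count-upper {0} {Q * z} {l} {s} z≤n (az≤B Q≤A) (≤-trans (*-monoˡ-≤ z Q≤A) Az≤) (Az<s² (*-monoˡ-≤ z Q≤A)))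
        (≤-trans (≤-reflexive (cong (λ u → u + L * (π (Q * z) + s) + ψ (Q * z)) ψ-0)) (≤-trans (≤-reflexive (+-comm (L * (π (Q * z) + s)) (ψ (Q * z)))) (+-monoˡ-≤ (L * (π (Q * z) + s)) (m≤m+n (ψ (Q * z)) (L * π 0)))))
        where
        Q≤A : Q ≤ A
        Q≤A = m≤m+n Q (Q + 0)
      lost : 208 * (S * h * (π z + t)) ≤ 832 * P + 208 * (S * (h * x₀)) + 2 * (S * z)
      lost = by-lin (+-mono-≤ (*-monoʳ-≤ 208 π-z) (subst (λ u → 208 * (S * h * u) ≤ 208 * (S * h * π ((1 + Q′) * z)) + 624 * P + 2 * (S * z)) πt top-windows))
        (≤-reflexive (r P (S * (h * x₀)) (S * h) (π z) (π ((1 + Q′) * z)) t (S * z)))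
        where
        r : ∀ P X m a b t Z → 208 * (P + X) + (208 * (m * b) + 624 * P + 2 * Z) + 208 * (m * (a + t))
          ≡ 208 * (m * a) + 208 * (m * (b + t)) + (832 * P + 208 * X + 2 * Z)
        r = solve-∀
      Q≤A : Q ≤ A
      Q≤A = m≤m+n Q (Q + 0)
      hyps = +-mono-≤ (*-monoʳ-≤ (4 * k) lost) (+-mono-≤ (*-monoʳ-≤ (208 * S * k * (π z + t)) l≤4h)
        (+-mono-≤ (*-monoʳ-≤ 416 ψQ) (+-mono-≤ (*-monoʳ-≤ 2 (scaling-lower {Q} (s≤s z≤n) Q≤A))
        (+-mono-≤ (*-monoʳ-≤ (8 * k + 2) P-large) (+-mono-≤ (*-monoʳ-≤ (26 * S) small-terms) (*-monoʳ-≤ 26 P-large))))))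
      pQ = π (Q * z)
      cert = (≤-trans (m≤m+n _ (4928 * k * P + 1024 * P))
          (≤-reflexive (r P S l h x₀ z k (π z) t pQ s (ψ (Q * z)) (π ((1 + Q′) * z)))))
        where
        r : ∀ P S l h x z k a t p s y b →
          4 * k * (832 * P + 208 * (S * (h * x)) + 2 * (S * z)) + (208 * S * k * (a + t) * (4 * h) + (416 * (S * l * (p + s)) + (2 * (208 * y + S * z) + ((8 * k + 2) * (8 * P) + (26 * S * z + 26 * (8 * P))))))
            + 208 * (S * l) * (k * (3 + 20 * k + a + (b + t))) + (4928 * k * P + 1024 * P)
          ≡ 4 * k * (208 * (S * h * (a + t))) + (208 * S * k * (a + t) * l + (416 * y + (2 * (208 * ((3 + 20 * k) * P)) + ((8 * k + 2) * (S * z) + (26 * S * (8 * (4 * (k * (h * x)) + l * (k * (3 + 20 * k)) + 2 * (l * s))) + 26 * (S * z))))))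
            + 208 * (S * l) * (2 * p + k * b)
        r = solve-∀

-- Products of primes with distinct subset products

bit : Bool → ℕ
bit false = 0
bit true = 1

bit≤1 : ∀ b → bit b ≤ 1
bit≤1 false = z≤n
bit≤1 true = ≤-refl

bit-injective : ∀ b c → bit b ≡ bit c → b ≡ c
bit-injective false false _ = refl
bit-injective true true _ = refl

Injective-products : ∀ {n} → Vec ℕ n → Set
Injective-products {n} A = (B C : Subset n) → prodSub A B ≡ prodSub A C → B ≡ C

Avoids : ℕ → List ℕ → Set
Avoids p xs = ∀ a → a ∈ xs → ¬ p ∣ a

Positive : List ℕ → Set
Positive xs = ∀ a → a ∈ xs → 1 ≤ a

select : Bool → ℕ → ℕ
select b a = if b then a else 1

select-positive : ∀ b {a} → 1 ≤ a → 1 ≤ select b a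
select-positive false _ = ≤-refl
select-positive true h = h

select-valuation : ∀ p b a → valuation p (select b a) ≡ bit b * valuation p a
select-valuation p false a = additive-1 (λ q → ⟦ p ≟ q ⟧)
select-valuation p true a = sym (*-identityˡ _)

prodSub-positive : ∀ xs → Positive xs → ∀ B → 1 ≤ prodSub (fromList xs) B
prodSub-positive [] _ [] = ≤-refl
prodSub-positive (x ∷ xs) h (b ∷ B) = 1≤* (select-positive b (h x (here refl))) (prodSub-positive xs (λ a i → h a (there i)) B)

prodSub-valuation : ∀ p x xs → Positive (x ∷ xs) → ∀ b B →
  valuation p (prodSub (fromList (x ∷ xs)) (b ∷ B)) ≡ bit b * valuation p x + valuation p (prodSub (fromList xs) B)
prodSub-valuation p x xs h b B = trans (additive-* _ (select-positive b (h x (here refl))) (prodSub-positive xs (λ a i → h a (there i)) B))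
  (cong (_+ valuation p (prodSub (fromList xs) B)) (select-valuation p b x))

prodSub-avoids : ∀ {p} → Prime p → ∀ xs → Positive xs → Avoids p xs → ∀ B → valuation p (prodSub (fromList xs) B) ≡ 0
prodSub-avoids {p} pp [] _ _ [] = additive-1 (λ q → ⟦ p ≟ q ⟧)
prodSub-avoids {p} pp (x ∷ xs) h av (b ∷ B) = trans (prodSub-valuation p x xs h b B)
  (cong₂ _+_ (trans (cong (bit b *_) (valuation-∤ pp x (h x (here refl)) (av x (here refl)))) (*-zeroʳ (bit b)))
    (prodSub-avoids pp xs (λ a i → h a (there i)) (λ a i → av a (there i)) B))

select-cancel : ∀ b {a X Y} → 1 ≤ a → select b a * X ≡ select b a * Y → X ≡ Y
select-cancel b {a} {X} {Y} h = *-cancelˡ-≡ X Y (select b a) {{>-nonZero (select-positive b h)}}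

∷-positive : ∀ {x xs} → 1 ≤ x → Positive xs → Positive (x ∷ xs)
∷-positive h k a (here refl) = h
∷-positive h k a (there i) = k a i

-- The exponent of p in a subset product tells whether p was selected; then p cancels.
injective-single : ∀ {p} xs → Prime p → Positive xs → Avoids p xs → Injective-products (fromList xs) → Injective-products (fromList (p ∷ xs))
injective-single {p} xs pp h av inj (b ∷ B) (c ∷ C) eq with bit-injective b c (trans (sym (val b B)) (trans (cong (valuation p) eq) (val c C)))
  where
  val : ∀ b B → valuation p (prodSub (fromList (p ∷ xs)) (b ∷ B)) ≡ bit b
  val b B = trans (prodSub-valuation p p xs (∷-positive (prime≥1 pp) h) b B)
    (trans (cong₂ _+_ (trans (cong (bit b *_) (valuation-self pp)) (*-identityʳ (bit b))) (prodSub-avoids pp xs h av B)) (+-identityʳ (bit b)))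
... | refl = cong (b ∷_) (inj B C (select-cancel b (prime≥1 pp) eq))

quad : ℕ → ℕ → ℕ → List ℕ → List ℕ
quad p q r xs = p ∷ p * q ∷ p * r ∷ q * r ∷ xs

-- The exponents of q and r force ε₂ = ε₃ = - ε₄ in a relation among p, p q, p r, q r, and then the exponent of p
-- forces ε₁ = 2 ε₄.
quad-bits : ∀ b₁ b₂ b₃ b₄ c₁ c₂ c₃ c₄ → bit b₁ + (bit b₂ + bit b₃) ≡ bit c₁ + (bit c₂ + bit c₃) →
  bit b₂ + bit b₄ ≡ bit c₂ + bit c₄ → bit b₃ + bit b₄ ≡ bit c₃ + bit c₄ → b₁ ≡ c₁ × b₂ ≡ c₂ × b₃ ≡ c₃ × b₄ ≡ c₄
quad-bits b₁ b₂ b₃ b₄ c₁ c₂ c₃ c₄ = cases b₄ c₄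
  where
  same : ∀ d → bit b₁ + (bit b₂ + bit b₃) ≡ bit c₁ + (bit c₂ + bit c₃) → bit b₂ + bit d ≡ bit c₂ + bit d → bit b₃ + bit d ≡ bit c₃ + bit d →
    b₁ ≡ c₁ × b₂ ≡ c₂ × b₃ ≡ c₃ × d ≡ d
  same d e₁ e₂ e₃ with bit-injective b₂ c₂ (+-cancelʳ-≡ (bit d) (bit b₂) (bit c₂) e₂) | bit-injective b₃ c₃ (+-cancelʳ-≡ (bit d) (bit b₃) (bit c₃) e₃)
  ... | refl | refl = bit-injective b₁ c₁ (+-cancelʳ-≡ (bit b₂ + bit b₃) (bit b₁) (bit c₁) e₁) , refl , refl , refl
  clash : ∀ x₁ x₂ x₃ y₁ y₂ y₃ → x₁ ≤ 1 → x₁ + (x₂ + x₃) ≡ y₁ + (y₂ + y₃) → x₂ + 1 ≡ y₂ → x₃ + 1 ≡ y₃ → ⊥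
  clash x₁ x₂ x₃ y₁ _ _ x₁≤1 e refl refl = <⇒≱ (s≤s (s≤s z≤n)) (≤-trans (≤-trans (m≤n+m 2 y₁) (≤-reflexive (sym (+-cancelʳ-≡ (x₂ + x₃) x₁ (y₁ + 2) (trans e (r y₁ x₂ x₃)))))) x₁≤1)
    where
    r : ∀ y a b → y + (a + 1 + (b + 1)) ≡ y + 2 + (a + b)
    r = solve-∀
  cases : ∀ b₄ c₄ → bit b₁ + (bit b₂ + bit b₃) ≡ bit c₁ + (bit c₂ + bit c₃) → bit b₂ + bit b₄ ≡ bit c₂ + bit c₄ → bit b₃ + bit b₄ ≡ bit c₃ + bit c₄ →
    b₁ ≡ c₁ × b₂ ≡ c₂ × b₃ ≡ c₃ × b₄ ≡ c₄
  cases false false = same false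
  cases true true = same true
  cases true false e₁ e₂ e₃ = ⊥-elim (clash (bit b₁) (bit b₂) (bit b₃) (bit c₁) (bit c₂) (bit c₃) (bit≤1 b₁) e₁ (trans e₂ (+-identityʳ _)) (trans e₃ (+-identityʳ _)))
  cases false true e₁ e₂ e₃ = ⊥-elim (clash (bit c₁) (bit c₂) (bit c₃) (bit b₁) (bit b₂) (bit b₃) (bit≤1 c₁) (sym e₁) (trans (sym e₂) (+-identityʳ _)) (trans (sym e₃) (+-identityʳ _)))

valuation-other : ∀ {p q} → Prime p → Prime q → p ≢ q → valuation p q ≡ 0
valuation-other {p} {q} pp pq p≢q = trans (additive-prime _ pq) (⟦⟧-false (p ≟ q) p≢q)

quad-positive : ∀ {p q r xs} → 1 ≤ p → 1 ≤ q → 1 ≤ r → Positive xs → Positive (quad p q r xs)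
quad-positive a b c h = ∷-positive a (∷-positive (1≤* a b) (∷-positive (1≤* a c) (∷-positive (1≤* b c) h)))

-- As the rest avoids p, q, r, their exponents are b₁ + b₂ + b₃, b₂ + b₄ and b₃ + b₄; by `quad-bits`
-- these determine the four choices.
injective-quad : ∀ {p q r} xs → Prime p → Prime q → Prime r → p ≢ q → p ≢ r → q ≢ r → Positive xs → Avoids p xs → Avoids q xs → Avoids r xs →
  Injective-products (fromList xs) → Injective-products (fromList (quad p q r xs))
injective-quad {p} {q} {r} xs pp pq pr p≢q p≢r q≢r h avp avq avr inj (b₁ ∷ b₂ ∷ b₃ ∷ b₄ ∷ B) (c₁ ∷ c₂ ∷ c₃ ∷ c₄ ∷ C) eq
  with quad-bits b₁ b₂ b₃ b₄ c₁ c₂ c₃ c₄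
    (trans (sym (val-p b₁ b₂ b₃ b₄ B)) (trans (cong (valuation p) eq) (val-p c₁ c₂ c₃ c₄ C)))
    (trans (sym (val-q b₁ b₂ b₃ b₄ B)) (trans (cong (valuation q) eq) (val-q c₁ c₂ c₃ c₄ C)))
    (trans (sym (val-r b₁ b₂ b₃ b₄ B)) (trans (cong (valuation r) eq) (val-r c₁ c₂ c₃ c₄ C)))
  where
  1≤p = prime≥1 pp
  1≤q = prime≥1 pq
  1≤r = prime≥1 pr
  general : ∀ s → Prime s → Avoids s xs → ∀ b₁ b₂ b₃ b₄ B → valuation s (prodSub (fromList (quad p q r xs)) (b₁ ∷ b₂ ∷ b₃ ∷ b₄ ∷ B))
    ≡ bit b₁ * valuation s p + (bit b₂ * (valuation s p + valuation s q) + (bit b₃ * (valuation s p + valuation s r) + (bit b₄ * (valuation s q + valuation s r) + 0)))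
  general s ps av b₁ b₂ b₃ b₄ B =
    trans (prodSub-valuation s p _ (quad-positive 1≤p 1≤q 1≤r h) b₁ (b₂ ∷ b₃ ∷ b₄ ∷ B)) (cong (_+_ (bit b₁ * valuation s p))
    (trans (prodSub-valuation s (p * q) _ (∷-positive (1≤* 1≤p 1≤q) (∷-positive (1≤* 1≤p 1≤r) (∷-positive (1≤* 1≤q 1≤r) h))) b₂ (b₃ ∷ b₄ ∷ B)) (cong₂ _+_ (cong (bit b₂ *_) (additive-* _ 1≤p 1≤q))
    (trans (prodSub-valuation s (p * r) _ (∷-positive (1≤* 1≤p 1≤r) (∷-positive (1≤* 1≤q 1≤r) h)) b₃ (b₄ ∷ B)) (cong₂ _+_ (cong (bit b₃ *_) (additive-* _ 1≤p 1≤r))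
    (trans (prodSub-valuation s (q * r) _ (∷-positive (1≤* 1≤q 1≤r) h) b₄ B) (cong₂ _+_ (cong (bit b₄ *_) (additive-* _ 1≤q 1≤r)) (prodSub-avoids ps xs h av B))))))))
  val-p : ∀ b₁ b₂ b₃ b₄ B → valuation p (prodSub (fromList (quad p q r xs)) (b₁ ∷ b₂ ∷ b₃ ∷ b₄ ∷ B)) ≡ bit b₁ + (bit b₂ + bit b₃)
  val-p b₁ b₂ b₃ b₄ B = trans (general p pp avp b₁ b₂ b₃ b₄ B) (trans (subst₂ (λ u v → bit b₁ * valuation p p + (bit b₂ * (valuation p p + u) + (bit b₃ * (valuation p p + v) + (bit b₄ * (u + v) + 0))) ≡ bit b₁ * valuation p p + (bit b₂ * valuation p p + bit b₃ * valuation p p))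
      (sym (valuation-other pp pq p≢q)) (sym (valuation-other pp pr p≢r)) (r₀ (bit b₁) (bit b₂) (bit b₃) (bit b₄) (valuation p p)))
    (trans (cong (λ t → bit b₁ * t + (bit b₂ * t + bit b₃ * t)) (valuation-self pp)) (r₁ (bit b₁) (bit b₂) (bit b₃))))
    where
    r₀ : ∀ a b c d v → a * v + (b * (v + 0) + (c * (v + 0) + (d * 0 + 0))) ≡ a * v + (b * v + c * v)
    r₀ = solve-∀
    r₁ : ∀ a b c → a * 1 + (b * 1 + c * 1) ≡ a + (b + c)
    r₁ = solve-∀
  val-q : ∀ b₁ b₂ b₃ b₄ B → valuation q (prodSub (fromList (quad p q r xs)) (b₁ ∷ b₂ ∷ b₃ ∷ b₄ ∷ B)) ≡ bit b₂ + bit b₄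
  val-q b₁ b₂ b₃ b₄ B = trans (general q pq avq b₁ b₂ b₃ b₄ B) (trans (cong₂ (λ u v → bit b₁ * u + (bit b₂ * (u + valuation q q) + (bit b₃ * (u + v) + (bit b₄ * (valuation q q + v) + 0))))
      (valuation-other pq pp (p≢q ∘ sym)) (valuation-other pq pr q≢r)) (trans (cong (λ t → bit b₁ * 0 + (bit b₂ * (0 + t) + (bit b₃ * 0 + (bit b₄ * (t + 0) + 0)))) (valuation-self pq)) (r₁ (bit b₁) (bit b₂) (bit b₃) (bit b₄))))
    where
    r₁ : ∀ a b c d → a * 0 + (b * 1 + (c * 0 + (d * 1 + 0))) ≡ b + d
    r₁ = solve-∀
  val-r : ∀ b₁ b₂ b₃ b₄ B → valuation r (prodSub (fromList (quad p q r xs)) (b₁ ∷ b₂ ∷ b₃ ∷ b₄ ∷ B)) ≡ bit b₃ + bit b₄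
  val-r b₁ b₂ b₃ b₄ B = trans (general r pr avr b₁ b₂ b₃ b₄ B) (trans (cong₂ (λ u v → bit b₁ * u + (bit b₂ * (u + v) + (bit b₃ * (u + valuation r r) + (bit b₄ * (v + valuation r r) + 0))))
      (valuation-other pr pp (p≢r ∘ sym)) (valuation-other pr pq (q≢r ∘ sym))) (trans (cong (λ t → bit b₁ * 0 + (bit b₂ * 0 + (bit b₃ * (0 + t) + (bit b₄ * (0 + t) + 0)))) (valuation-self pr)) (r₁ (bit b₁) (bit b₂) (bit b₃) (bit b₄))))
    where
    r₁ : ∀ a b c d → a * 0 + (b * 0 + (c * 1 + (d * 1 + 0))) ≡ c + d
    r₁ = solve-∀
... | refl , refl , refl , refl = cong (λ D → b₁ ∷ b₂ ∷ b₃ ∷ b₄ ∷ D) (inj B C (select-cancel b₄ (1≤* (prime≥1 pq) (prime≥1 pr)) (select-cancel b₃ (1≤* (prime≥1 pp) (prime≥1 pr))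
      (select-cancel b₂ (1≤* (prime≥1 pp) (prime≥1 pq)) (select-cancel b₁ (prime≥1 pp) eq)))))

Triple : Set
Triple = ℕ × ℕ × ℕ

flat : List Triple → List ℕ
flat [] = []
flat ((p , q , r) ∷ ts) = p ∷ q ∷ r ∷ flat ts

quads : List Triple → List ℕ → List ℕ
quads [] ss = ss
quads ((p , q , r) ∷ ts) ss = quad p q r (quads ts ss)

prime∣product₂ : ∀ {x p q} → Prime x → Prime p → Prime q → x ∣ p * q → x ≡ p ⊎ x ≡ q
prime∣product₂ {x} {p} {q} px pp pq d with euclidsLemma p q px d
... | inj₁ e = inj₁ (prime∣prime px pp e)
... | inj₂ e = inj₂ (prime∣prime px pq e)

quads-avoid : ∀ {x} → Prime x → ∀ ts ss → LAll.All Prime (flat ts ++ ss) → x ∉ flat ts ++ ss → Avoids x (quads ts ss)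
quads-avoid {x} px [] ss ap x∉ a a∈ d = x∉ (subst (_∈ ss) (sym (prime∣prime px (LAll.lookup ap a∈) d)) a∈)
quads-avoid {x} px ((p , q , r) ∷ ts) ss (pp ∷ pq ∷ pr ∷ ap) x∉ = go
  where
  go : Avoids x (quad p q r (quads ts ss))
  go a (here refl) d = x∉ (here (prime∣prime px pp d))
  go a (there (here refl)) d with prime∣product₂ px pp pq d
  ... | inj₁ e = x∉ (here e)
  ... | inj₂ e = x∉ (there (here e))
  go a (there (there (here refl))) d with prime∣product₂ px pp pr d
  ... | inj₁ e = x∉ (here e)
  ... | inj₂ e = x∉ (there (there (here e)))
  go a (there (there (there (here refl)))) d with prime∣product₂ px pq pr d
  ... | inj₁ e = x∉ (there (here e))
  ... | inj₂ e = x∉ (there (there (here e)))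
  go a (there (there (there (there i)))) d = quads-avoid px ts ss ap (λ j → x∉ (there (there (there j)))) a i d

quads-positive : ∀ ts ss → LAll.All Prime (flat ts ++ ss) → Positive (quads ts ss)
quads-positive [] ss ap a a∈ = prime≥1 (LAll.lookup ap a∈)
quads-positive ((p , q , r) ∷ ts) ss (pp ∷ pq ∷ pr ∷ ap) = quad-positive (prime≥1 pp) (prime≥1 pq) (prime≥1 pr) (quads-positive ts ss ap)

quads-injective : ∀ ts ss → LAll.All Prime (flat ts ++ ss) → Unique (flat ts ++ ss) → Injective-products (fromList (quads ts ss))
quads-injective [] [] _ _ [] [] _ = refl
quads-injective [] (s ∷ ss) (ps ∷ ap) (s∉ ∷ u) = injective-single ss ps (λ a i → prime≥1 (LAll.lookup ap i))
  (quads-avoid ps [] ss ap (λ i → LAll.lookup s∉ i refl)) (quads-injective [] ss ap u)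
quads-injective ((p , q , r) ∷ ts) ss (pp ∷ pq ∷ pr ∷ ap) (p∉@(p≢q ∷ p≢r ∷ p∉′) ∷ (q≢r ∷ q∉′) ∷ r∉′ ∷ u) =
  injective-quad (quads ts ss) pp pq pr p≢q p≢r q≢r (quads-positive ts ss ap)
    (quads-avoid pp ts ss ap (λ i → LAll.lookup p∉′ i refl)) (quads-avoid pq ts ss ap (λ i → LAll.lookup q∉′ i refl)) (quads-avoid pr ts ss ap (λ i → LAll.lookup r∉′ i refl))
    (quads-injective ts ss ap u)

squareFree : ∀ {n} → 1 ≤ n → (∀ q → Prime q → ¬ q * q ∣ n) → SquareFree n
squareFree {suc n} _ h zero d = contradiction (0∣⇒≡0 d) λ ()
squareFree _ h (suc zero) d = refl
squareFree _ h (suc (suc m)) d = let q , pq , q∣ = prime-divisor (suc (suc m)) (s≤s (s≤s z≤n)) in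
  contradiction (∣-trans (*-pres-∣ q∣ q∣) d) (h q pq)

squareFree-prime : ∀ {p} → Prime p → ∀ q → Prime q → ¬ q * q ∣ p
squareFree-prime {p} pp q pq d = prime∤1 pq (∣-trans (m∣m*n q) (square∣prime* pp pq (prime∤1 pp) (subst (q * q ∣_) (sym (*-identityʳ p)) d)))

squareFree-prime² : ∀ {p p′} → Prime p → Prime p′ → p ≢ p′ → ∀ q → Prime q → ¬ q * q ∣ p * p′
squareFree-prime² pp pp′ p≢ q pq d = squareFree-prime pp′ q pq (square∣prime* pp pq (λ e → p≢ (prime∣prime pp pp′ e)) d)

Fits : ℕ → Triple → Set
Fits N (p , q , r) = p * q ≤ N × p * r ≤ N × q * r ≤ N

quads-admissible : ∀ {N} ts ss → LAll.All Prime (flat ts ++ ss) → Unique (flat ts ++ ss) → (∀ t → t ∈ ts → Fits N t) → (∀ s → s ∈ ss → s ≤ N) →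
  All (Admissible N) (fromList (quads ts ss))
quads-admissible [] [] _ _ _ _ = []
quads-admissible [] (s ∷ ss) (ps ∷ ap) (_ ∷ u) ft fs = ((prime≥1 ps , fs s (here refl)) , squareFree (prime≥1 ps) (squareFree-prime ps)) ∷
  quads-admissible [] ss ap u ft (λ x i → fs x (there i))
quads-admissible {N} ((p , q , r) ∷ ts) ss (pp ∷ pq ∷ pr ∷ ap) ((p≢q ∷ p≢r ∷ _) ∷ (q≢r ∷ _) ∷ _ ∷ u) ft fs =
  ((prime≥1 pp , ≤-trans (m≤m*n p q {{prime⇒nonZero pq}}) f₁) , squareFree (prime≥1 pp) (squareFree-prime pp)) ∷
  two pp pq p≢q f₁ ∷ two pp pr p≢r f₂ ∷ two pq pr q≢r f₃ ∷ quads-admissible ts ss ap u (λ t i → ft t (there i)) fs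
  where
  f = ft (p , q , r) (here refl)
  f₁ = proj₁ f
  f₂ = proj₁ (proj₂ f)
  f₃ = proj₂ (proj₂ f)
  two : ∀ {x y} → Prime x → Prime y → x ≢ y → x * y ≤ N → Admissible N (x * y)
  two px py x≢y le = (1≤* (prime≥1 px) (prime≥1 py) , le) , squareFree (1≤* (prime≥1 px) (prime≥1 py)) (squareFree-prime² px py x≢y)

length-quads : ∀ ts ss → length (quads ts ss) ≡ 4 * length ts + length ss
length-quads [] ss = refl
length-quads (t ∷ ts) ss rewrite length-quads ts ss = r (length ts) (length ss)
  where
  r : ∀ a b → suc (suc (suc (suc (4 * a + b)))) ≡ 4 * suc a + b
  r = solve-∀

length-flat : ∀ ts → length (flat ts) ≡ 3 * length ts
length-flat [] = refl
length-flat (t ∷ ts) rewrite length-flat ts = sym (*-suc 3 (length ts))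

flat-++ : ∀ ts us → flat (ts ++ us) ≡ flat ts ++ flat us
flat-++ [] us = refl
flat-++ ((p , q , r) ∷ ts) us = cong (λ l → p ∷ q ∷ r ∷ l) (flat-++ ts us)

-- Two primes of the first list use up one of the second. If the second is at least half as long, at
-- most one prime of the first stays unpaired (`length-triplesOf`).
triplesOf : List ℕ → List ℕ → List Triple
triplesOf (p ∷ q ∷ ps) (r ∷ rs) = (p , q , r) ∷ triplesOf ps rs
triplesOf _ _ = []

length-triplesOf : ∀ ps rs → length ps ≤ 2 * length rs + 1 → length ps ≤ 2 * length (triplesOf ps rs) + 1
length-triplesOf [] rs _ = z≤n
length-triplesOf (p ∷ []) rs _ = s≤s z≤n
length-triplesOf (p ∷ q ∷ ps) [] (s≤s ())
length-triplesOf (p ∷ q ∷ ps) (r ∷ rs) h = ≤-trans (s≤s (s≤s (length-triplesOf ps rs (≤-pred (≤-pred (≤-trans h (≤-reflexive (e (length rs)))))))))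
  (≤-reflexive (sym (e (length (triplesOf ps rs)))))
  where
  e : ∀ a → 2 * suc a + 1 ≡ suc (suc (2 * a + 1))
  e = solve-∀

∈-flat-triplesOf : ∀ {x} ps rs → x ∈ flat (triplesOf ps rs) → x ∈ ps ⊎ x ∈ rs
∈-flat-triplesOf (p ∷ q ∷ ps) (r ∷ rs) (here refl) = inj₁ (here refl)
∈-flat-triplesOf (p ∷ q ∷ ps) (r ∷ rs) (there (here refl)) = inj₁ (there (here refl))
∈-flat-triplesOf (p ∷ q ∷ ps) (r ∷ rs) (there (there (here refl))) = inj₂ (here refl)
∈-flat-triplesOf (p ∷ q ∷ ps) (r ∷ rs) (there (there (there i))) with ∈-flat-triplesOf ps rs i
... | inj₁ j = inj₁ (there (there j))
... | inj₂ j = inj₂ (there j)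

∈-triplesOf : ∀ {t} ps rs → t ∈ triplesOf ps rs → proj₁ t ∈ ps × proj₁ (proj₂ t) ∈ ps × proj₂ (proj₂ t) ∈ rs
∈-triplesOf (p ∷ q ∷ ps) (r ∷ rs) (here refl) = here refl , there (here refl) , here refl
∈-triplesOf (p ∷ q ∷ ps) (r ∷ rs) (there i) = let a , b , c = ∈-triplesOf ps rs i in there (there a) , there (there b) , there c

unique-triplesOf : ∀ ps rs → Unique ps → Unique rs → (∀ x → x ∈ ps → x ∉ rs) → Unique (flat (triplesOf ps rs))
unique-triplesOf [] rs _ _ _ = []
unique-triplesOf (p ∷ []) rs _ _ _ = []
unique-triplesOf (p ∷ q ∷ ps) [] _ _ _ = []
unique-triplesOf (p ∷ q ∷ ps) (r ∷ rs) ((p≢q ∷ p∉) ∷ q∉ ∷ up) (r∉ ∷ ur) dis =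
  (p≢q ∷ (λ { refl → dis p (here refl) (here refl) }) ∷ LAll.tabulate (λ i → λ { refl → fresh p∉ (λ j → dis p (here refl) (there j)) i })) ∷
  ((λ { refl → dis q (there (here refl)) (here refl) }) ∷ LAll.tabulate (λ i → λ { refl → fresh q∉ (λ j → dis q (there (here refl)) (there j)) i })) ∷
  LAll.tabulate (λ i → λ { refl → case ∈-flat-triplesOf ps rs i of λ { (inj₁ j) → dis r (there (there j)) (here refl) ; (inj₂ j) → LAll.lookup r∉ j refl } }) ∷
  unique-triplesOf ps rs up ur (λ x i j → dis x (there (there i)) (there j))
  where
  fresh : ∀ {x} → LAll.All (x ≢_) ps → x ∉ rs → x ∉ flat (triplesOf ps rs)
  fresh x∉ps x∉rs i with ∈-flat-triplesOf ps rs i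
  ... | inj₁ j = LAll.lookup x∉ps j refl
  ... | inj₂ j = x∉rs j

-- Counting elements and matching windows

occurrences≤1 : ∀ f {L : List ℕ} → Unique L → ∑ L (λ x → ⟦ x ≟ f ⟧) ≤ 1
occurrences≤1 f [] = z≤n
occurrences≤1 f {x ∷ L} (x∉ ∷ u) with x ≟ f
... | no _ = occurrences≤1 f u
... | yes refl = ≤-reflexive (cong suc (∑-zero L λ y y∈ → ⟦⟧-false (y ≟ x) λ { refl → LAll.lookup x∉ y∈ refl }))

-- As L has no repetitions, each f in F removes at most one of its entries.
length-removed : ∀ (F : List ℕ) {L} → Unique L → length L ≤ length (filter (λ x → ¬? (x ∈? F)) L) + length F
length-removed F {L} u = begin
  length L ≡⟨ sym (trans (∑-const L 1) (*-identityʳ (length L))) ⟩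
  ∑ L (λ _ → 1) ≤⟨ ∑-mono L (λ x → each x (x ∈? F)) ⟩
  ∑ L (λ x → ⟦ ¬? (x ∈? F) ⟧ + ∑ F (λ f → ⟦ x ≟ f ⟧)) ≡⟨ ∑-+ L _ _ ⟩
  ∑ L (λ x → ⟦ ¬? (x ∈? F) ⟧) + ∑ L (λ x → ∑ F (λ f → ⟦ x ≟ f ⟧)) ≡⟨ cong₂ _+_ (sym (length-filter (λ x → ¬? (x ∈? F)) L)) (∑-swap L F _) ⟩
  length (filter (λ x → ¬? (x ∈? F)) L) + ∑ F (λ f → ∑ L (λ x → ⟦ x ≟ f ⟧)) ≤⟨ +-monoʳ-≤ _ (≤-trans (∑-mono F (λ f → occurrences≤1 f u)) (≤-reflexive (trans (∑-const F 1) (*-identityʳ (length F))))) ⟩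
  length (filter (λ x → ¬? (x ∈? F)) L) + length F ∎
  where
  open ≤-Reasoning
  each : ∀ x (d : Dec (x ∈ F)) → 1 ≤ ⟦ ¬? d ⟧ + ∑ F (λ f → ⟦ x ≟ f ⟧)
  each x (no _) = s≤s z≤n
  each x (yes i) = ≤-trans (≤-reflexive (sym (⟦⟧-true (x ≟ x) refl))) (∈⇒≤∑ (λ f → ⟦ x ≟ f ⟧) i)

∑-upTo : ∀ n (g f : ℕ → ℕ) → ∑ (applyUpTo g (suc n)) f ≡ f (g 0) + ∑ (rng n) (λ i → f (g i))
∑-upTo zero g f = refl
∑-upTo (suc n) g f = cong (f (g 0) +_) (trans (∑-upTo n (g ∘ suc) f) (sym (∑-rng-suc n (λ i → f (g i)))))

primeCountSqrt-π : ∀ N → primeCountSqrt N ≡ π (isqrt N)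
primeCountSqrt-π N = begin
  primeCountSqrt N ≡⟨ length-filter (λ p → prime? p ×-dec (p * p ≤? N)) (upTo (suc N)) ⟩
  ∑ (upTo (suc N)) (λ p → ⟦ prime? p ×-dec (p * p ≤? N) ⟧) ≡⟨ ∑-upTo N id (λ p → ⟦ prime? p ×-dec (p * p ≤? N) ⟧) ⟩
  ⟦ prime? 0 ×-dec (0 ≤? N) ⟧ + ∑ (rng N) (λ p → ⟦ prime? p ×-dec (p * p ≤? N) ⟧) ≡⟨ cong₂ _+_ (⟦⟧-false (prime? 0 ×-dec (0 ≤? N)) (¬prime[0] ∘ proj₁))
      (∑-cong (rng N) λ p → sym (⟦⟧-× (prime? p) (p ≤? isqrt N) (prime? p ×-dec (p * p ≤? N)) (λ pp h → pp , ≤-trans (*-mono-≤ h h) (proj₁ (isqrt-spec N)))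
         (λ { (pp , h) → pp , ≤-pred (square-cancel-< (≤-<-trans h (proj₂ (isqrt-spec N)))) }))) ⟩
  ∑ (rng N) (λ p → ⟦ prime? p ⟧ * ⟦ p ≤? isqrt N ⟧) ≡⟨ Log.π-as-∑ N (isqrt≤ N) ⟩
  π (isqrt N) ∎
  where
  open ≡-Reasoning
  isqrt≤ : ∀ N → isqrt N ≤ N
  isqrt≤ N = ≤-trans (m≤m*m (isqrt N)) (proj₁ (isqrt-spec N))
    where
    m≤m*m : ∀ m → m ≤ m * m
    m≤m*m zero = z≤n
    m≤m*m (suc m) = m≤m*n (suc m) (suc m)
  square-cancel-< : ∀ {a b} → a * a < b * b → a < b
  square-cancel-< {a} {b} h with a <? b
  ... | yes p = p
  ... | no p = contradiction h (≤⇒≯ (*-mono-≤ (≮⇒≥ p) (≮⇒≥ p)))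

-- Windows j and i with i + j + 2 = 2 Q satisfy (j + 1)(i + 1) ≤ Q², so the product of their elements is at most N.
module Matching (k Q′ N z : ℕ) (Qz≤M : (3 + Q′) * z ≤ isqrt N) (M≤ : isqrt N ≤ (4 + Q′) * z)
  (equidistributed : ∀ i j → 1 ≤ i → suc i ≤ 2 * (3 + Q′) → 1 ≤ j → suc j ≤ 2 * (3 + Q′) → count (j * z) z ≤ 2 * count (i * z) z)
  (few-lost : k * (3 + Q′ + π z + π ((4 + Q′) * z)) ≤ 2 * π ((3 + Q′) * z) + k * π ((1 + Q′) * z)) where
  open ≤-Reasoning

  Q M : ℕ
  Q = 3 + Q′
  M = isqrt N

  partner : ℕ → ℕ
  partner j = suc (Q + Q′) ∸ j

  window : ℕ → List ℕ
  window i = primesIn (i * z) z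

  triples : ℕ → List Triple
  triples j = triplesOf (window j) (window (partner j))

  collect : ℕ → List Triple
  collect zero = []
  collect (suc n) = triples (suc n) ++ collect n

  partner-sum : ∀ {j} → j ≤ Q′ → partner j + j ≡ suc (Q + Q′)
  partner-sum j≤ = m∸n+n≡m (≤-trans j≤ (≤-trans (m≤n+m Q′ Q) (n≤1+n _)))

  -- Stopping at Q′ = Q - 3 keeps the partners at Q + 1 or more, beyond √N, so that no window serves
  -- on both sides.
  partner≥ : ∀ {j} → j ≤ Q′ → suc Q ≤ partner j
  partner≥ {j} j≤ = +-cancelʳ-≤ j (suc Q) (partner j) (≤-trans (+-monoʳ-≤ (suc Q) j≤) (≤-reflexive (sym (partner-sum j≤))))

  ∈-window : ∀ {p} i → p ∈ window i → Prime p × i * z < p × p ≤ suc i * z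
  ∈-window i p∈ = let a , b , c = ∈-primesIn (i * z) z p∈ in a , b , ≤-trans c (≤-reflexive (+-comm (i * z) z))

  triples-many : ∀ j → 1 ≤ j → j ≤ Q′ → count (j * z) z ≤ 2 * length (triples j) + 1
  triples-many j 1≤j j≤ = subst (_≤ 2 * length (triples j) + 1) (length-primesIn (j * z) z) (length-triplesOf (window j) (window (partner j))
    (≤-trans (subst₂ (λ a b → a ≤ 2 * b) (sym (length-primesIn (j * z) z)) (sym (length-primesIn (partner j * z) z))
      (equidistributed (partner j) j (≤-trans (s≤s z≤n) (partner≥ j≤)) partner<A 1≤j (≤-trans (s≤s j≤) (≤-trans (s≤s (m≤n+m Q′ 2)) (m≤m+n Q (Q + 0)))))) (m≤m+n _ 1)))
    where
    partner<A : suc (partner j) ≤ 2 * Q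
    partner<A = ≤-trans (s≤s (m∸n≤m (suc (Q + Q′)) j)) (≤-trans (s≤s (s≤s (n≤1+n _))) (≤-reflexive (r Q′)))
      where
      r : ∀ q → suc (suc (suc (3 + q + q))) ≡ 2 * (3 + q)
      r = solve-∀

  -- The last n allows one unpaired prime per window; π z stands for the primes below the first
  -- window.
  collect-many : ∀ n → n ≤ Q′ → π (suc n * z) ≤ π z + 2 * length (collect n) + n
  collect-many zero _ = ≤-reflexive (trans (cong π (*-identityˡ z)) (r (π z)))
    where
    r : ∀ x → x ≡ x + 0 + 0
    r = solve-∀
  collect-many (suc n) n<Q′ = begin
    π (suc (suc n) * z) ≡⟨ trans (cong π (+-comm z (suc n * z))) (π-count (suc n * z) z) ⟩
    π (suc n * z) + count (suc n * z) z ≤⟨ +-mono-≤ (collect-many n (<⇒≤ n<Q′)) (triples-many (suc n) (s≤s z≤n) n<Q′) ⟩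
    π z + 2 * length (collect n) + n + (2 * length (triples (suc n)) + 1) ≡⟨ r (π z) (length (collect n)) n (length (triples (suc n))) ⟩
    π z + 2 * (length (triples (suc n)) + length (collect n)) + suc n ≡⟨ cong (λ t → π z + 2 * t + suc n) (sym (length-++ (triples (suc n)))) ⟩
    π z + 2 * length (collect (suc n)) + suc n ∎
    where
    r : ∀ a b n c → a + 2 * b + n + (2 * c + 1) ≡ a + 2 * (c + b) + suc n
    r = solve-∀

  -- The windows close in on √N from both sides; the next pair of windows lies in the gap between
  -- the two conditions, which is why no prime is used twice.
  Used : ℕ → ℕ → Set
  Used n x = Prime x × (x ≤ suc n * z ⊎ partner n * z < x)

  partner-suc : ∀ {n} → suc n ≤ Q′ → suc (partner (suc n)) ≡ partner n
  partner-suc {n} n< = +-cancelʳ-≡ n (suc (partner (suc n))) (partner n) (trans (sym (+-suc (partner (suc n)) n)) (trans (partner-sum n<) (sym (partner-sum (<⇒≤ n<)))))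

  used : ∀ n → n ≤ Q′ → ∀ x → x ∈ flat (collect n) → Used n x
  used (suc n) n< x x∈ with ∈-++⁻ (flat (triples (suc n))) (subst (x ∈_) (flat-++ (triples (suc n)) (collect n)) x∈)
  ... | inj₁ i with ∈-flat-triplesOf (window (suc n)) (window (partner (suc n))) i
  ... | inj₁ j = let a , _ , c = ∈-window (suc n) j in a , inj₁ c
  ... | inj₂ j = let a , b , _ = ∈-window (partner (suc n)) j in a , inj₂ b
  used (suc n) n< x x∈ | inj₂ i with used n (<⇒≤ n<) x i
  ... | a , inj₁ b = a , inj₁ (≤-trans b (*-monoˡ-≤ z (n≤1+n (suc n))))
  ... | a , inj₂ b = a , inj₂ (≤-<-trans (*-monoˡ-≤ z (≤-trans (n≤1+n _) (≤-reflexive (partner-suc n<)))) b)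

  windows-apart : ∀ {j} → j ≤ Q′ → suc j * z ≤ partner j * z
  windows-apart {j} j≤ = *-monoˡ-≤ z (≤-trans (s≤s (≤-trans j≤ (m≤n+m Q′ 3))) (partner≥ j≤))

  unique-collect : ∀ n → n ≤ Q′ → Unique (flat (collect n))
  unique-collect zero _ = []
  unique-collect (suc n) n< = subst Unique (sym (flat-++ (triples (suc n)) (collect n)))
    (Uniq.++⁺ (unique-triplesOf (window (suc n)) (window (partner (suc n))) (primesIn-unique (suc n * z) z) (primesIn-unique (partner (suc n) * z) z)
        (λ x i j → <⇒≱ (proj₁ (proj₂ (∈-window (partner (suc n)) j))) (≤-trans (proj₂ (proj₂ (∈-window (suc n) i))) (windows-apart n<))))
      (unique-collect n (<⇒≤ n<)) disjoint)
    where
    disjoint : ∀ {x} → x ∈ flat (triples (suc n)) × x ∈ flat (collect n) → ⊥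
    disjoint {x} (i , j) with ∈-flat-triplesOf (window (suc n)) (window (partner (suc n))) i | used n (<⇒≤ n<) x j
    ... | inj₁ a | _ , inj₁ b = <⇒≱ (proj₁ (proj₂ (∈-window (suc n) a))) b
    ... | inj₁ a | _ , inj₂ b = <⇒≱ b (≤-trans (proj₂ (proj₂ (∈-window (suc n) a))) (≤-trans (windows-apart n<) (*-monoˡ-≤ z (≤-trans (n≤1+n _) (≤-reflexive (partner-suc n<))))))
    ... | inj₂ a | _ , inj₁ b = <⇒≱ (proj₁ (proj₂ (∈-window (partner (suc n)) a))) (≤-trans b (≤-trans (*-monoˡ-≤ z (n≤1+n (suc n))) (windows-apart n<)))
    ... | inj₂ a | _ , inj₂ b = <⇒≱ b (≤-trans (proj₂ (proj₂ (∈-window (partner (suc n)) a))) (≤-reflexive (cong (_* z) (partner-suc n<))))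

  Qz² : Q * Q * (z * z) ≤ N
  Qz² = ≤-trans (≤-reflexive (r Q z)) (≤-trans (*-mono-≤ Qz≤M Qz≤M) (proj₁ (isqrt-spec N)))
    where
    r : ∀ q z → q * q * (z * z) ≡ q * z * (q * z)
    r = solve-∀

  fits : ∀ n → n ≤ Q′ → ∀ t → t ∈ collect n → Fits N t
  fits (suc n) n< t t∈ with ∈-++⁻ (triples (suc n)) t∈
  ... | inj₂ i = fits n (<⇒≤ n<) t i
  ... | inj₁ i with t | ∈-triplesOf (window (suc n)) (window (partner (suc n))) i
  ... | p , q , r | a , b , c = product-fits {p} {q} {suc j} {suc j} p≤ q≤ (*-mono-≤ j≤Q j≤Q) , product-fits {p} {r} {suc j} {suc (partner j)} p≤ r≤ balanced , product-fits {q} {r} {suc j} {suc (partner j)} q≤ r≤ balanced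
    where
    j = suc n
    p≤ = proj₂ (proj₂ (∈-window j a))
    q≤ = proj₂ (proj₂ (∈-window j b))
    r≤ = proj₂ (proj₂ (∈-window (partner j) c))
    product-fits : ∀ {x y u v} → x ≤ u * z → y ≤ v * z → u * v ≤ Q * Q → x * y ≤ N
    product-fits {x} {y} {u} {v} hx hy huv = ≤-trans (*-mono-≤ hx hy) (≤-trans (≤-reflexive (e u v z)) (≤-trans (*-monoˡ-≤ (z * z) huv) Qz²))
      where
      e : ∀ u v z → u * z * (v * z) ≡ u * v * (z * z)
      e = solve-∀
    j≤Q : suc j ≤ Q
    j≤Q = s≤s (≤-trans n< (m≤n+m Q′ 2))
    balanced : suc j * suc (partner j) ≤ Q * Q
    balanced = *-cancelˡ-≤ 4 (by-lin (2ab≤a²+b² (suc j) (suc (partner j))) (≤-reflexive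
      (subst (λ w → suc j * suc j + suc (partner j) * suc (partner j) + 4 * (suc j * suc (partner j)) ≡ 2 * (suc j * suc (partner j)) + w) square (e (suc j) (suc (partner j))))))
      where
      e : ∀ a b → a * a + b * b + 4 * (a * b) ≡ 2 * (a * b) + (a + b) * (a + b)
      e = solve-∀
      total : suc j + suc (partner j) ≡ 2 * Q
      total = trans (e₁ j (partner j)) (trans (cong (λ s → suc (suc s)) (partner-sum n<)) (e₂ Q′))
        where
        e₁ : ∀ a b → suc a + suc b ≡ suc (suc (b + a))
        e₁ = solve-∀
        e₂ : ∀ q → suc (suc (suc (3 + q + q))) ≡ 2 * (3 + q)
        e₂ = solve-∀
      square : (suc j + suc (partner j)) * (suc j + suc (partner j)) ≡ 4 * (Q * Q)
      square = trans (cong₂ _*_ total total) (e₃ Q)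
        where
        e₃ : ∀ q → 2 * q * (2 * q) ≡ 4 * (q * q)
        e₃ = solve-∀

  ts : List Triple
  ts = collect Q′
  primesN singles elements : List ℕ
  primesN = filter prime? (upTo (suc N))
  singles = filter (λ x → ¬? (x ∈? flat ts)) primesN
  elements = quads ts singles

  ∈-singles : ∀ {x} → x ∈ singles → Prime x × x ≤ N × x ∉ flat ts
  ∈-singles i with ∈-filter⁻ (λ x → ¬? (x ∈? flat ts)) {xs = primesN} i
  ... | j , x∉ with ∈-filter⁻ prime? {xs = upTo (suc N)} j
  ... | j′ , px = px , ≤-pred (∈-upTo⁻ j′) , x∉

  unique-primesN : Unique primesN
  unique-primesN = Uniq.filter⁺ prime? (Uniq.upTo⁺ (suc N))

  all-prime : LAll.All Prime (flat ts ++ singles)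
  all-prime = LAllP.++⁺ (LAll.tabulate (λ i → proj₁ (used Q′ ≤-refl _ i))) (LAll.tabulate (λ i → proj₁ (∈-singles i)))

  all-unique : Unique (flat ts ++ singles)
  all-unique = Uniq.++⁺ (unique-collect Q′ ≤-refl) (Uniq.filter⁺ (λ x → ¬? (x ∈? flat ts)) unique-primesN) (λ (i , j) → proj₂ (proj₂ (∈-singles j)) i)

  -- For each triple three primes leave the list of all primes and four elements enter.
  enough : primeCount N + length ts ≤ length elements
  enough = begin
    primeCount N + length ts ≤⟨ +-monoˡ-≤ (length ts) (≤-trans (length-removed (flat ts) unique-primesN) (≤-reflexive (cong (length singles +_) (length-flat ts)))) ⟩
    length singles + 3 * length ts + length ts ≡⟨ e (length singles) (length ts) ⟩
    4 * length ts + length singles ≡⟨ sym (length-quads ts singles) ⟩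
    length elements ∎
    where
    e : ∀ a b → a + 3 * b + b ≡ 4 * b + a
    e = solve-∀

  -- A prime up to √N ≤ (4 + Q′) z either lies in one of the windows 1 to Q′, where two primes make
  -- a triple, or is among those that `few-lost` bounds.
  gain : k * primeCountSqrt N ≤ 2 * (k * length ts) + 2 * primeCountSqrt N
  gain = subst (λ s → k * s ≤ 2 * (k * length ts) + 2 * s) (sym (primeCountSqrt-π N))
    (by-lin (+-mono-≤ few-lost (+-mono-≤ (*-monoʳ-≤ k (collect-many Q′ ≤-refl)) (+-mono-≤ (*-monoʳ-≤ k (∑-rng-mono prime-indicator M≤)) (*-monoʳ-≤ 2 (∑-rng-mono prime-indicator Qz≤M)))))
      (≤-trans (m≤m+n _ (3 * k)) (≤-reflexive (e (π (Q * z)) k (π ((1 + Q′) * z)) (π z) (length ts) Q′ (π ((4 + Q′) * z)) (π M)))))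
    where
    prime-indicator : ℕ → ℕ
    prime-indicator p = ⟦ prime? p ⟧
    e : ∀ q k u a t Q b m → 2 * q + k * u + (k * (a + 2 * t + Q) + (k * b + 2 * m)) + k * m + 3 * k
      ≡ k * (3 + Q + a + b) + (k * u + (k * m + 2 * q)) + (2 * (k * t) + 2 * m)
    e = solve-∀

  result : Σ ℕ λ n → Σ (Vec ℕ n) λ A → All (Admissible N) A × DistinctSubsetProducts A ×
    (2 * k * primeCount N + k * primeCountSqrt N ≤ 2 * k * n + 2 * primeCountSqrt N)
  result = length elements , fromList elements ,
    quads-admissible ts singles all-prime all-unique (fits Q′ ≤-refl) (λ s i → proj₁ (proj₂ (∈-singles i))) ,
    (λ B C B≢C e → B≢C (quads-injective ts singles all-prime all-unique B C e)) ,
    by-lin (+-mono-≤ (*-monoʳ-≤ (2 * k) enough) gain) (≤-reflexive (e k (length elements) (length ts) (primeCountSqrt N) (primeCount N)))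
    where
    e : ∀ k n t s p → 2 * k * n + (2 * (k * t) + 2 * s) + (2 * k * p + k * s) ≡ 2 * k * (p + t) + k * s + (2 * k * n + 2 * s)
    e = solve-∀

-- After division by 2 k the inequality reads n ≥ π (N) + (1 / 2 - 1 / k) π (√N); letting k grow
-- slowly with N gives the error term o(π (√N)).
theorem1p6 : (k : ℕ) → 1 ≤ k → Σ ℕ λ N₀ → (N : ℕ) → N₀ ≤ N →
    Σ ℕ λ n → Σ (Vec ℕ n) λ A →
    All (Admissible N) A × DistinctSubsetProducts A ×
    (2 * k * primeCount N + k * primeCountSqrt N ≤ 2 * k * n + 2 * primeCountSqrt N)
theorem1p6 k 1≤k = (Q * (z₀ + Q)) * (Q * (z₀ + Q)) , λ N N-large →
  let M = isqrt N
      z = M ÷ Q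
      M-large : Q * (z₀ + Q) ≤ M
      M-large = ≤-pred (≰⇒> λ h → <⇒≱ (proj₂ (isqrt-spec N)) (≤-trans (*-mono-≤ h h) N-large))
      z-large : z₀ + Q ≤ z
      z-large = ÷-greatest {d = Q} (s≤s z≤n) (≤-trans (≤-reflexive (*-comm (z₀ + Q) Q)) M-large)
      Qz≤M : Q * z ≤ M
      Qz≤M = ≤-trans (≤-reflexive (*-comm Q z)) (÷-lower M Q)
      -- M < Q z + Q and Q ≤ z; this is why the threshold contains z₀ + Q.
      M≤ : M ≤ (4 + Q′) * z
      M≤ = ≤-trans (<⇒≤ (÷-upper M {Q} (s≤s z≤n))) (+-mono-≤ (≤-trans (m≤n+m Q z₀) z-large) (≤-reflexive (*-comm z Q)))
      z₀≤z : z₀ ≤ z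
      z₀≤z = ≤-trans (m≤m+n z₀ Q) z-large
  in Matching.result k Q′ N z Qz≤M M≤ (Large.equidistributed z z₀≤z) (Large.few-lost z z₀≤z)
  where
  open Windows k 1≤k using (Q; Q′; z₀; module Large)
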